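{- For all integers $\ell \geq 1$ there exists an integer $k$ such that every $2$-connected graph $G$ with a $\Gamma_k$ minor contains $\Gamma_{\ell}^{+}$ or $\nabla_\ell$ as a minor.
   Context: All graphs are finite and simple. For $\ell\ge 0$, $\Gamma_\ell$ denotes the complete binary tree of height $\ell$: the rooted tree in which every non-leaf vertex has exactly two children, with $2^\ell$ leaves and every root-to-leaf path having exactly $\ell$ edges. $\Gamma_\ell^+$ is obtained from $\Gamma_\ell$ by adding one new vertex adjacent to all leaves of $\Gamma_\ell$. The graphs $\nabla_\ell$ ($\ell\ge1$), each with a designated root edge, are defined recursively: $\nabla_1$ is a triangle with one edge designated as root edge; $\nabla_{\ell+1}$ is obtained by taking two disjoint copies of $\nabla_\ell$ with root edges $e_1,e_2$ and a triangle with edges $e_1',e_2',e_3$, identifying $e_i$ with $e_i'$ for $i=1,2$, and declaring $e_3$ the root edge. -}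

module Defs where

open import Data.Nat using (ℕ; zero; suc; _≤_; pred)
open import Data.Fin using (Fin)
open import Data.Bool using (Bool; true; false)
open import Data.List using (List; []; _∷_; length)
open import Data.Maybe using (Maybe; just; nothing)
open import Data.Unit using (⊤; tt)
open import Data.Sum using (_⊎_; inj₁; inj₂)
open import Data.Product using (Σ; ∃; ∃-syntax; _×_; _,_; proj₁)
open import Relation.Binary.PropositionalEquality using (_≡_; _≢_)

record Graph : Set where
  field
    n      : ℕ
    adj    : Fin n → Fin n → Bool
    sym    : ∀ x y → adj x y ≡ adj y x
    irrefl : ∀ x → adj x x ≡ false
open Graph public

data WalkIn (G : Graph) (S : Fin (n G) → Set) : Fin (n G) → Fin (n G) → Set where
  stop : ∀ {x} → S x → WalkIn G S x x
  step : ∀ {x y z} → S x → adj G x y ≡ true → WalkIn G S y z → WalkIn G S x z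

ConnectedSet : (G : Graph) → (Fin (n G) → Set) → Set
ConnectedSet G S = (∃[ x ] S x) × (∀ x y → S x → S y → WalkIn G S x y)

-- 2-connected (Diestel): |G| > 2 and G - X connected for every X with |X| < 2.
TwoConnected : Graph → Set
TwoConnected G =
  (3 ≤ n G)
  × ConnectedSet G (λ _ → ⊤)
  × (∀ v → ConnectedSet G (λ x → x ≢ v))

record Pattern : Set₁ where
  field
    V : Set
    E : V → V → Set
open Pattern public

record MinorModel (H : Pattern) (G : Graph) : Set where
  field
    branch    : V H → Fin (n G) → Bool
    connected : ∀ h → ConnectedSet G (λ x → branch h x ≡ true)
    disjoint  : ∀ h h' x → branch h x ≡ true → branch h' x ≡ true → h ≡ h'
    edges     : ∀ h h' → E H h h' →
                ∃[ x ] ∃[ y ] (branch h x ≡ true × branch h' y ≡ true × adj G x y ≡ true)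

_≼_ : Pattern → Graph → Set
H ≼ G = MinorModel H G

TreeV : ℕ → Set
TreeV ℓ = Σ (List Bool) (λ s → length s ≤ ℓ)

Child : ∀ {ℓ} → TreeV ℓ → TreeV ℓ → Set
Child x y = ∃[ b ] (proj₁ y ≡ b ∷ proj₁ x)

TreeE : ∀ {ℓ} → TreeV ℓ → TreeV ℓ → Set
TreeE x y = Child x y ⊎ Child y x

Γ : ℕ → Pattern
Γ ℓ = record { V = TreeV ℓ ; E = TreeE }

PlusE : ∀ ℓ → Maybe (TreeV ℓ) → Maybe (TreeV ℓ) → Set
PlusE ℓ (just x) (just y) = TreeE x y
PlusE ℓ (just x) nothing  = length (proj₁ x) ≡ ℓ
PlusE ℓ nothing  (just y) = length (proj₁ y) ≡ ℓ
PlusE ℓ nothing  nothing  = Data.Empty.⊥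
  where import Data.Empty

Γ⁺ : ℕ → Pattern
Γ⁺ ℓ = record { V = Maybe (TreeV ℓ) ; E = PlusE ℓ }

-- ∇: level m represents ∇_{m+1}.  Vertices: the two root-edge ends
-- (left, right) and inner vertices.  Level 0 is a triangle on
-- left, right, inner tt.  Level m+1: a new top vertex (inner (inj₁ tt))
-- called M; copy 1 of level m glued with its root edge onto left–M,
-- copy 2 glued with its root edge onto M–right; new root edge left–right.

Inner : ℕ → Set
Inner zero    = ⊤
Inner (suc m) = ⊤ ⊎ (Inner m ⊎ Inner m)

data NV (m : ℕ) : Set where
  left right : NV m
  inner      : Inner m → NV m

emb₁ : ∀ {m} → NV m → NV (suc m)
emb₁ left      = left
emb₁ right     = inner (inj₁ tt)
emb₁ (inner i) = inner (inj₂ (inj₁ i))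

emb₂ : ∀ {m} → NV m → NV (suc m)
emb₂ left      = inner (inj₁ tt)
emb₂ right     = right
emb₂ (inner i) = inner (inj₂ (inj₂ i))

RootE : ∀ {m} → NV m → NV m → Set
RootE u v = (u ≡ left × v ≡ right) ⊎ (u ≡ right × v ≡ left)

NE : ∀ m → NV m → NV m → Set
NE zero    u v = u ≢ v
NE (suc m) u v =
  RootE u v
  ⊎ (∃[ a ] ∃[ b ] (NE m a b × u ≡ emb₁ a × v ≡ emb₁ b))
  ⊎ (∃[ a ] ∃[ b ] (NE m a b × u ≡ emb₂ a × v ≡ emb₂ b))

-- ∇ ℓ is ∇_ℓ for ℓ ≥ 1 (the value at ℓ = 0 is an unused junk value).
∇ : ℕ → Pattern
∇ ℓ = record { V = NV (pred ℓ) ; E = NE (pred ℓ) }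

{-# OPTIONS --safe #-}
-- Fix ℓ.  If some connected set A misses a binary tree of height ℓ all of whose leaves touch A, then A is the apex of
-- a Γ⁺ minor, so assume that this never happens.  Three facts are used repeatedly.
-- (1) A connected region K of a 2-connected graph that carries a huge tree contains a 2-connected subgraph that
-- carries a large tree: otherwise the tree is spread over the blocks of K, and since every end of the block
-- structure touches the outside of K, the outside is the apex of a Γ⁺ minor (blockOrCut, crown).
-- (2) Such a 2-connected piece is joined to any prescribed part of the graph by two disjoint paths (menger, attach).
-- (3) Two disjoint paths with prescribed ends can be rerouted so as to spare a large subtree (route).
-- Given a 2-connected H with distinct vertices a, b and a huge tree, (1)–(3) give a path from a to b, and parallel to
-- it two disjoint 2-connected pieces, each with a large tree, that are arranged in series or in parallel
-- between a and b (bypass, stage₁, stage₂, arrange).  Recursion into the pieces (solve) yields a binary tree of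
-- series and parallel steps; many nested series steps make ∇, many nested parallel steps make a tree whose leaves
-- touch a common connected set, that is Γ⁺.
module Submission where

open import Defs
open import Data.Nat using (ℕ; zero; suc; _+_; _∸_; _≤_; _<_; z≤n; s≤s)
open import Data.Nat.Properties using (≤-refl; ≤-trans; ≤-reflexive; ≤-irrelevant; +-mono-≤; +-suc; m∸n+n≡m; m≤m+n; m≤n+m; m≤n⇒m≤1+n; m≢1+n+m)
open import Data.Nat.Induction using (<-wellFounded)
open import Induction.WellFounded using (Acc; acc)
open import Data.Bool using (Bool; true; false; _∧_; _∨_; not; if_then_else_)
import Data.Bool.Properties as Bool
open import Data.Fin using (Fin; zero; suc; _≟_)
open import Data.Fin.Properties using (any?)
open import Data.List using (List; []; _∷_; _++_; length; reverse; _∷ʳ_; map; filter; allFin; cartesianProduct)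
open import Data.List.Properties using (∷-injectiveˡ; ∷-injectiveʳ; ++-assoc; length-++; length-reverse; unfold-reverse; reverse-injective)
open import Data.List.Relation.Unary.Any using (here; there)
import Data.List.Membership.Propositional as List
open import Data.List.Membership.Propositional.Properties using (∈-map⁺; ∈-map⁻; ∈-filter⁺; ∈-filter⁻; ∈-allFin; ∈-cartesianProduct⁺)
open import Data.Maybe using (Maybe; just; nothing)
open import Data.Unit using (tt)
open import Data.Product using (Σ; ∃-syntax; _×_; _,_; proj₁; proj₂)
open import Data.Sum using (_⊎_; inj₁; inj₂; [_,_]′)
open import Data.Empty using (⊥; ⊥-elim)
open import Function using (_∘_)
open import Relation.Nullary using (¬_; Dec; yes; no; does)
open import Relation.Nullary.Decidable using (_×-dec_; ¬?; dec-true; decidable-stable)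
open import Relation.Binary.PropositionalEquality using (_≡_; _≢_; refl; trans; cong; subst) renaming (sym to ≡-sym)

-- Why the recursion closes: series and parallel steps are dual. In series a crown in one piece is
-- enough, since everything else is absorbed into its root and apex, while ∇ grows only if both
-- pieces yield it; in parallel one ∇ is enough and the tree grows only if both pieces yield crowns.
-- So a series step asks for `p - 1` and `q`, a parallel step for `p` and `q - 1`, as in
-- off-diagonal Ramsey recursions. For this to compose, every outcome is anchored at prescribed
-- vertices: `a` lies in one root end or in the root of the tree, `b` in the other root end or in
-- the apex. The obstacle is to obtain two disjoint 2-connected pieces, each held at two distinct
-- vertices, in a controlled position. The first piece hangs at the far ends of two disjoint strands
-- starting at `a` and `b`; the second hangs with two feet on these strands. Feet on the same strand
-- give series, feet on different strands give parallel. An edge joining the `a` side to the `b`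
-- side is reserved beforehand, because a series step needs it as the root edge of the glued ∇.

count : ∀ {m} → (Fin m → Bool) → ℕ
count {zero}  f = 0
count {suc m} f = (if f zero then 1 else 0) + count (f ∘ suc)

private
  bit-mono : ∀ a b → (a ≡ true → b ≡ true) → (if a then 1 else 0) ≤ (if b then 1 else 0)
  bit-mono false b     h = z≤n
  bit-mono true  true  h = s≤s z≤n
  bit-mono true  false h with () ← h refl

count-≤ : ∀ {m} (f g : Fin m → Bool) → (∀ x → f x ≡ true → g x ≡ true) → count f ≤ count g
count-≤ {zero}  f g h = z≤n
count-≤ {suc m} f g h = +-mono-≤ (bit-mono _ _ (h zero)) (count-≤ (f ∘ suc) (g ∘ suc) (h ∘ suc))

count-< : ∀ {m} (f g : Fin m → Bool) → (∀ x → f x ≡ true → g x ≡ true) →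
          ∀ v → f v ≡ false → g v ≡ true → count f < count g
count-< {suc m} f g h zero    p q rewrite p | q = s≤s (count-≤ (f ∘ suc) (g ∘ suc) (h ∘ suc))
count-< {suc m} f g h (suc v) p q =
  ≤-trans (≤-reflexive (≡-sym (+-suc _ _)))
          (+-mono-≤ (bit-mono _ _ (h zero)) (count-< (f ∘ suc) (g ∘ suc) (h ∘ suc) v p q))

-- One more level of a crown takes two calls of `blockOrCut`, each setting aside `n` levels for a
-- possible block, and one level in between for a pruning.
crown-height : ℕ → ℕ → ℕ
crown-height n zero    = 0
crown-height n (suc q) = n + suc (n + crown-height n q)

-- Avoiding a vertex costs one level, because it lies in at most one of two sibling subtrees; a
-- detour costs two levels and a route four; the single `suc` in `stage₁-height` pays for separating
-- the children of a node. The constants fit together: `suc (step-height w k)` is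
-- `stage₁-height w (7 + attach-height w k)`, and `8 + attach-height w k` is `stage₂-height w k`.
attach-height stage₁-height stage₂-height bypass-height step-height : ℕ → ℕ → ℕ
attach-height w m = suc m + crown-height (suc m) w
stage₁-height w m = 2 + suc (4 + attach-height w m)
stage₂-height w k = 4 + (4 + attach-height w k)
bypass-height w k = 2 + (2 + attach-height w k)
step-height   w k = 6 + attach-height w (7 + attach-height w k)

-- Whether the pieces end up in series or in parallel is known only after they are found, so they
-- must be large enough for both recursive calls; the sum is a common upper bound.
solve-height : ℕ → ℕ → ℕ → ℕ
solve-height w zero    q       = bypass-height w 0
solve-height w (suc p) zero    = bypass-height w 0
solve-height w (suc p) (suc q) = bypass-height w (step-height w (solve-height w p (suc q) + solve-height w (suc p) q))

module Minors (G : Graph) where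

  -- Vertex sets and walks

  Vertex : Set
  Vertex = Fin (n G)

  Sub : Set
  Sub = Vertex → Bool

  infix 4 _∈_ _∉_ _⊆_ _~_
  infixr 6 _∪_
  infixl 7 _∖_ _∩_

  record _∈_ (x : Vertex) (S : Sub) : Set where
    constructor mem
    field holds : S x ≡ true

  _∉_ : Vertex → Sub → Set
  x ∉ S = ¬ (x ∈ S)

  _⊆_ : Sub → Sub → Set
  A ⊆ B = ∀ {x} → x ∈ A → x ∈ B

  Disj : Sub → Sub → Set
  Disj A B = ∀ {x} → x ∈ A → x ∈ B → ⊥

  infix 4 _∈?_
  _∈?_ : ∀ x S → Dec (x ∈ S)
  x ∈? S with S x in eq
  ... | true  = yes (mem eq)
  ... | false = no λ { (mem p) → case-absurd (trans (≡-sym eq) p) }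
    where case-absurd : false ≡ true → ⊥
          case-absurd ()

  ∉⇒false : ∀ {x S} → x ∉ S → S x ≡ false
  ∉⇒false {x} {S} x∉ with S x in eq
  ... | true  = ⊥-elim (x∉ (mem eq))
  ... | false = refl

  opaque
    _∪_ _∩_ _∖_ : Sub → Sub → Sub
    (A ∪ B) x = A x ∨ B x
    (A ∩ B) x = A x ∧ B x
    (A ∖ B) x = A x ∧ not (B x)

    ⁅_⁆ : Vertex → Sub
    ⁅ v ⁆ x = does (x ≟ v)

    ∪ˡ : ∀ {A B} → A ⊆ A ∪ B
    ∪ˡ {A} {B} {x} (mem p) = mem (lem p)
      where lem : ∀ {a b} → a ≡ true → a ∨ b ≡ true
            lem refl = refl

    ∪ʳ : ∀ {A B} → B ⊆ A ∪ B
    ∪ʳ {A} {B} {x} (mem p) = mem (lem (A x) p)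
      where lem : ∀ a {b} → b ≡ true → a ∨ b ≡ true
            lem true  q = refl
            lem false q = q

    ∪⁻ : ∀ {A B x} → x ∈ A ∪ B → x ∈ A ⊎ x ∈ B
    ∪⁻ {A} {B} {x} (mem p) with A x in eq
    ... | true  = inj₁ (mem eq)
    ... | false = inj₂ (mem p)

    ∩⁺ : ∀ {A B x} → x ∈ A → x ∈ B → x ∈ A ∩ B
    ∩⁺ {A} {B} {x} (mem p) (mem q) = mem (lem p q)
      where lem : ∀ {a b} → a ≡ true → b ≡ true → a ∧ b ≡ true
            lem refl refl = refl

    ∩⁻ : ∀ {A B x} → x ∈ A ∩ B → x ∈ A × x ∈ B
    ∩⁻ {A} {B} {x} (mem p) with A x in eq
    ... | true = mem eq , mem p

    ∖⁺ : ∀ {A B x} → x ∈ A → x ∉ B → x ∈ A ∖ B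
    ∖⁺ {A} {B} {x} (mem p) q = mem (lem p (∉⇒false q))
      where lem : ∀ {a b} → a ≡ true → b ≡ false → a ∧ not b ≡ true
            lem refl refl = refl

    ∖⁻ : ∀ {A B x} → x ∈ A ∖ B → x ∈ A × x ∉ B
    ∖⁻ {A} {B} {x} (mem p) with A x in eq | B x in eq′
    ... | true | false = mem eq , λ { (mem q) → absurd (trans (≡-sym eq′) q) }
      where absurd : false ≡ true → ⊥
            absurd ()

    ∖ˡ : ∀ {A B} → A ∖ B ⊆ A
    ∖ˡ p = proj₁ (∖⁻ p)

    ∖ʳ : ∀ {A B} → Disj (A ∖ B) B
    ∖ʳ p = proj₂ (∖⁻ p)

    ⁅⁆⁺ : ∀ {x} → x ∈ ⁅ x ⁆
    ⁅⁆⁺ {x} = mem (dec-true (x ≟ x) refl)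

    ⁅⁆⁻ : ∀ {x v} → x ∈ ⁅ v ⁆ → x ≡ v
    ⁅⁆⁻ {x} {v} (mem p) with x ≟ v
    ... | yes q = q

  ≢⇒∉ : ∀ {x v} → x ≢ v → x ∉ ⁅ v ⁆
  ≢⇒∉ x≢v p = x≢v (⁅⁆⁻ p)

  ⁅⁆⊆ : ∀ {v A} → v ∈ A → ⁅ v ⁆ ⊆ A
  ⁅⁆⊆ v∈A p with refl ← ⁅⁆⁻ p = v∈A

  ∪⊆ : ∀ {A B C} → A ⊆ C → B ⊆ C → A ∪ B ⊆ C
  ∪⊆ f g p with ∪⁻ p
  ... | inj₁ a = f a
  ... | inj₂ b = g b

  ∪-mono : ∀ {A B C D} → A ⊆ C → B ⊆ D → A ∪ B ⊆ C ∪ D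
  ∪-mono {C = C} {D} f g p with ∪⁻ p
  ... | inj₁ a = ∪ˡ {C} {D} (f a)
  ... | inj₂ b = ∪ʳ {C} {D} (g b)

  disj-∪ : ∀ {A B C} → Disj A C → Disj B C → Disj (A ∪ B) C
  disj-∪ f g p q with ∪⁻ p
  ... | inj₁ a = f a q
  ... | inj₂ b = g b q

  disj-∪ʳ : ∀ {A B C} → Disj C A → Disj C B → Disj C (A ∪ B)
  disj-∪ʳ f g q p with ∪⁻ p
  ... | inj₁ a = f q a
  ... | inj₂ b = g q b

  disj-sym : ∀ {A B} → Disj A B → Disj B A
  disj-sym d p q = d q p

  size : Sub → ℕ
  size = count

  size-< : ∀ {A B v} → A ⊆ B → v ∈ B → v ∉ A → size A < size B
  size-< {A} {B} {v} sub (mem p) v∉ =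
    count-< A B (λ x q → _∈_.holds (sub (mem q))) v (∉⇒false v∉) p

  data Walk (E : Vertex → Vertex → Set) (A : Sub) : Vertex → Vertex → Set where
    nil  : ∀ {x} → x ∈ A → Walk E A x x
    cons : ∀ {x y z} → x ∈ A → E x y → Walk E A y z → Walk E A x z

  module _ {E : Vertex → Vertex → Set} where

    mapW : ∀ {A B x y} → A ⊆ B → Walk E A x y → Walk E B x y
    mapW f (nil p)      = nil (f p)
    mapW f (cons p e w) = cons (f p) e (mapW f w)

    infixr 5 _++W_
    _++W_ : ∀ {A x y z} → Walk E A x y → Walk E A y z → Walk E A x z
    nil _      ++W v = v
    cons p e w ++W v = cons p e (w ++W v)

    start∈ : ∀ {A x y} → Walk E A x y → x ∈ A
    start∈ (nil p)      = p
    start∈ (cons p _ _) = p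

    end∈ : ∀ {A x y} → Walk E A x y → y ∈ A
    end∈ (nil p)      = p
    end∈ (cons _ _ w) = end∈ w

    -- The part of a walk before its first visit to Y.
    approach : ∀ {A Y x y} → Walk E A x y → x ∉ Y → y ∈ Y →
               ∃[ u ] ∃[ v ] (Walk E (A ∖ Y) x u × E u v × v ∈ Y × v ∈ A)
    approach (nil p) x∉ y∈ = ⊥-elim (x∉ y∈)
    approach {Y = Y} (cons {y = y₁} p e w) x∉ y∈ with y₁ ∈? Y
    ... | yes q = _ , _ , nil (∖⁺ p x∉) , e , q , start∈ w
    ... | no  q with approach w q y∈
    ...   | u , v , w′ , e′ , v∈ , v∈A = u , v , cons (∖⁺ p x∉) e w′ , e′ , v∈ , v∈A

    -- A walk can leave R only through s, so after its last visit to s it avoids R.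
    leave : ∀ {A R s x y} → (∀ {u w} → u ∈ R → E u w → w ∈ A → w ∈ R ⊎ w ≡ s) →
            Walk E A x y → y ∉ R → (x ∉ R × Walk E (A ∖ R) x y) ⊎ Walk E (A ∖ R) s y
    leave cl (nil p) y∉ = inj₁ (y∉ , nil (∖⁺ p y∉))
    leave {R = R} cl (cons {x = x} p e w) y∉ with leave cl w y∉
    ... | inj₂ v = inj₂ v
    ... | inj₁ (q , v) with x ∈? R
    ...   | no x∉ = inj₁ (x∉ , cons (∖⁺ p x∉) e v)
    ...   | yes x∈ with cl x∈ e (start∈ w)
    ...     | inj₁ y∈ = ⊥-elim (q y∈)
    ...     | inj₂ refl = inj₂ v

    stay : ∀ {A R x y} → (∀ {u w} → u ∈ A → u ∈ R → E u w → w ∈ A → w ∈ R) →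
           Walk E A x y → x ∈ R → Walk E (A ∩ R) x y
    stay cl (nil p) x∈ = nil (∩⁺ p x∈)
    stay cl (cons p e w) x∈ = cons (∩⁺ p x∈) e (stay cl w (cl p x∈ e (start∈ w)))

  _~_ : Vertex → Vertex → Set
  x ~ y = adj G x y ≡ true

  ~-sym : ∀ {x y} → x ~ y → y ~ x
  ~-sym {x} {y} p = trans (sym G y x) p

  _~?_ : ∀ x y → Dec (x ~ y)
  x ~? y = adj G x y Bool.≟ true

  Path : Sub → Vertex → Vertex → Set
  Path = Walk _~_

  revW : ∀ {A x y} → Path A x y → Path A y x
  revW (nil p)      = nil p
  revW (cons p e w) = revW w ++W cons (start∈ w) (~-sym e) (nil p)

  Touch : Sub → Sub → Set
  Touch A B = ∃[ x ] ∃[ y ] (x ∈ A × y ∈ B × x ~ y)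

  touch-sym : ∀ {A B} → Touch A B → Touch B A
  touch-sym (x , y , p , q , e) = y , x , q , p , ~-sym e

  touch-mono : ∀ {A B C D} → A ⊆ C → B ⊆ D → Touch A B → Touch C D
  touch-mono f g (x , y , p , q , e) = x , y , f p , g q , e

  record Conn (S : Sub) : Set where
    constructor conn
    field
      hub    : Vertex
      hub∈   : hub ∈ S
      to-hub : ∀ {x} → x ∈ S → Path S x hub
  open Conn public

  conn-walk : ∀ {S x y} → Conn S → x ∈ S → y ∈ S → Path S x y
  conn-walk c p q = to-hub c p ++W revW (to-hub c q)

  conn-⁅⁆ : ∀ {x} → Conn ⁅ x ⁆
  conn-⁅⁆ {x} = conn x ⁅⁆⁺ λ p → subst (λ y → Path ⁅ x ⁆ y x) (≡-sym (⁅⁆⁻ p)) (nil ⁅⁆⁺)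

  conn-absorb : ∀ {A B C} → A ⊆ C → C ⊆ A ∪ B → Conn A →
                (∀ {x} → x ∈ B → ∃[ y ] (y ∈ A × Path C x y)) → Conn C
  conn-absorb {A} {B} {C} A⊆C sub c f = conn (hub c) (A⊆C (hub∈ c)) go
    where
    go : ∀ {x} → x ∈ C → Path C x (hub c)
    go p with ∪⁻ {A} {B} (sub p)
    ... | inj₁ a = mapW A⊆C (to-hub c a)
    ... | inj₂ b with f b
    ...   | y , y∈ , w = w ++W mapW A⊆C (to-hub c y∈)

  conn-∪-meet : ∀ {A B x} → Conn A → Conn B → x ∈ A → x ∈ B → Conn (A ∪ B)
  conn-∪-meet {A} {B} {x} c d p q =
    conn-absorb {A} {B} ∪ˡ (λ r → r) c λ r → x , p , mapW (∪ʳ {A} {B}) (conn-walk d r q)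

  conn-∪-touch : ∀ {A B} → Conn A → Conn B → Touch A B → Conn (A ∪ B)
  conn-∪-touch {A} {B} c d (x , y , p , q , e) =
    conn-absorb {A} {B} ∪ˡ (λ r → r) c λ r →
      x , p , (mapW (∪ʳ {A} {B}) (conn-walk d r q) ++W
               cons (∪ʳ {A} {B} q) (~-sym e) (nil (∪ˡ {A} {B} p)))

  conn-≈ : ∀ {A B} → A ⊆ B → B ⊆ A → Conn A → Conn B
  conn-≈ f g c = conn (hub c) (f (hub∈ c)) λ p → mapW f (to-hub c (g p))

  trace : ∀ {A x y} → Path A x y → Sub
  trace (nil {x} _)      = ⁅ x ⁆
  trace (cons {x} _ _ w) = ⁅ x ⁆ ∪ trace w

  trace⊆ : ∀ {A x y} (w : Path A x y) → trace w ⊆ A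
  trace⊆ (nil p)      q = ⁅⁆⊆ p q
  trace⊆ (cons p _ w) q = ∪⊆ (⁅⁆⊆ p) (trace⊆ w) q

  start-trace : ∀ {A x y} (w : Path A x y) → x ∈ trace w
  start-trace (nil _) = ⁅⁆⁺
  start-trace (cons {x} _ _ w) = ∪ˡ {⁅ x ⁆} {trace w} ⁅⁆⁺

  end-trace : ∀ {A x y} (w : Path A x y) → y ∈ trace w
  end-trace (nil _) = ⁅⁆⁺
  end-trace (cons {x} _ _ w) = ∪ʳ {⁅ x ⁆} {trace w} (end-trace w)

  conn-trace : ∀ {A x y} (w : Path A x y) → Conn (trace w)
  conn-trace (nil _)      = conn-⁅⁆
  conn-trace (cons {x} _ e w) =
    conn-∪-touch conn-⁅⁆ (conn-trace w) (x , _ , ⁅⁆⁺ , start-trace w , e)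

  record Component (S : Sub) (x : Vertex) : Set where
    field
      set    : Sub
      ⊆S     : set ⊆ S
      has    : x ∈ set
      isConn : Conn set
      closed : ∀ {u v} → u ∈ set → v ∈ S → u ~ v → v ∈ set

  opaque
    component : ∀ S {x} → x ∈ S → Component S x
    component S {x} x∈S = grow ⁅ x ⁆ (⁅⁆⊆ x∈S) ⁅⁆⁺ conn-⁅⁆ (<-wellFounded _)
      where
      grow : ∀ C → C ⊆ S → x ∈ C → Conn C → Acc _<_ (size (S ∖ C)) → Component S x
      grow C C⊆S x∈C cC (acc rs)
        with any? (λ u → any? (λ v → (u ∈? C) ×-dec (v ∈? S ∖ C) ×-dec (u ~? v)))
      ... | no none = record
        { set = C ; ⊆S = C⊆S ; has = x∈C ; isConn = cC
        ; closed = λ {u} {v} u∈ v∈ e → decide u∈ v∈ e (v ∈? C) }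
        where
        decide : ∀ {u v} → u ∈ C → v ∈ S → u ~ v → Dec (v ∈ C) → v ∈ C
        decide u∈ v∈ e (yes p) = p
        decide u∈ v∈ e (no p)  = ⊥-elim (none (_ , _ , u∈ , ∖⁺ v∈ p , e))
      ... | yes (u , v , u∈ , v∈ , e) =
        grow (C ∪ ⁅ v ⁆) (∪⊆ C⊆S (⁅⁆⊆ (∖ˡ v∈))) (∪ˡ {C} x∈C)
          (conn-∪-touch cC conn-⁅⁆ (u , v , u∈ , ⁅⁆⁺ , e))
          (rs (size-< {S ∖ (C ∪ ⁅ v ⁆)} {S ∖ C} {v}
                 (λ p → ∖⁺ (∖ˡ p) λ q → ∖ʳ p (∪ˡ {C} q)) v∈
                 λ p → ∖ʳ p (∪ʳ {C} ⁅⁆⁺)))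

  conn-⊆ : ∀ {C R x} → (∀ {u w} → u ∈ C → u ∈ R → u ~ w → w ∈ C → w ∈ R) → Conn C → x ∈ C → x ∈ R → C ⊆ R
  conn-⊆ cl c x∈C x∈R y∈C = proj₂ (∩⁻ (end∈ (stay cl (conn-walk c x∈C y∈C) x∈R)))

  -- Two disjoint paths

  Arcs : Set
  Arcs = List (Vertex × Vertex)

  Arc : Arcs → Vertex → Vertex → Set
  Arc es u v = (u , v) List.∈ es

  -- `side` is the certificate that `cut` meets every walk from `X` to `Y`: such a walk starts in
  -- `side` or at `cut`, and can leave `side` only through `cut`.
  record Separation (es : Arcs) (X Y : Sub) : Set where
    field
      cut    : Vertex
      side   : Sub
      source : ∀ {x} → x ∈ X → x ∈ side ⊎ x ≡ cut
      target : Disj side Y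
      closed : ∀ {u w} → u ∈ side → Arc es u w → w ∈ side ⊎ w ≡ cut

  record Linkage (E : Vertex → Vertex → Set) (X Y : Sub) : Set where
    field
      {P Q}         : Sub
      disj          : Disj P Q
      {x₁ y₁ x₂ y₂} : Vertex
      x₁∈           : x₁ ∈ X
      y₁∈           : y₁ ∈ Y
      x₂∈           : x₂ ∈ X
      y₂∈           : y₂ ∈ Y
      walk₁         : Walk E P x₁ y₁
      walk₂         : Walk E Q x₂ y₂

  weakenW : ∀ {E E′ : Vertex → Vertex → Set} {A x y} → (∀ {u w} → E u w → E′ u w) → Walk E A x y → Walk E′ A x y
  weakenW f (nil p)      = nil p
  weakenW f (cons p e w) = cons p (f e) (weakenW f w)

  link-to : ∀ {E X s x} → Linkage E X (⁅ s ⁆ ∪ ⁅ x ⁆) →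
            ∃[ A ] ∃[ B ] ∃[ a ] ∃[ b ] (Disj A B × a ∈ X × b ∈ X × Walk E A a s × Walk E B b x)
  link-to {E} {X} {s} {x} L = go (∪⁻ {⁅ s ⁆} y₁∈) (∪⁻ {⁅ s ⁆} y₂∈)
    where
    open Linkage L
    go : y₁ ∈ ⁅ s ⁆ ⊎ y₁ ∈ ⁅ x ⁆ → y₂ ∈ ⁅ s ⁆ ⊎ y₂ ∈ ⁅ x ⁆ →
         ∃[ A ] ∃[ B ] ∃[ a ] ∃[ b ] (Disj A B × a ∈ X × b ∈ X × Walk E A a s × Walk E B b x)
    go (inj₁ p) (inj₁ q) with refl ← ⁅⁆⁻ p | refl ← ⁅⁆⁻ q = ⊥-elim (disj (end∈ walk₁) (end∈ walk₂))
    go (inj₂ p) (inj₂ q) with refl ← ⁅⁆⁻ p | refl ← ⁅⁆⁻ q = ⊥-elim (disj (end∈ walk₁) (end∈ walk₂))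
    go (inj₁ p) (inj₂ q) with refl ← ⁅⁆⁻ p | refl ← ⁅⁆⁻ q = P , Q , _ , _ , disj , x₁∈ , x₂∈ , walk₁ , walk₂
    go (inj₂ p) (inj₁ q) with refl ← ⁅⁆⁻ p | refl ← ⁅⁆⁻ q =
      Q , P , _ , _ , disj-sym disj , x₂∈ , x₁∈ , walk₂ , walk₁

  link-from : ∀ {E Y s x} → Linkage E (⁅ s ⁆ ∪ ⁅ x ⁆) Y →
              ∃[ A ] ∃[ B ] ∃[ a ] ∃[ b ] (Disj A B × a ∈ Y × b ∈ Y × Walk E A s a × Walk E B x b)
  link-from {E} {Y} {s} {x} L = go (∪⁻ {⁅ s ⁆} x₁∈) (∪⁻ {⁅ s ⁆} x₂∈)
    where
    open Linkage L
    go : x₁ ∈ ⁅ s ⁆ ⊎ x₁ ∈ ⁅ x ⁆ → x₂ ∈ ⁅ s ⁆ ⊎ x₂ ∈ ⁅ x ⁆ →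
         ∃[ A ] ∃[ B ] ∃[ a ] ∃[ b ] (Disj A B × a ∈ Y × b ∈ Y × Walk E A s a × Walk E B x b)
    go (inj₁ p) (inj₁ q) with refl ← ⁅⁆⁻ p | refl ← ⁅⁆⁻ q = ⊥-elim (disj (start∈ walk₁) (start∈ walk₂))
    go (inj₂ p) (inj₂ q) with refl ← ⁅⁆⁻ p | refl ← ⁅⁆⁻ q = ⊥-elim (disj (start∈ walk₁) (start∈ walk₂))
    go (inj₁ p) (inj₂ q) with refl ← ⁅⁆⁻ p | refl ← ⁅⁆⁻ q = P , Q , _ , _ , disj , y₁∈ , y₂∈ , walk₁ , walk₂
    go (inj₂ p) (inj₁ q) with refl ← ⁅⁆⁻ p | refl ← ⁅⁆⁻ q =
      Q , P , _ , _ , disj-sym disj , y₂∈ , y₁∈ , walk₂ , walk₁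

  -- Since `R` is left only through `s`, cutting the walk at its first visit to `s` keeps it inside
  -- `R` and `s`.
  until : ∀ {E A R s x} → (∀ {u w} → u ∈ R → E u w → w ∈ R ⊎ w ≡ s) → x ∈ R ⊎ x ≡ s →
          Walk E A x s → Walk E (A ∩ (R ∪ ⁅ s ⁆)) x s
  until {R = R} {s} cl _ (nil p) = nil (∩⁺ p (∪ʳ {R} ⁅⁆⁺))
  until {R = R} {s} cl (inj₂ refl) (cons p e w) = nil (∩⁺ p (∪ʳ {R} ⁅⁆⁺))
  until {R = R} {s} cl (inj₁ r) (cons p e w) = cons (∩⁺ p (∪ˡ {R} r)) e (until cl (cl r e) w)

  -- Menger's theorem for two paths, by deletion of the arc x → y: a vertex s that
  -- separates without the arc makes {s,x} and {s,y} separators, and the linkages from X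
  -- to {s,x} and from {s,y} to Y meet only in s.
  menger : Vertex → ∀ es X Y → Separation es X Y ⊎ Linkage (Arc es) X Y
  menger v₀ [] X Y with any? (λ x → (x ∈? X) ×-dec (x ∈? Y))
  -- Without arcs and with `X` and `Y` disjoint every vertex is a valid cut; `v₀` is the default.
  ... | no none = inj₁ record
    { cut = v₀ ; side = X ; source = inj₁ ; target = λ p q → none (_ , p , q) ; closed = λ _ () }
  ... | yes (x , x∈X , x∈Y) with any? (λ z → (z ∈? X) ×-dec (z ∈? Y) ×-dec ¬? (z ≟ x))
  ...   | yes (z , z∈X , z∈Y , z≢x) = inj₂ record
    { disj = λ p q → z≢x (trans (≡-sym (⁅⁆⁻ q)) (⁅⁆⁻ p))
    ; x₁∈ = x∈X ; y₁∈ = x∈Y ; x₂∈ = z∈X ; y₂∈ = z∈Y ; walk₁ = nil ⁅⁆⁺ ; walk₂ = nil ⁅⁆⁺ }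
  ...   | no none = inj₁ record
    { cut = x ; side = X ∖ ⁅ x ⁆
    ; source = λ {z} p → src z p (z ≟ x)
    ; target = λ p q → none (_ , ∖ˡ p , q , λ { refl → ∖ʳ {X} p ⁅⁆⁺ })
    ; closed = λ _ () }
    where
    src : ∀ z → z ∈ X → Dec (z ≡ x) → z ∈ X ∖ ⁅ x ⁆ ⊎ z ≡ x
    src z p (yes q) = inj₂ q
    src z p (no q)  = inj₁ (∖⁺ p (≢⇒∉ q))
  menger v₀ ((x , y) ∷ es) X Y with menger v₀ es X Y
  ... | inj₂ L = inj₂ record
    { disj = disj ; x₁∈ = x₁∈ ; y₁∈ = y₁∈ ; x₂∈ = x₂∈ ; y₂∈ = y₂∈
    ; walk₁ = weakenW there walk₁ ; walk₂ = weakenW there walk₂ }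
    where open Linkage L
  ... | inj₁ S = split (x ∈? R) (y ∈? R) (y ≟ s)
    where
    open Separation S renaming (cut to s; side to R)

    Goal : Set
    Goal = Separation ((x , y) ∷ es) X Y ⊎ Linkage (Arc ((x , y) ∷ es)) X Y

    same : (x ∈ R → y ∈ R ⊎ y ≡ s) → Goal
    same f = inj₁ record { cut = s ; side = R ; source = source ; target = target
                         ; closed = λ { p (here refl) → f p ; p (there e) → closed p e } }

    cross : x ∈ R → y ∉ R → y ≢ s → Goal
    cross x∈R y∉R y≢s with menger v₀ es X (⁅ s ⁆ ∪ ⁅ x ⁆)
    -- Restricted to `R`, the side of `S₁` also works against `Y`: an exit from `R` goes through `s`
    -- or along the new arc from `x`, and neither `s` nor `x` belongs to that side.
    ... | inj₁ S₁ = inj₁ record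
      { cut = S₁.cut ; side = S₁.side ∩ R
      ; source = src
      ; target = λ p q → target (proj₂ (∩⁻ {S₁.side} p)) q
      ; closed = cl }
      where
      module S₁ = Separation S₁
      src : ∀ {z} → z ∈ X → z ∈ S₁.side ∩ R ⊎ z ≡ S₁.cut
      src p with S₁.source p | source p
      ... | inj₂ q | _ = inj₂ q
      ... | inj₁ q | inj₁ r = inj₁ (∩⁺ q r)
      ... | inj₁ q | inj₂ refl = ⊥-elim (S₁.target q (∪ˡ {⁅ s ⁆} ⁅⁆⁺))
      cl : ∀ {u w} → u ∈ S₁.side ∩ R → Arc ((x , y) ∷ es) u w → w ∈ S₁.side ∩ R ⊎ w ≡ S₁.cut
      cl p (here refl) = ⊥-elim (S₁.target (proj₁ (∩⁻ {S₁.side} {R} p)) (∪ʳ {⁅ s ⁆} ⁅⁆⁺))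
      cl p (there e) with ∩⁻ {S₁.side} {R} p
      ... | p₁ , p₂ with S₁.closed p₁ e | closed p₂ e
      ...   | inj₂ q | _ = inj₂ q
      ...   | inj₁ q | inj₁ r = inj₁ (∩⁺ q r)
      ...   | inj₁ q | inj₂ refl = ⊥-elim (S₁.target q (∪ˡ {⁅ s ⁆} ⁅⁆⁺))
    ... | inj₂ L₁ with menger v₀ es (⁅ s ⁆ ∪ ⁅ y ⁆) Y
    -- Every exit from `R` leads to `s` or `y`, and both lie in `R₂` or equal `v`; so the two sides
    -- merge into one that is left only through `v`.
    ...   | inj₁ S₂ = inj₁ record
      { cut = v ; side = (R ∪ R₂) ∖ ⁅ v ⁆
      ; source = src
      ; target = λ p q → [ (λ r → target r q) , (λ r → S₂.target r q) ]′ (∪⁻ {R} {R₂} (∖ˡ p))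
      ; closed = cl }
      where
      module S₂ = Separation S₂
      v = S₂.cut
      R₂ = S₂.side
      put : ∀ {z} → z ∈ R ∪ R₂ → z ∈ (R ∪ R₂) ∖ ⁅ v ⁆ ⊎ z ≡ v
      put {z} p with z ≟ v
      ... | yes q = inj₂ q
      ... | no q  = inj₁ (∖⁺ p (≢⇒∉ q))
      put₂ : ∀ {z} → z ∈ R₂ ⊎ z ≡ v → z ∈ (R ∪ R₂) ∖ ⁅ v ⁆ ⊎ z ≡ v
      put₂ (inj₁ p) = put (∪ʳ {R} p)
      put₂ (inj₂ p) = inj₂ p
      put₁ : ∀ {z} → z ∈ R ⊎ z ≡ s → z ∈ (R ∪ R₂) ∖ ⁅ v ⁆ ⊎ z ≡ v
      put₁ (inj₁ p) = put (∪ˡ {R} p)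
      put₁ (inj₂ refl) = put₂ (S₂.source (∪ˡ {⁅ s ⁆} ⁅⁆⁺))
      src : ∀ {z} → z ∈ X → z ∈ (R ∪ R₂) ∖ ⁅ v ⁆ ⊎ z ≡ v
      src p = put₁ (source p)
      cl : ∀ {u w} → u ∈ (R ∪ R₂) ∖ ⁅ v ⁆ → Arc ((x , y) ∷ es) u w → w ∈ (R ∪ R₂) ∖ ⁅ v ⁆ ⊎ w ≡ v
      cl p (here refl) = put₂ (S₂.source (∪ʳ {⁅ s ⁆} ⁅⁆⁺))
      cl p (there e) = [ (λ q → put₁ (closed q e)) , (λ q → put₂ (S₂.closed q e)) ]′ (∪⁻ {R} {R₂} (∖ˡ p))
    ...   | inj₂ L₂ with link-to L₁ | link-from L₂
    ...     | A , B , a , b , A#B , a∈ , b∈ , wA , wB | C , D , c , d , C#D , c∈ , d∈ , wC , wD =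
      inj₂ record
        { P = A′ ∪ C′ ; Q = B′ ∪ D′
        ; disj = disj-∪ {A′} {C′} (disj-∪ʳ {B′} {D′} (λ p q → A#B (proj₁ (∩⁻ p)) (proj₁ (∩⁻ q))) A#D)
                                  (disj-∪ʳ {B′} {D′} (λ p q → ∖ʳ p (proj₂ (∩⁻ {B} q)))
                                                     (λ p q → C#D (∖ˡ p) (∖ˡ q)))
        ; x₁∈ = a∈ ; y₁∈ = c∈ ; x₂∈ = b∈ ; y₂∈ = d∈
        ; walk₁ = mapW (∪ˡ {A′}) (weakenW there (until closed (source a∈) wA)) ++W
                  mapW (∪ʳ {A′}) (weakenW there wC′)
        ; walk₂ = mapW (∪ˡ {B′}) (weakenW there wB′) ++W
                  cons (∪ˡ {B′} (end∈ wB′)) (here refl) (mapW (∪ʳ {B′}) (weakenW there wD′)) }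
      where
      A′ = A ∩ (R ∪ ⁅ s ⁆)
      B′ = B ∩ R
      C′ = C ∖ R
      D′ = D ∖ R
      s∉B : s ∉ B
      s∉B = A#B (end∈ wA)
      s∉D : s ∉ D
      s∉D = C#D (start∈ wC)
      no-s : ∀ {T : Set} {Z z} → s ∉ Z → z ∈ Z → T ⊎ z ≡ s → T
      no-s h p (inj₁ t)    = t
      no-s h p (inj₂ refl) = ⊥-elim (h p)
      wB′ : Walk (Arc es) B′ b x
      wB′ = stay (λ _ p e q → no-s s∉B q (closed p e)) wB (no-s s∉B (start∈ wB) (source b∈))
      wC′ : Walk (Arc es) C′ s c
      wC′ with leave (λ p e _ → closed p e) wC (λ p → target p c∈)
      ... | inj₁ (_ , w) = w
      ... | inj₂ w = w
      wD′ : Walk (Arc es) D′ y d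
      wD′ with leave (λ p e _ → closed p e) wD (λ p → target p d∈)
      ... | inj₁ (_ , w) = w
      ... | inj₂ w = ⊥-elim (s∉D (∖ˡ (start∈ w)))
      A#D : Disj A′ D′
      A#D p q with ∪⁻ {R} (proj₂ (∩⁻ {A} p))
      ... | inj₁ r = ∖ʳ q r
      ... | inj₂ r with refl ← ⁅⁆⁻ r = s∉D (∖ˡ q)

    split : Dec (x ∈ R) → Dec (y ∈ R) → Dec (y ≡ s) → Goal
    split (no p)  _       _       = same (λ q → ⊥-elim (p q))
    split (yes _) (yes q) _       = same (λ _ → inj₁ q)
    split (yes _) (no _)  (yes r) = same (λ _ → inj₂ r)
    split (yes p) (no q)  (no r)  = cross p q r

  -- Tree models

  -- A model of the complete binary tree, indexed by its height, its root bag and the union of all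
  -- its bags: edges are required between root bags, disjointness concerns the unions.
  data Tree : ℕ → Sub → Sub → Set where
    leaf : ∀ {U} → Conn U → Tree 0 U U
    node : ∀ {h R R₀ U₀ R₁ U₁} → Conn R → Tree h R₀ U₀ → Tree h R₁ U₁ →
           Touch R R₀ → Touch R R₁ → Disj R U₀ → Disj R U₁ → Disj U₀ U₁ →
           Tree (suc h) R (R ∪ U₀ ∪ U₁)

  root⊆ : ∀ {h R U} → Tree h R U → R ⊆ U
  root⊆ (leaf _) p = p
  root⊆ (node {R = R} _ _ _ _ _ _ _ _) p = ∪ˡ {R} p

  tree-conn : ∀ {h R U} → Tree h R U → Conn U
  tree-conn (leaf c) = c
  tree-conn (node {R = R} {U₀ = U₀} {U₁ = U₁} c t₀ t₁ e₀ e₁ _ _ _) =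
    conn-≈ (∪⊆ {R ∪ U₀} (∪-mono {R} (λ p → p) (∪ˡ {U₀})) (λ p → ∪ʳ {R} (∪ʳ {U₀} p)))
           (∪⊆ {R} (λ p → ∪ˡ {R ∪ U₀} (∪ˡ {R} p)) (∪-mono {U₀} (∪ʳ {R}) (λ p → p)))
           (conn-∪-touch (conn-∪-touch c (tree-conn t₀) (touch-mono (λ p → p) (root⊆ t₀) e₀))
                         (tree-conn t₁) (touch-mono (∪ˡ {R}) (root⊆ t₁) e₁))

  -- V is a subtree of U with root set R: either all of it, or attached by R to a connected rest.
  Below : Sub → Sub → Sub → Set
  Below U V R = V ⊆ U × (U ⊆ V ⊎ (Conn (U ∖ V) × Touch (U ∖ V) R))

  below-refl : ∀ {U R} → Below U U R
  below-refl = (λ p → p) , inj₁ (λ p → p)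

  -- Outside the child `V₀` remain the root `R`, the sibling `V₁` and what lies outside `V`; the
  -- last two are each joined to `R`. The child is abstract so that both children can be treated at
  -- once.
  below-conn : ∀ {U V R R₀ V₀ V₁} → Below U V R → Conn R → Conn V₁ → Touch R R₀ → Touch R V₁ →
               V ⊆ R ∪ V₀ ∪ V₁ → R ⊆ V → V₀ ⊆ V → V₁ ⊆ V → Disj R V₀ → Disj V₁ V₀ →
               Below U V₀ R₀ × Conn (U ∖ V₀)
  below-conn {U} {V} {R} {R₀} {V₀} {V₁} (V⊆U , rest) cR c₁ e₀ e₁ cover R⊆ V₀⊆ V₁⊆ R#V₀ V₁#V₀ =
    ((λ p → V⊆U (V₀⊆ p)) , inj₂ (cU , touch-mono R⊆U∖ (λ p → p) e₀)) , cU
    where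
    R⊆U∖ : R ⊆ U ∖ V₀
    R⊆U∖ p = ∖⁺ (V⊆U (R⊆ p)) (R#V₀ p)
    V₁⊆U∖ : V₁ ⊆ U ∖ V₀
    V₁⊆U∖ p = ∖⁺ (V⊆U (V₁⊆ p)) (V₁#V₀ p)
    cRV : Conn (R ∪ V₁)
    cRV = conn-∪-touch cR c₁ e₁
    in-V : ∀ {x} → x ∈ U ∖ V₀ → x ∈ V → x ∈ R ∪ V₁
    in-V p q with ∪⁻ {R} (cover q)
    ... | inj₁ r = ∪ˡ {R} r
    ... | inj₂ r with ∪⁻ {V₀} r
    ...   | inj₁ s = ⊥-elim (∖ʳ p s)
    ...   | inj₂ s = ∪ʳ {R} s
    cU : Conn (U ∖ V₀)
    cU = go rest
      where
      go : U ⊆ V ⊎ (Conn (U ∖ V) × Touch (U ∖ V) R) → Conn (U ∖ V₀)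
      go (inj₁ U⊆V) = conn-≈ (∪⊆ {R} R⊆U∖ V₁⊆U∖) (λ p → in-V p (U⊆V (∖ˡ p))) cRV
      go (inj₂ (cUV , e)) =
       conn-≈ (∪⊆ {U ∖ V} (λ p → ∖⁺ (∖ˡ p) λ q → ∖ʳ p (V₀⊆ q)) (∪⊆ {R} R⊆U∖ V₁⊆U∖))
             (λ {x} p → back x p (x ∈? V))
             (conn-∪-touch cUV cRV (touch-mono (λ p → p) (∪ˡ {R}) e))
        where
        back : ∀ x → x ∈ U ∖ V₀ → Dec (x ∈ V) → x ∈ (U ∖ V) ∪ R ∪ V₁
        back x p (yes q) = ∪ʳ {U ∖ V} (in-V p q)
        back x p (no q)  = ∪ˡ {U ∖ V} (∖⁺ (∖ˡ p) q)

  record Subtree (g : ℕ) (U Z : Sub) : Set where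
    constructor subtree
    field
      {R V}  : Sub
      tree   : Tree g R V
      below  : Below U V R
      inside : V ⊆ Z

  record Pruned (g : ℕ) (U V : Sub) (v : Vertex) : Set where
    field
      {R′ V′} : Sub
      tree    : Tree g R′ V′
      below   : Below U V′ R′
      ⊆V      : V′ ⊆ V
      avoids  : v ∉ V′
      rest    : Conn (U ∖ V′)

  below-left : ∀ {h R U R₀ V₀ V₁ R₁} → Below U (R ∪ V₀ ∪ V₁) R → Conn R → Tree h R₁ V₁ → Touch R R₀ →
               Touch R R₁ → Disj R V₀ → Disj V₀ V₁ → Below U V₀ R₀ × Conn (U ∖ V₀)
  below-left {R = R} {V₀ = V₀} b c t₁ e₀ e₁ d₀ d =
    below-conn b c (tree-conn t₁) e₀ (touch-mono (λ p → p) (root⊆ t₁) e₁) (λ p → p) (∪ˡ {R})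
      (λ p → ∪ʳ {R} (∪ˡ {V₀} p)) (λ p → ∪ʳ {R} (∪ʳ {V₀} p)) d₀ (disj-sym d)

  below-right : ∀ {h R U R₀ V₀ V₁ R₁} → Below U (R ∪ V₀ ∪ V₁) R → Conn R → Tree h R₀ V₀ → Touch R R₀ →
                Touch R R₁ → Disj R V₁ → Disj V₀ V₁ → Below U V₁ R₁ × Conn (U ∖ V₁)
  below-right {R = R} {V₀ = V₀} {V₁} b c t₀ e₀ e₁ d₁ d =
    below-conn b c (tree-conn t₀) e₁ (touch-mono (λ p → p) (root⊆ t₀) e₀)
      (∪-mono {R} (λ p → p) (∪⊆ {V₀} {V₁} (∪ʳ {V₁}) (∪ˡ {V₁}))) (∪ˡ {R})
      (λ p → ∪ʳ {R} (∪ʳ {V₀} p)) (λ p → ∪ʳ {R} (∪ˡ {V₀} p)) d₁ d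

  -- The two children are disjoint, so one of them misses `v`; this is the one level that is paid.
  prune : ∀ {g R U V} → Tree (suc g) R V → Below U V R → ∀ v → Pruned g U V v
  prune (node {R = R} {U₀ = V₀} {U₁ = V₁} c t₀ t₁ e₀ e₁ d₀ d₁ d) b v with v ∈? V₀
  ... | no v∉ with below-left b c t₁ e₀ e₁ d₀ d
  ...   | b₀ , r = record { tree = t₀ ; below = b₀ ; ⊆V = λ p → ∪ʳ {R} (∪ˡ {V₀} p) ; avoids = v∉ ; rest = r }
  prune (node {R = R} {U₀ = V₀} {U₁ = V₁} c t₀ t₁ e₀ e₁ d₀ d₁ d) b v | yes v∈ with below-right b c t₀ e₀ e₁ d₁ d
  ...   | b₁ , r = record { tree = t₁ ; below = b₁ ; ⊆V = λ p → ∪ʳ {R} (∪ʳ {V₀} p) ; avoids = λ q → d v∈ q ; rest = r }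

  -- For connected `A` disjoint from the tree this is a model of Γ⁺ with `A` as the bag of the added
  -- vertex. `A` is kept separate so that it can be enlarged later.
  data Tree⁺ (A : Sub) : ℕ → Sub → Sub → Set where
    leaf : ∀ {U} → Conn U → Touch U A → Tree⁺ A 0 U U
    node : ∀ {q R R₀ U₀ R₁ U₁} → Conn R → Tree⁺ A q R₀ U₀ → Tree⁺ A q R₁ U₁ → Touch R R₀ → Touch R R₁ →
           Disj R U₀ → Disj R U₁ → Disj U₀ U₁ → Tree⁺ A (suc q) R (R ∪ U₀ ∪ U₁)

  tree⁺-root⊆ : ∀ {A q R U} → Tree⁺ A q R U → R ⊆ U
  tree⁺-root⊆ (leaf _ _) p = p
  tree⁺-root⊆ (node _ _ _ _ _ _ _ _) p = ∪ˡ p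

  tree⁺-root-conn : ∀ {A q R U} → Tree⁺ A q R U → Conn R
  tree⁺-root-conn (leaf c _) = c
  tree⁺-root-conn (node c _ _ _ _ _ _ _) = c

  tree⁺-mono : ∀ {A B q R U} → A ⊆ B → Tree⁺ A q R U → Tree⁺ B q R U
  tree⁺-mono f (leaf c e) = leaf c (touch-mono (λ p → p) f e)
  tree⁺-mono f (node c t₀ t₁ e₀ e₁ d₀ d₁ d) = node c (tree⁺-mono f t₀) (tree⁺-mono f t₁) e₀ e₁ d₀ d₁ d

  record Extended (A : Sub) (q : ℕ) (R U P : Sub) : Set where
    field
      {set} : Sub
      tree  : Tree⁺ A q (R ∪ P) set
      bound : set ⊆ U ∪ P

  -- Used to carry the root of a crown along a connecting set to a new end; since `P` meets the tree
  -- only in `h`, no other bag is disturbed.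
  extend : ∀ {A q R U P h} → Tree⁺ A q R U → h ∈ R → Conn P → h ∈ P → (∀ {x} → x ∈ P → x ∈ U → x ≡ h) →
           Extended A q R U P
  extend (leaf c e) h∈R cP h∈P only = record
    { tree = leaf (conn-∪-meet c cP h∈R h∈P) (touch-mono ∪ˡ (λ p → p) e) ; bound = λ p → p }
  extend {P = P} {h} (node {R = R} {U₀ = U₀} {U₁ = U₁} c t₀ t₁ e₀ e₁ d₀ d₁ d) h∈R cP h∈P only = record
    { tree = node (conn-∪-meet c cP h∈R h∈P) t₀ t₁ (touch-mono ∪ˡ (λ p → p) e₀) (touch-mono ∪ˡ (λ p → p) e₁)
                  (disj-∪ d₀ λ p q → d₀ (subst (_∈ R) (≡-sym (only p (∪ʳ (∪ˡ q)))) h∈R) q)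
                  (disj-∪ d₁ λ p q → d₁ (subst (_∈ R) (≡-sym (only p (∪ʳ (∪ʳ q)))) h∈R) q) d
    ; bound = ∪⊆ (∪-mono ∪ˡ (λ p → p)) (λ p → ∪ˡ (∪ʳ p)) }

  -- Blocks and cut vertices

  path? : ∀ S x y → Dec (Path S x y)
  path? S x y with x ∈? S
  ... | no x∉ = no λ w → x∉ (start∈ w)
  ... | yes x∈ with y ∈? set
    where open Component (component S x∈)
  ...   | yes y∈ = yes (mapW ⊆S (conn-walk isConn has y∈))
    where open Component (component S x∈)
  ...   | no y∉ = no λ w → y∉ (proj₂ (∩⁻ {S} (end∈ (stay (λ _ p e q → closed p q e) w has))))
    where open Component (component S x∈)

  ⊆? : ∀ A B → (A ⊆ B) ⊎ ∃[ x ] (x ∈ A × x ∉ B)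
  ⊆? A B with any? (λ x → (x ∈? A) ×-dec ¬? (x ∈? B))
  ... | yes p = inj₂ p
  ... | no none = inj₁ λ {x} p → decidable-stable (x ∈? B) λ q → none (x , p , q)

  -- A single vertex or an edge also qualifies; the required size comes from a tree of positive
  -- height inside the set, which `third` turns into a vertex different from any two given ones.
  TwoConn : Sub → Set
  TwoConn B = ∀ {v x y} → x ∈ B → y ∈ B → x ≢ v → y ≢ v → Path (B ∖ ⁅ v ⁆) x y

  record Block (n : ℕ) (Z : Sub) : Set where
    constructor block
    field
      {B R U} : Sub
      twoConn : TwoConn B
      B⊆      : B ⊆ Z
      tree    : Tree n R U
      U⊆      : U ⊆ B

  record Cut (g : ℕ) (W U : Sub) : Set where
    field
      cut     : Vertex
      P Q     : Sub
      P⊆      : P ⊆ W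
      Q⊆      : Q ⊆ W
      P#Q     : Disj P Q
      cut∉P   : cut ∉ P
      cut∉Q   : cut ∉ Q
      cover   : ∀ {x} → x ∈ W → x ≢ cut → x ∈ P ⊎ x ∈ Q
      no-edge : ∀ {x y} → x ∈ P → y ∈ Q → x ~ y → ⊥
      treeP   : Subtree g U P
      treeQ   : Subtree g U Q

  flip-cut : ∀ {g W U} → Cut g W U → Cut g W U
  flip-cut C = record
    { cut = cut ; P = Q ; Q = P ; P⊆ = Q⊆ ; Q⊆ = P⊆ ; P#Q = disj-sym P#Q ; cut∉P = cut∉Q ; cut∉Q = cut∉P
    ; cover = λ p q → [ inj₂ , inj₁ ]′ (cover p q) ; no-edge = λ p q e → no-edge q p (~-sym e)
    ; treeP = treeQ ; treeQ = treeP }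
    where open Cut C

  -- Only the subtrees at depth exactly `n` count, each of height `g`; the `n` levels above them are
  -- what survives in a block.
  NoSubtree : ∀ g n {R U} → Tree (n + g) R U → Sub → Set
  NoSubtree g zero    {U = U} t Z = ¬ (U ⊆ Z)
  NoSubtree g (suc n) (node _ t₀ t₁ _ _ _ _ _) Z = NoSubtree g n t₀ Z × NoSubtree g n t₁ Z

  noSubtree-mono : ∀ g n {R U Y Z} (t : Tree (n + g) R U) → Y ⊆ Z → NoSubtree g n t Z → NoSubtree g n t Y
  noSubtree-mono g zero    t f h = λ q → h λ p → f (q p)
  noSubtree-mono g (suc n) (node _ t₀ t₁ _ _ _ _ _) f (h₀ , h₁) =
    noSubtree-mono g n t₀ f h₀ , noSubtree-mono g n t₁ f h₁

  noSubtree-all : ∀ g n {R U Z} (t : Tree (n + g) R U) → NoSubtree g n t Z → ¬ (U ⊆ Z)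
  noSubtree-all g zero t h = h
  noSubtree-all g (suc n) (node {R = R} {U₀ = U₀} _ t₀ t₁ _ _ _ _ _) (h₀ , _) f =
    noSubtree-all g n t₀ h₀ λ p → f (∪ʳ {R} (∪ˡ {U₀} p))

  -- The known failure for `Y` travels along so that a subtree found in `Z` is certified not to lie
  -- in `Y`. This is needed when `Z` is an enlargement of a fibre `Y`.
  findSubtree : ∀ g n {R U₀ U} (t : Tree (n + g) R U) → Below U₀ U R → ∀ {Y} Z → NoSubtree g n t Y →
                (Σ (Subtree g U₀ Z) λ S → ¬ (Subtree.V S ⊆ Y)) ⊎ NoSubtree g n t Z
  findSubtree g zero {U = U} t b Z no-Y with ⊆? U Z
  ... | inj₁ s = inj₁ (subtree t b s , no-Y)
  ... | inj₂ (x , p , q) = inj₂ λ s → q (s p)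
  findSubtree g (suc n) (node c t₀ t₁ e₀ e₁ d₀ d₁ d) b Z (no₀ , no₁)
    with findSubtree g n t₀ (proj₁ (below-left b c t₁ e₀ e₁ d₀ d)) Z no₀
       | findSubtree g n t₁ (proj₁ (below-right b c t₀ e₀ e₁ d₁ d)) Z no₁
  ... | inj₁ s | _ = inj₁ s
  ... | inj₂ _ | inj₁ s = inj₁ s
  ... | inj₂ h | inj₂ h′ = inj₂ (h , h′)

  preimage : (Vertex → Vertex) → Sub → Sub
  preimage π S x = S (π x)

  fibre : (Vertex → Vertex) → Vertex → Sub
  fibre π c = preimage π ⁅ c ⁆ ∖ ⁅ c ⁆

  pre⁺ : ∀ {π S x} → π x ∈ S → x ∈ preimage π S
  pre⁺ (mem p) = mem p

  pre⁻ : ∀ {π S x} → x ∈ preimage π S → π x ∈ S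
  pre⁻ (mem p) = mem p

  -- W′ is obtained from W by contracting away pieces that hang on single vertices of W′.
  record Retract (W W′ : Sub) : Set where
    field
      π        : Vertex → Vertex
      W′⊆W     : W′ ⊆ W
      image    : ∀ {x} → x ∈ W → π x ∈ W′
      fixed    : ∀ {x} → x ∈ W′ → π x ≡ x
      collapse : ∀ {x y} → x ∈ W → y ∈ W → x ∉ W′ → x ~ y → π x ≡ π y

  module _ {W W′ : Sub} (ρ : Retract W W′) where
    open Retract ρ

    fibre∉ : ∀ {x c} → x ∈ fibre π c → x ∉ W′
    fibre∉ {x} {c} p q = ∖ʳ {preimage π ⁅ c ⁆} p (subst (_∈ ⁅ c ⁆) (fixed q) (pre⁻ {π} (∖ˡ p)))

    ∈fibre : ∀ {x} → x ∈ W → x ∉ W′ → x ∈ fibre π (π x)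
    ∈fibre p q = ∖⁺ (pre⁺ {π} ⁅⁆⁺) λ r → q (subst (_∈ W′) (≡-sym (⁅⁆⁻ r)) (image p))

    -- By `collapse` the map `π` is constant along edges at a vertex outside `W′`, so a fibre is
    -- left only through its base `c`, and `C` avoids `c`.
    fibre-⊆ : ∀ {C c x} → C ⊆ W → Conn C → c ∉ C → x ∈ C → x ∈ fibre π c → C ⊆ fibre π c
    fibre-⊆ {C} {c} C⊆ cC c∉ = conn-⊆ cl cC
      where
      cl : ∀ {u w} → u ∈ C → u ∈ fibre π c → u ~ w → w ∈ C → w ∈ fibre π c
      cl u∈C u∈ e w∈ =
        ∖⁺ (pre⁺ {π} (subst (_∈ ⁅ c ⁆) (collapse (C⊆ u∈C) (C⊆ w∈) (fibre∉ u∈) e) (pre⁻ {π} (∖ˡ u∈))))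
           λ q → c∉ (subst (_∈ C) (⁅⁆⁻ q) w∈)

    own-fibre : ∀ {C x y} → C ⊆ W → Conn C → x ∈ C → x ∉ W′ → y ∈ C → y ∈ W′ → π x ∈ C
    own-fibre {C} {x} C⊆ cC x∈ x∉ y∈ y∈W′ = decidable-stable (π x ∈? C) λ c∉ →
      fibre∉ (fibre-⊆ C⊆ cC c∉ x∈ (∈fibre (C⊆ x∈) x∉) y∈) y∈W′

    meets : ∀ {C} → C ⊆ W → Conn C → (∀ c → ¬ (C ⊆ fibre π c)) → ∃[ y ] (y ∈ C × y ∈ W′)
    meets {C} C⊆ cC h with any? (λ y → (y ∈? C) ×-dec (y ∈? W′))
    ... | yes p = p
    ... | no none = ⊥-elim (h (π (hub cC)) (fibre-⊆ C⊆ cC c∉ (hub∈ cC) (∈fibre (C⊆ (hub∈ cC)) λ q → none (_ , hub∈ cC , q))))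
      where
      c∉ : π (hub cC) ∉ C
      c∉ p = none (_ , p , image (C⊆ (hub∈ cC)))

    -- Applying `π` to a walk contracts each edge with an end outside `W′` and keeps the others, so
    -- the image is again a walk.
    retract-walk : ∀ {C x y} → C ⊆ W → Path C x y → y ∈ W′ → Path (C ∩ W′) (π x) y
    retract-walk {C} {y = y} C⊆ (nil p) y∈ = subst (λ z → Path (C ∩ W′) z y) (≡-sym (fixed y∈)) (nil (∩⁺ p y∈))
    retract-walk {C} {y = y} C⊆ (cons {x} {x′} p e w) y∈ with x ∈? W′ | x′ ∈? W′
    ... | no x∉ | _ = subst (λ z → Path (C ∩ W′) z y) (≡-sym (collapse (C⊆ p) (C⊆ (start∈ w)) x∉ e)) (retract-walk C⊆ w y∈)
    ... | yes x∈ | no x′∉ = subst (λ z → Path (C ∩ W′) z y) (collapse (C⊆ (start∈ w)) (C⊆ p) x′∉ (~-sym e)) (retract-walk C⊆ w y∈)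
    ... | yes x∈ | yes x′∈ = subst (λ z → Path (C ∩ W′) z y) (≡-sym (fixed x∈))
      (cons (∩⁺ p x∈) e (subst (λ z → Path (C ∩ W′) z y) (fixed x′∈) (retract-walk C⊆ w y∈)))

    conn-retract : ∀ {C y} → C ⊆ W → Conn C → y ∈ C → y ∈ W′ → Conn (C ∩ W′)
    conn-retract {C} {y} C⊆ cC y∈C y∈W′ = conn y (∩⁺ y∈C y∈W′) λ {x} p →
      subst (λ z → Path (C ∩ W′) z y) (fixed (proj₂ (∩⁻ {C} p))) (retract-walk C⊆ (conn-walk cC (proj₁ (∩⁻ {C} p)) y∈C) y∈W′)

    -- If `u` were outside `W′`, the connected set `C` would contain the base `π u` of its fibre.
    -- Then `D` would enter this fibre at `v` without containing the base, hence lie inside it and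
    -- miss `W′`.
    touch-retract : ∀ {C D y z} → C ⊆ W → D ⊆ W → Conn C → Conn D → Disj C D → y ∈ C → y ∈ W′ → z ∈ D → z ∈ W′ →
                    ∀ {u v} → u ∈ C → v ∈ D → u ~ v → u ∈ W′
    touch-retract {C} {D} C⊆ D⊆ cC cD C#D y∈ y∈W′ z∈ z∈W′ {u} {v} u∈ v∈ e = decidable-stable (u ∈? W′) λ u∉ →
      let c∈C = own-fibre C⊆ cC u∈ u∉ y∈ y∈W′
          v∈F = ∖⁺ (pre⁺ {π} (subst (_∈ ⁅ π u ⁆) (collapse (C⊆ u∈) (D⊆ v∈) u∉ e) ⁅⁆⁺))
                   λ q → C#D (subst (_∈ C) (≡-sym (⁅⁆⁻ q)) c∈C) v∈
      in fibre∉ (fibre-⊆ D⊆ cD (C#D c∈C) v∈ v∈F z∈) z∈W′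

    record Projected (n : ℕ) (R U : Sub) : Set where
      field
        {R′ U′} : Sub
        tree    : Tree n R′ U′
        root    : R ∩ W′ ⊆ R′
        ⊆U      : U′ ⊆ U
        ⊆W′     : U′ ⊆ W′

    -- Each subtree at depth `n` is merged into one leaf bag, and every bag is intersected with
    -- `W′`. The intersections are nonempty because no fibre swallows a subtree at depth `n`, and
    -- connected by `retract-walk`.
    project : ∀ g n {R U} (t : Tree (n + g) R U) → U ⊆ W → (∀ c → NoSubtree g n t (fibre π c)) → Projected n R U
    project g zero {R} {U} t U⊆ h with meets U⊆ (tree-conn t) h
    ... | y , y∈ , y∈W′ = record
      { tree = leaf (conn-retract U⊆ (tree-conn t) y∈ y∈W′)
      ; root = λ p → ∩⁺ (root⊆ t (proj₁ (∩⁻ {R} p))) (proj₂ (∩⁻ {R} p))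
      ; ⊆U = λ p → proj₁ (∩⁻ {U} p) ; ⊆W′ = λ p → proj₂ (∩⁻ {U} p) }
    project g (suc n) (node {R = R} {R₀} {U₀} {R₁} {U₁} c t₀ t₁ e₀ e₁ d₀ d₁ d) U⊆ h =
      record { tree = node (conn-retract R⊆W c (proj₁ (proj₂ R-meets)) (proj₂ (proj₂ R-meets))) P₀.tree P₁.tree
                           (touch′ t₀ U₀⊆W U₀-meets d₀ P₀.root e₀) (touch′ t₁ U₁⊆W U₁-meets d₁ P₁.root e₁)
                           (λ p q → d₀ (proj₁ (∩⁻ {R} p)) (P₀.⊆U q)) (λ p q → d₁ (proj₁ (∩⁻ {R} p)) (P₁.⊆U q))
                           (λ p q → d (P₀.⊆U p) (P₁.⊆U q))
             ; root = λ p → p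
             ; ⊆U = ∪-mono {R ∩ W′} (λ p → proj₁ (∩⁻ {R} p)) (∪-mono {P₀.U′} P₀.⊆U P₁.⊆U)
             ; ⊆W′ = ∪⊆ {R ∩ W′} (λ p → proj₂ (∩⁻ {R} p)) (∪⊆ {P₀.U′} P₀.⊆W′ P₁.⊆W′) }
      where
      R⊆W : R ⊆ W
      R⊆W p = U⊆ (∪ˡ {R} p)
      U₀⊆W : U₀ ⊆ W
      U₀⊆W p = U⊆ (∪ʳ {R} (∪ˡ {U₀} p))
      U₁⊆W : U₁ ⊆ W
      U₁⊆W p = U⊆ (∪ʳ {R} (∪ʳ {U₀} p))
      module P₀ = Projected (project g n t₀ U₀⊆W (λ c → proj₁ (h c)))
      module P₁ = Projected (project g n t₁ U₁⊆W (λ c → proj₂ (h c)))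
      U₀-meets : ∃[ y ] (y ∈ U₀ × y ∈ W′)
      U₀-meets = meets U₀⊆W (tree-conn t₀) λ c → noSubtree-all g n t₀ (proj₁ (h c))
      U₁-meets : ∃[ y ] (y ∈ U₁ × y ∈ W′)
      U₁-meets = meets U₁⊆W (tree-conn t₁) λ c → noSubtree-all g n t₁ (proj₂ (h c))
      child⊆ : ∀ {R′ U′ x} → Tree (n + g) R′ U′ → U′ ⊆ W → Touch R R′ → R ⊆ fibre π x → x ∉ U′ → U′ ⊆ fibre π x
      child⊆ {R′} {U′} {x} t U′⊆ e R⊆F x∉ p =
        fibre-⊆ (∪⊆ {R} R⊆W U′⊆) (conn-∪-touch c (tree-conn t) (touch-mono (λ q → q) (root⊆ t) e))
                (λ q → [ (λ r → ∖ʳ (R⊆F r) ⁅⁆⁺) , x∉ ]′ (∪⁻ {R} q)) (∪ˡ {R} (hub∈ c)) (R⊆F (hub∈ c)) (∪ʳ {R} p)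
      -- A fibre that swallows the root bag also swallows each child that avoids its base `x`; as
      -- the children are disjoint, at least one of them does.
      R-meets : ∃[ y ] (y ∈ R × y ∈ W′)
      R-meets = meets R⊆W c λ x R⊆F → lemma x R⊆F (x ∈? U₀)
        where
        lemma : ∀ x → R ⊆ fibre π x → Dec (x ∈ U₀) → ⊥
        lemma x R⊆F (no x∉)  = noSubtree-all g n t₀ (proj₁ (h x)) (child⊆ t₀ U₀⊆W e₀ R⊆F x∉)
        lemma x R⊆F (yes x∈) = noSubtree-all g n t₁ (proj₂ (h x)) (child⊆ t₁ U₁⊆W e₁ R⊆F (d x∈))
      touch′ : ∀ {R₀ U₀ R₀′} → Tree (n + g) R₀ U₀ → U₀ ⊆ W → ∃[ y ] (y ∈ U₀ × y ∈ W′) → Disj R U₀ →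
               R₀ ∩ W′ ⊆ R₀′ → Touch R R₀ → Touch (R ∩ W′) R₀′
      touch′ t₀ U₀⊆ (z , z∈ , z∈W′) d₀ root (u , v , u∈ , v∈ , e) =
        let (y , y∈ , y∈W′) = R-meets
            v∈U = root⊆ t₀ v∈
        in u , v
         , ∩⁺ u∈ (touch-retract R⊆W U₀⊆ c (tree-conn t₀) d₀ y∈ y∈W′ z∈ z∈W′ u∈ v∈U e)
         , root (∩⁺ v∈ (touch-retract U₀⊆ R⊆W (tree-conn t₀) c (disj-sym d₀) z∈ z∈W′ y∈ y∈W′ v∈U u∈ (~-sym e)))
         , e

  fibre-retract : ∀ {W W′ c D} → Retract W W′ → c ∈ W′ → c ∉ D → (∀ {x y} → x ∈ D → y ∈ W′ → x ~ y → y ∈ D ⊎ y ≡ c) →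
                  Retract W (W′ ∖ D)
  fibre-retract {W} {W′} {c} {D} ρ c∈ c∉ cl = record
    { π = π′ ; W′⊆W = λ p → W′⊆W (∖ˡ p) ; image = image′ ; fixed = fixed′ ; collapse = collapse′ }
    where
    open Retract ρ
    π′ : Vertex → Vertex
    π′ x = if D (π x) then c else π x
    on : ∀ {x} → π x ∈ D → π′ x ≡ c
    on {x} (mem p) rewrite p = refl
    off : ∀ {x} → π x ∉ D → π′ x ≡ π x
    off {x} p rewrite ∉⇒false {π x} {D} p = refl
    image′ : ∀ {x} → x ∈ W → π′ x ∈ W′ ∖ D
    image′ {x} p with π x ∈? D
    ... | yes q = subst (_∈ W′ ∖ D) (≡-sym (on q)) (∖⁺ c∈ c∉)
    ... | no q  = subst (_∈ W′ ∖ D) (≡-sym (off q)) (∖⁺ (image p) q)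
    fixed′ : ∀ {x} → x ∈ W′ ∖ D → π′ x ≡ x
    fixed′ {x} p = trans (off λ q → ∖ʳ p (subst (_∈ D) (fixed (∖ˡ p)) q)) (fixed (∖ˡ p))
    collapse′ : ∀ {x y} → x ∈ W → y ∈ W → x ∉ W′ ∖ D → x ~ y → π′ x ≡ π′ y
    collapse′ {x} {y} p q x∉ e with x ∈? W′
    ... | no x∉W′ = cong (λ z → if D z then c else z) (collapse p q x∉W′ e)
    ... | yes x∈W′ = trans (on πx∈) (≡-sym (to-c (y ∈? W′)))
      where
      x∈D : x ∈ D
      x∈D = decidable-stable (x ∈? D) λ r → x∉ (∖⁺ x∈W′ r)
      πx∈ : π x ∈ D
      πx∈ = subst (_∈ D) (≡-sym (fixed x∈W′)) x∈D
      to-c : Dec (y ∈ W′) → π′ y ≡ c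
      to-c (no y∉) = on (subst (_∈ D) (≡-sym (collapse q p y∉ (~-sym e))) πx∈)
      to-c (yes y∈) with cl x∈D y∈ e
      ... | inj₁ r = on (subst (_∈ D) (≡-sym (fixed y∈)) r)
      ... | inj₂ refl = trans (off λ r → c∉ (subst (_∈ D) (fixed y∈) r)) (fixed y∈)

  -- A path to `v` stopped at its first arrival cannot have entered `D`, whose only neighbour
  -- outside itself is `v`.
  conn-remove : ∀ {W D v} → Conn W → v ∈ W → v ∉ D → (∀ {x y} → x ∈ D → y ∈ W → x ~ y → y ∈ D ⊎ y ≡ v) →
                Conn (W ∖ D)
  conn-remove {W} {D} {v} cW v∈ v∉ cl = conn v (∖⁺ v∈ v∉) (λ {x} p → go p (x ≟ v))
    where
    cl′ : ∀ {u w} → u ∈ W ∖ ⁅ v ⁆ → u ∈ W ∖ D → u ~ w → w ∈ W ∖ ⁅ v ⁆ → w ∈ W ∖ D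
    cl′ p q e r = ∖⁺ (∖ˡ r) λ s → [ ∖ʳ q , (λ { refl → ∖ʳ p ⁅⁆⁺ }) ]′ (cl s (∖ˡ p) (~-sym e))
    go : ∀ {x} → x ∈ W ∖ D → Dec (x ≡ v) → Path (W ∖ D) x v
    go p (yes refl) = nil p
    go p (no x≢v) with approach {Y = ⁅ v ⁆} (conn-walk cW (∖ˡ p) v∈) (≢⇒∉ x≢v) ⁅⁆⁺
    ... | u , _ , w , e , q , _ with refl ← ⁅⁆⁻ q =
      let w′ = mapW (λ r → proj₂ (∩⁻ {W ∖ ⁅ v ⁆} r)) (stay {R = W ∖ D} cl′ w p)
      in w′ ++W cons (end∈ w′) e (nil (∖⁺ v∈ v∉))

  module _ {W U R : Sub} (g n : ℕ) (t : Tree (n + g) R U) (U⊆W : U ⊆ W) where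

    -- Shrink a retract at its cut vertices as long as one of the two sides carries no subtree of height g.
    shrink : ∀ W′ (ρ : Retract W W′) → Conn W′ → (∀ c → NoSubtree g n t (fibre (Retract.π ρ) c)) →
             Acc _<_ (size W′) → Block n W ⊎ Cut g W U
    shrink W′ ρ cW′ small (acc rs)
      with any? (λ v → any? (λ x → any? (λ y → (x ∈? W′) ×-dec (y ∈? W′) ×-dec ¬? (x ≟ v) ×-dec ¬? (y ≟ v)
                  ×-dec ¬? (path? (W′ ∖ ⁅ v ⁆) x y))))
    ... | no none = inj₁ (block (λ {v} {x} {y} p q r s →
             decidable-stable (path? (W′ ∖ ⁅ v ⁆) x y) λ no-path → none (v , x , y , p , q , r , s , no-path))
             (Retract.W′⊆W ρ) (Projected.tree pr) (Projected.⊆W′ pr))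
      where pr = project ρ g n t U⊆W small
    ... | yes (v , x , y , x∈ , y∈ , x≢v , y≢v , no-path) = branch
      where
      open Retract ρ
      v∈ : v ∈ W′
      v∈ = decidable-stable (v ∈? W′) λ v∉ → no-path
             (mapW (λ p → ∖⁺ p (≢⇒∉ λ { refl → v∉ p })) (conn-walk cW′ x∈ y∈))
      x∈′ : x ∈ W′ ∖ ⁅ v ⁆
      x∈′ = ∖⁺ x∈ (≢⇒∉ x≢v)
      open Component (component (W′ ∖ ⁅ v ⁆) x∈′) renaming (set to C)
      D : Sub
      D = (W′ ∖ ⁅ v ⁆) ∖ C
      y∈D : y ∈ D
      y∈D = ∖⁺ (∖⁺ y∈ (≢⇒∉ y≢v)) λ q → no-path (mapW ⊆S (conn-walk isConn has q))
      v∉C : v ∉ C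
      v∉C p = ∖ʳ (⊆S p) ⁅⁆⁺
      v∉D : v ∉ D
      v∉D p = ∖ʳ (∖ˡ p) ⁅⁆⁺
      clC : ∀ {x y} → x ∈ C → y ∈ W′ → x ~ y → y ∈ C ⊎ y ≡ v
      clC {y = y} p q e with y ≟ v
      ... | yes r = inj₂ r
      ... | no r  = inj₁ (closed p (∖⁺ q (≢⇒∉ r)) e)
      clD : ∀ {x y} → x ∈ D → y ∈ W′ → x ~ y → y ∈ D ⊎ y ≡ v
      clD {y = y} p q e with y ≟ v
      ... | yes r = inj₂ r
      ... | no r  = inj₁ (∖⁺ (∖⁺ q (≢⇒∉ r)) λ s → ∖ʳ p (closed s (∖ˡ p) (~-sym e)))
      ρC = fibre-retract ρ v∈ v∉C clC
      ρD = fibre-retract ρ v∈ v∉D clD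

      module _ (S : Sub) (v∉S : v ∉ S) (cl : ∀ {x y} → x ∈ S → y ∈ W′ → x ~ y → y ∈ S ⊎ y ≡ v) where
        π′ = Retract.π (fibre-retract ρ v∈ v∉S cl)
        new-fibre : ∀ {c z} → z ∈ fibre π′ c → (π z ∈ S × c ≡ v) ⊎ (π z ∉ S × z ∈ fibre π c)
        new-fibre {c} {z} p with π z ∈? S | ⁅⁆⁻ (pre⁻ {π′} (∖ˡ {preimage π′ ⁅ c ⁆} p))
        ... | yes (mem q) | r rewrite q = inj₁ (mem q , ≡-sym r)
        ... | no q | r rewrite ∉⇒false q =
          inj₂ (q , ∖⁺ (pre⁺ {π} (subst (_∈ ⁅ c ⁆) (≡-sym r) ⁅⁆⁺)) (∖ʳ {preimage π′ ⁅ c ⁆} p))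
        new-small : NoSubtree g n t (fibre π′ v) → ∀ c → NoSubtree g n t (fibre π′ c)
        new-small h c with c ≟ v
        ... | yes refl = h
        ... | no c≢v = noSubtree-mono g n t
          (λ p → [ (λ q → ⊥-elim (c≢v (proj₂ q))) , proj₂ ]′ (new-fibre p)) (small c)

      branch : Block n W ⊎ Cut g W U
      -- The fibre of `v` under `ρD` is its old fibre together with all that `π` sends into `D`. If
      -- it swallows no subtree, `D` may be contracted to `v`; likewise for `C`. If both swallow
      -- one, `v` is the cut sought.
      branch with findSubtree g n t below-refl (fibre (Retract.π ρD) v) (small v)
      ... | inj₂ h = shrink (W′ ∖ D) ρD (conn-remove cW′ v∈ v∉D clD) (new-small D v∉D clD h)
                       (rs (size-< {v = y} ∖ˡ y∈ λ p → ∖ʳ p y∈D))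
      ... | inj₁ (subtree t₁ b₁ i₁ , _) with findSubtree g n t below-refl (fibre (Retract.π ρC) v) (small v)
      ...   | inj₂ h = shrink (W′ ∖ C) ρC (conn-remove cW′ v∈ v∉C clC) (new-small C v∉C clC h)
                         (rs (size-< {v = x} ∖ˡ x∈ λ p → ∖ʳ p has))
      -- The old fibre of `v` is assigned to `P`. The second subtree is known not to lie in it;
      -- being connected and avoiding `v`, it does not meet it either, and so lies over `C`.
      ...   | inj₁ (subtree {V = V₂} t₂ b₂ i₂ , out) = inj₂ record
        { cut = v
        ; P = (W ∖ ⁅ v ⁆) ∖ πC
        ; Q = (W ∖ ⁅ v ⁆) ∩ πC
        ; P⊆ = λ p → ∖ˡ (∖ˡ p)
        ; Q⊆ = λ p → ∖ˡ (proj₁ (∩⁻ {W ∖ ⁅ v ⁆} p))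
        ; P#Q = λ p q → ∖ʳ p (proj₂ (∩⁻ {W ∖ ⁅ v ⁆} q))
        ; cut∉P = λ p → ∖ʳ (∖ˡ p) ⁅⁆⁺
        ; cut∉Q = λ p → ∖ʳ (proj₁ (∩⁻ {W ∖ ⁅ v ⁆} p)) ⁅⁆⁺
        ; cover = λ {x} p q → cover′ p q (x ∈? πC)
        ; no-edge = λ p q e → apart (∖ˡ p) (∖ʳ p) (proj₁ (∩⁻ {W ∖ ⁅ v ⁆} q)) (proj₂ (∩⁻ {W ∖ ⁅ v ⁆} q)) e
        ; treeP = subtree t₁ b₁ (λ p → ∖⁺ (∖⁺ (U⊆W (proj₁ b₁ p)) (∖ʳ {preimage (Retract.π ρD) ⁅ v ⁆} (i₁ p))) (in-P (i₁ p)))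
        ; treeQ = subtree t₂ b₂ (λ p → ∩⁺ (∖⁺ (U⊆W (proj₁ b₂ p)) (∖ʳ {preimage (Retract.π ρC) ⁅ v ⁆} (i₂ p))) (in-Q p)) }
        where
        πC = preimage π C
        cover′ : ∀ {x} → x ∈ W → x ≢ v → Dec (x ∈ πC) → x ∈ (W ∖ ⁅ v ⁆) ∖ πC ⊎ x ∈ (W ∖ ⁅ v ⁆) ∩ πC
        cover′ p q (yes r) = inj₂ (∩⁺ (∖⁺ p (≢⇒∉ q)) r)
        cover′ p q (no r)  = inj₁ (∖⁺ (∖⁺ p (≢⇒∉ q)) r)
        apart : ∀ {x y} → x ∈ W ∖ ⁅ v ⁆ → x ∉ πC → y ∈ W ∖ ⁅ v ⁆ → y ∈ πC → x ~ y → ⊥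
        apart {x} {y} p p′ q q′ e with x ∈? W′ | y ∈? W′
        ... | no x∉ | _ = p′ (pre⁺ {π} (subst (_∈ C) (≡-sym (collapse (∖ˡ p) (∖ˡ q) x∉ e)) (pre⁻ {π} q′)))
        ... | yes _ | no y∉ = p′ (pre⁺ {π} (subst (_∈ C) (collapse (∖ˡ q) (∖ˡ p) y∉ (~-sym e)) (pre⁻ {π} q′)))
        ... | yes x∈ | yes y∈ = p′ (pre⁺ {π} (subst (_∈ C) (≡-sym (fixed x∈))
              (closed (subst (_∈ C) (fixed y∈) (pre⁻ {π} q′)) (∖⁺ x∈ (∖ʳ p)) (~-sym e))))
        in-P : ∀ {z} → z ∈ fibre (Retract.π ρD) v → z ∉ πC
        in-P p q with new-fibre D v∉D clD p
        ... | inj₁ (r , _) = ∖ʳ r (pre⁻ {π} q)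
        ... | inj₂ (_ , r) = v∉C (subst (_∈ C) (⁅⁆⁻ (pre⁻ {π} (∖ˡ {preimage π ⁅ v ⁆} r))) (pre⁻ {π} q))
        in-Q : ∀ {z} → z ∈ V₂ → z ∈ πC
        in-Q {z} p = decidable-stable (z ∈? πC) λ q →
          out (fibre-⊆ ρ (λ r → U⊆W (proj₁ b₂ r)) (tree-conn t₂)
                 (λ r → ∖ʳ {preimage (Retract.π ρC) ⁅ v ⁆} (i₂ r) ⁅⁆⁺) p
                 ([ (λ r → ⊥-elim (q (pre⁺ {π} (proj₁ r)))) , proj₂ ]′ (new-fibre C v∉C clC (i₂ p))))

    -- The identity is a retract with empty fibres, so the shrinking can start there.
    blockOrCut : Conn W → Block n W ⊎ Cut g W U
    blockOrCut cW = shrink W trivial cW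
      (λ c → noSubtree-empty n t λ {x} p → ∖ʳ {preimage (λ x → x) ⁅ c ⁆} {⁅ c ⁆} {x} p (pre⁻ {λ x → x} (∖ˡ p))) (<-wellFounded _)
      where
      trivial : Retract W W
      trivial = record { π = λ x → x ; W′⊆W = λ p → p ; image = λ p → p ; fixed = λ _ → refl
                       ; collapse = λ p _ q _ → ⊥-elim (q p) }
      noSubtree-empty : ∀ n {R U Z} (t : Tree (n + g) R U) → (∀ {x} → x ∈ Z → ⊥) → NoSubtree g n t Z
      noSubtree-empty zero    t h f = h (f (hub∈ (tree-conn t)))
      noSubtree-empty (suc n) (node _ t₀ t₁ _ _ _ _ _) h = noSubtree-empty n t₀ h , noSubtree-empty n t₁ h

  -- Trees whose leaves touch the outside of a region

  descend : ∀ k {g R U} → Tree (k + g) R U → ∃[ R′ ] ∃[ U′ ] (Tree g R′ U′ × U′ ⊆ U)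
  descend zero t = _ , _ , t , (λ p → p)
  descend (suc k) (node {R = R} {U₀ = U₀} _ t₀ _ _ _ _ _ _) =
    let R′ , U′ , t , s = descend k t₀ in R′ , U′ , t , λ p → ∪ʳ {R} (∪ˡ {U₀} (s p))

  module _ {g W U} (C : Cut g W U) where
    open Cut C

    cut-side : ∀ {S x} → S ⊆ W → Conn S → cut ∉ S → x ∈ S → x ∈ P → S ⊆ P
    cut-side {S} S⊆ cS c∉ = conn-⊆ cl cS
      where
      cl : ∀ {u w} → u ∈ S → u ∈ P → u ~ w → w ∈ S → w ∈ P
      cl _ u∈ e w∈ with cover (S⊆ w∈) (λ { refl → c∉ w∈ })
      ... | inj₁ p = p
      ... | inj₂ q = ⊥-elim (no-edge u∈ q e)

    -- A connected set without the cut vertex lies on one side, but `U` has a subtree on each.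
    cut∈ : U ⊆ W → Conn U → cut ∈ U
    cut∈ U⊆ cU = decidable-stable (cut ∈? U) λ c∉ →
      P#Q (cut-side U⊆ cU c∉ (proj₁ P.below (hub∈ cP)) (P.inside (hub∈ cP)) (proj₁ Q.below (hub∈ cQ)))
          (Q.inside (hub∈ cQ))
      where
      module P = Subtree treeP
      module Q = Subtree treeQ
      cP = tree-conn P.tree
      cQ = tree-conn Q.tree

  record Crown (A : Sub) (q : ℕ) (Z : Sub) : Set where
    field
      {R V} : Sub
      tree  : Tree⁺ A q R V
      V⊆    : V ⊆ Z

  module _ {K A : Sub} (n : ℕ)
           (escape : ∀ {c x} → x ∈ K → x ≢ c → ∃[ y ] ∃[ z ] (Path (K ∖ ⁅ c ⁆) x y × z ∈ A × y ~ z)) where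

    -- `D` hangs at `c` alone, so an escape route from `D` that avoids `c` stays in `D` until it is
    -- next to `A`. The gate is the neighbour of `c` by which a crown in `D` will be hung below a
    -- root bag containing `c`.
    record Away (c : Vertex) (D : Sub) : Set where
      field
        D⊆     : D ⊆ K
        D-conn : Conn D
        c∉     : c ∉ D
        closed : ∀ {x y} → x ∈ D → y ∈ K → x ~ y → y ∈ D ⊎ y ≡ c
        {gate} : Vertex
        gate∈  : gate ∈ D
        gate~  : c ~ gate

    record AwaySide {g W U} (C : Cut g W U) : Set where
      field
        {D}  : Sub
        away : Away (Cut.cut C) D
        D⊆P  : D ⊆ Cut.P C
        V⊆D  : Subtree.V (Cut.treeP C) ⊆ D

    away-side : ∀ {g W U} (C : Cut g W U) → W ⊆ K → Conn W → U ⊆ W → Conn U →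
                (∀ {x y} → x ∈ Cut.P C → y ∈ K → x ~ y → y ∈ W) → AwaySide C
    away-side {g} {W} {U} C W⊆K cW U⊆W cU cl = record
      { away = record { D⊆ = λ p → W⊆K (∖ˡ (⊆S p)) ; D-conn = isConn ; c∉ = λ p → ∖ʳ (⊆S p) ⁅⁆⁺
                      ; closed = closed′ ; gate∈ = proj₁ (proj₂ gate) ; gate~ = proj₂ (proj₂ gate) }
      ; D⊆P = D⊆P ; V⊆D = V⊆D }
      where
      open Cut C
      module T = Subtree treeP
      cV = tree-conn T.tree
      in-W∖ : P ⊆ W ∖ ⁅ cut ⁆
      in-W∖ p = ∖⁺ (P⊆ p) (≢⇒∉ λ { refl → cut∉P p })
      open Component (component (W ∖ ⁅ cut ⁆) (in-W∖ (T.inside (hub∈ cV))))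
      D⊆P : set ⊆ P
      D⊆P = cut-side C (λ p → ∖ˡ (⊆S p)) isConn (λ p → ∖ʳ (⊆S p) ⁅⁆⁺) has (T.inside (hub∈ cV))
      V⊆D : T.V ⊆ set
      V⊆D = conn-⊆ (λ _ p e q → closed p (in-W∖ (T.inside q)) e) cV (hub∈ cV) has
      closed′ : ∀ {x y} → x ∈ set → y ∈ K → x ~ y → y ∈ set ⊎ y ≡ cut
      closed′ {y = y} p q e with y ≟ cut
      ... | yes r = inj₂ r
      ... | no r  = inj₁ (closed p (∖⁺ (cl (D⊆P p) q e) (≢⇒∉ r)) e)
      gate : ∃[ d ] (d ∈ set × cut ~ d)
      gate with approach {Y = ⁅ cut ⁆} (conn-walk cW (∖ˡ (⊆S has)) (U⊆W (cut∈ C U⊆W cU))) (∖ʳ (⊆S has)) ⁅⁆⁺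
      ... | u , _ , w , e , q , _ with refl ← ⁅⁆⁻ q =
        u , proj₂ (∩⁻ (end∈ (stay (λ _ p e q → closed p q e) w has))) , ~-sym e

    record Rooted (q : ℕ) (c : Vertex) (D : Sub) : Set where
      field
        {R V}    : Sub
        tree     : Tree⁺ A q R V
        V⊆       : V ⊆ D
        {anchor} : Vertex
        anchor∈  : anchor ∈ R
        anchor~  : c ~ anchor

    -- For `q = 0` the whole region is a leaf, as it touches `A`. Otherwise two disjoint subregions
    -- are sought, each hanging at a vertex of what remains: the first is the side of a cut away
    -- from `c`, the second comes from cutting again along a subtree on the side of `c`. The
    -- remainder is the new root bag.
    crown : ∀ q {c D R U} → Away c D → c ∈ K → Tree (crown-height n q) R U → U ⊆ D → Block n K ⊎ Rooted q c D
    crown zero {c} {D} α _ t U⊆D with escape (D⊆ (hub∈ D-conn)) (λ { refl → c∉ (hub∈ D-conn) })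
      where open Away α
    ... | y , z , w , z∈ , e = inj₂ record
      { tree = leaf D-conn (y , z , proj₂ (∩⁻ (end∈ (stay cl w (hub∈ D-conn)))) , z∈ , e) ; V⊆ = λ p → p ; anchor∈ = gate∈ ; anchor~ = gate~ }
      where
      open Away α
      cl : ∀ {u w} → u ∈ K ∖ ⁅ c ⁆ → u ∈ D → u ~ w → w ∈ K ∖ ⁅ c ⁆ → w ∈ D
      cl _ p e q with closed p (∖ˡ q) e
      ... | inj₁ r = r
      ... | inj₂ refl = ⊥-elim (∖ʳ q ⁅⁆⁺)
    crown (suc q) {c} {D} {R} {U} α c∈K t U⊆D = first (blockOrCut g₁ n t U⊆W cW)
      where
      open Away α
      g₁ = suc (n + crown-height n q)
      W = D ∪ ⁅ c ⁆
      W⊆K : W ⊆ K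
      W⊆K = ∪⊆ D⊆ (⁅⁆⊆ c∈K)
      c∈W : c ∈ W
      c∈W = ∪ʳ {D} ⁅⁆⁺
      cW : Conn W
      cW = conn-∪-touch D-conn conn-⁅⁆ (gate , c , gate∈ , ⁅⁆⁺ , ~-sym gate~)
      U⊆W : U ⊆ W
      U⊆W p = ∪ˡ {D} (U⊆D p)
      W-D : ∀ {x} → x ∈ W → x ≢ c → x ∈ D
      W-D p x≢c = [ (λ q → q) , (λ q → ⊥-elim (x≢c (⁅⁆⁻ q))) ]′ (∪⁻ {D} p)
      Goal = Block n K ⊎ Rooted (suc q) c D

      widen : Block n W → Goal
      widen (block 2c B⊆ t U⊆) = inj₁ (block 2c (λ p → W⊆K (B⊆ p)) t U⊆)

      closed-W : ∀ {S x y} → S ⊆ W → c ∉ S → x ∈ S → y ∈ K → x ~ y → y ∈ W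
      closed-W S⊆ c∉S p q e with closed (W-D (S⊆ p) (λ { refl → c∉S p })) q e
      ... | inj₁ r = ∪ˡ {D} r
      ... | inj₂ refl = c∈W

      first′ : (C : Cut g₁ W U) → c ∈ Cut.Q C → Goal
      first′ C c∈Q = grow₁ (crown q away₁ (W⊆K (∪ˡ {D} cut∈D)) (proj₁ (proj₂ (proj₂ low)))
                               (λ p → V⊆D (proj₂ (proj₂ (proj₂ low)) p)))
        where
        open Cut C
        c∉P : c ∉ P
        c∉P p = P#Q p c∈Q
        open AwaySide (away-side C W⊆K cW U⊆W (tree-conn t) (closed-W P⊆ c∉P)) renaming (D to D₁; away to away₁; D⊆P to D₁⊆P)
        module D₁ = Away away₁
        low = descend (suc n) (Subtree.tree treeP)
        cut∈U : cut ∈ U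
        cut∈U = cut∈ C U⊆W (tree-conn t)
        cut∈D : cut ∈ D
        cut∈D = U⊆D cut∈U
        D₁⊆D : D₁ ⊆ D
        D₁⊆D p = W-D (P⊆ (D₁⊆P p)) λ { refl → c∉P (D₁⊆P p) }
        c∉U : c ∉ U
        c∉U p = c∉ (U⊆D p)
        grow₁ : Block n K ⊎ Rooted q cut D₁ → Goal
        grow₁ (inj₁ b) = inj₁ b
        grow₁ (inj₂ κ₁) with approach (conn-walk cW c∈W (U⊆W cut∈U)) c∉U cut∈U
        ... | u , v , w , e , v∈U , _ = second (blockOrCut (crown-height n q) n T′.tree V′⊆W cW)
          where
          module κ₁ = Rooted κ₁
          module T₂ = Subtree treeQ
          module T′ = Pruned (prune T₂.tree T₂.below v)
          V′ = T′.V′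
          V′⊆U : V′ ⊆ U
          V′⊆U = proj₁ T′.below
          V′⊆W : V′ ⊆ W
          V′⊆W p = U⊆W (V′⊆U p)
          V′⊆Q : V′ ⊆ Q
          V′⊆Q p = T₂.inside (T′.⊆V p)
          -- This connected set ties `c` to the first cut vertex and avoids `V′`, which contains the
          -- second cut vertex. Hence the first cut vertex is on the side of `c` in the second cut,
          -- and the far region `D₂` stays clear of it. For `X` to be connected, `V′` was pruned at
          -- the vertex `v` where the walk from `c` enters `U`.
          X = trace w ∪ (U ∖ V′)
          X-conn : Conn X
          X-conn = conn-∪-touch (conn-trace w) T′.rest (u , v , end-trace w , ∖⁺ v∈U T′.avoids , e)
          c∈X : c ∈ X
          c∈X = ∪ˡ {trace w} (start-trace w)
          cut∈X : cut ∈ X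
          cut∈X = ∪ʳ {trace w} (∖⁺ cut∈U λ p → cut∉Q (V′⊆Q p))
          X⊆W : X ⊆ W
          X⊆W = ∪⊆ (λ p → ∖ˡ (trace⊆ w p)) (λ p → U⊆W (∖ˡ p))
          X#V′ : Disj X V′
          X#V′ = disj-∪ (λ p q → ∖ʳ (trace⊆ w p) (V′⊆U q)) ∖ʳ

          second′ : (C : Cut (crown-height n q) W V′) → c ∈ Cut.Q C → Goal
          second′ C₂ c∈Q₂ = grow₂ (crown q away₂ (W⊆K (V′⊆W cut₂∈V′)) T₃.tree V₃⊆D₂)
            where
            module C₂ = Cut C₂
            module T₃ = Subtree C₂.treeP
            cut₂∈V′ : C₂.cut ∈ V′
            cut₂∈V′ = cut∈ C₂ V′⊆W (tree-conn T′.tree)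
            c∉P₂ : c ∉ C₂.P
            c∉P₂ p = C₂.P#Q p c∈Q₂
            open AwaySide (away-side C₂ W⊆K cW V′⊆W (tree-conn T′.tree) (closed-W C₂.P⊆ c∉P₂))
              renaming (D to D₂; away to away₂; D⊆P to D₂⊆P; V⊆D to V₃⊆D₂)
            module D₂ = Away away₂
            X⊆Q₂ : X ⊆ C₂.Q
            X⊆Q₂ = cut-side (flip-cut C₂) X⊆W X-conn (λ p → X#V′ p cut₂∈V′) c∈X c∈Q₂
            cut∉D₂ : cut ∉ D₂
            cut∉D₂ p = C₂.P#Q (D₂⊆P p) (X⊆Q₂ cut∈X)
            D₂⊆W : D₂ ⊆ W
            D₂⊆W p = C₂.P⊆ (D₂⊆P p)
            D₂⊆D : D₂ ⊆ D
            D₂⊆D p = W-D (D₂⊆W p) λ { refl → c∉P₂ (D₂⊆P p) }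
            D₂⊆Q : D₂ ⊆ Q
            D₂⊆Q = cut-side (flip-cut C) D₂⊆W D₂.D-conn cut∉D₂ (V₃⊆D₂ x∈) (V′⊆Q (proj₁ T₃.below x∈))
              where x∈ = hub∈ (tree-conn T₃.tree)
            D₁#D₂ : Disj D₁ D₂
            D₁#D₂ p q = P#Q (D₁⊆P p) (D₂⊆Q q)
            -- Each removed region hangs at a single vertex, so the remainder stays connected; it
            -- contains both cut vertices and the gate to `c`, which becomes the anchor of the
            -- larger crown.
            N = D ∖ (D₁ ∪ D₂)
            cut∈N : cut ∈ N
            cut∈N = ∖⁺ cut∈D λ p → [ D₁.c∉ , cut∉D₂ ]′ (∪⁻ p)
            cut₂∈N : C₂.cut ∈ N
            cut₂∈N = ∖⁺ (U⊆D (V′⊆U cut₂∈V′)) λ p → [ (λ q → P#Q (D₁⊆P q) (V′⊆Q cut₂∈V′)) , D₂.c∉ ]′ (∪⁻ p)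
            c≢cut : c ≢ cut
            c≢cut refl = c∉ cut∈D
            c≢cut₂ : c ≢ C₂.cut
            c≢cut₂ refl = c∉ (U⊆D (V′⊆U cut₂∈V′))
            gate∈N : gate ∈ N
            gate∈N = ∖⁺ gate∈ λ p → [ (λ q → [ (λ r → c∉ (D₁⊆D r)) , c≢cut ]′ (D₁.closed q c∈K (~-sym gate~)))
                                    , (λ q → [ (λ r → c∉ (D₂⊆D r)) , c≢cut₂ ]′ (D₂.closed q c∈K (~-sym gate~))) ]′ (∪⁻ p)
            N-conn : Conn N
            N-conn = conn-≈ (λ p → ∖⁺ (∖ˡ (∖ˡ p)) λ q → [ ∖ʳ (∖ˡ p) , ∖ʳ p ]′ (∪⁻ q))
                            (λ p → ∖⁺ (∖⁺ (∖ˡ p) λ q → ∖ʳ p (∪ˡ q)) λ q → ∖ʳ p (∪ʳ q))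
              (conn-remove (conn-remove D-conn cut∈D D₁.c∉ (λ p q e → D₁.closed p (D⊆ q) e))
                (∖⁺ (∖ˡ cut₂∈N) λ q → ∖ʳ cut₂∈N (∪ˡ q)) D₂.c∉ (λ p q e → D₂.closed p (D⊆ (∖ˡ q)) e))
            grow₂ : Block n K ⊎ Rooted q C₂.cut D₂ → Goal
            grow₂ (inj₁ b) = inj₁ b
            grow₂ (inj₂ κ₂) = inj₂ record
              { tree = node N-conn κ₁.tree κ₂.tree
                            (cut , κ₁.anchor , cut∈N , κ₁.anchor∈ , κ₁.anchor~)
                            (C₂.cut , κ₂.anchor , cut₂∈N , κ₂.anchor∈ , κ₂.anchor~)
                            (λ p q → ∖ʳ p (∪ˡ (κ₁.V⊆ q))) (λ p q → ∖ʳ p (∪ʳ (κ₂.V⊆ q)))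
                            (λ p q → D₁#D₂ (κ₁.V⊆ p) (κ₂.V⊆ q))
              ; V⊆ = ∪⊆ ∖ˡ (∪⊆ (λ p → D₁⊆D (κ₁.V⊆ p)) (λ p → D₂⊆D (κ₂.V⊆ p)))
              ; anchor∈ = gate∈N ; anchor~ = gate~ }
              where module κ₂ = Rooted κ₂

          second : Block n W ⊎ Cut (crown-height n q) W V′ → Goal
          second (inj₁ b) = widen b
          second (inj₂ C₂) with Cut.cover C₂ c∈W (λ { refl → c∉U (V′⊆U (cut∈ C₂ V′⊆W (tree-conn T′.tree))) })
          ... | inj₂ c∈Q₂ = second′ C₂ c∈Q₂
          ... | inj₁ c∈P₂ = second′ (flip-cut C₂) c∈P₂

      first : Block n W ⊎ Cut g₁ W U → Goal
      first (inj₁ b) = widen b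
      first (inj₂ C) with Cut.cover C c∈W (λ { refl → c∉ (U⊆D (cut∈ C U⊆W (tree-conn t))) })
      ... | inj₂ c∈Q = first′ C c∈Q
      ... | inj₁ c∈P = first′ (flip-cut C) c∈P

    blockOrCrown : ∀ q {R U} → Conn K → Tree (n + crown-height n q) R U → U ⊆ K → Block n K ⊎ Crown A q K
    blockOrCrown q cK t U⊆K with blockOrCut (crown-height n q) n t U⊆K cK
    ... | inj₁ b = inj₁ b
    ... | inj₂ C with crown q away (U⊆K (cut∈ C U⊆K (tree-conn t))) (Subtree.tree (Cut.treeP C)) V⊆D
      where open AwaySide (away-side C (λ p → p) cK U⊆K (tree-conn t) (λ _ q _ → q))
    ...   | inj₁ b = inj₁ b
    ...   | inj₂ κ = inj₂ record { tree = Rooted.tree κ ; V⊆ = λ p → Away.D⊆ away (Rooted.V⊆ κ p) }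
      where open AwaySide (away-side C (λ p → p) cK U⊆K (tree-conn t) (λ _ q _ → q))

  -- Attaching a 2-connected piece

  opaque
    -- With `f` the identity this is the graph induced on `H`, as used for links; with `f` a
    -- contraction it is the contracted graph, as used for routes.
    arcs : (Vertex → Vertex) → Sub → Arcs
    arcs f H = map (λ e → f (proj₁ e) , f (proj₂ e))
      (filter (λ e → (proj₁ e ∈? H) ×-dec (proj₂ e ∈? H) ×-dec (proj₁ e ~? proj₂ e))
              (cartesianProduct (allFin (n G)) (allFin (n G))))

    arc⁺ : ∀ {f H u v} → u ∈ H → v ∈ H → u ~ v → Arc (arcs f H) (f u) (f v)
    arc⁺ {f} {H} {u} {v} p q e = ∈-map⁺ (λ e → f (proj₁ e) , f (proj₂ e))
      (∈-filter⁺ (λ e → (proj₁ e ∈? H) ×-dec (proj₂ e ∈? H) ×-dec (proj₁ e ~? proj₂ e))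
        (∈-cartesianProduct⁺ (∈-allFin u) (∈-allFin v)) (p , q , e))

    arc⁻ : ∀ {f H p q} → Arc (arcs f H) p q →
           ∃[ u ] ∃[ v ] (u ∈ H × v ∈ H × u ~ v × p ≡ f u × q ≡ f v)
    arc⁻ {f} {H} m with ∈-map⁻ (λ e → f (proj₁ e) , f (proj₂ e)) m
    ... | (u , v) , m′ , refl with ∈-filter⁻ (λ e → (proj₁ e ∈? H) ×-dec (proj₂ e ∈? H) ×-dec (proj₁ e ~? proj₂ e))
                                     {xs = cartesianProduct (allFin (n G)) (allFin (n G))} m′
    ...   | _ , p , q , e = u , v , p , q , e , refl , refl

  separated : ∀ {f H X Y H₀ x y} (σ : Separation (arcs f H) X Y) → H₀ ⊆ H →
              (∀ {z} → z ∈ H₀ → f z ≢ Separation.cut σ) → Path H₀ x y → f x ∈ X → f y ∉ Y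
  separated {f} {Y = Y} {H₀} σ H₀⊆ avoid w fx∈ = go w ([ (λ p → p) , (λ p → ⊥-elim (avoid (start∈ w) p)) ]′ (source fx∈))
    where
    open Separation σ
    go : ∀ {x y} → Path H₀ x y → f x ∈ side → f y ∉ Y
    go (nil p) q = target q
    go (cons p e w) q with closed q (arc⁺ (H₀⊆ p) (H₀⊆ (start∈ w)) e)
    ... | inj₁ r = go w r
    ... | inj₂ r = ⊥-elim (avoid (start∈ w) r)

  arc-path : ∀ {H P x y} → x ∈ H → Walk (Arc (arcs (λ x → x) H)) P x y → Path (P ∩ H) x y
  arc-path x∈ (nil p) = nil (∩⁺ p x∈)
  arc-path x∈ (cons p e w) with arc⁻ e
  ... | _ , _ , q , r , e′ , refl , refl = cons (∩⁺ p q) e′ (arc-path r w)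

  record Link (H S B P : Sub) : Set where
    field
      {h s}  : Vertex
      {L}    : Sub
      L-conn : Conn L
      h∈L    : h ∈ L
      h∈B    : h ∈ B
      only   : ∀ {x} → x ∈ L → x ∈ B → x ≡ h
      s∈S    : s ∈ S
      s∈P    : s ∈ P
      touch  : Touch L ⁅ s ⁆
      L⊆P    : L ⊆ P
      L⊆H    : L ⊆ H
      L#S    : Disj L S

  -- The path is cut at its first visit to `S` and then, read backwards, at its first visit to `B`.
  link : ∀ {H S B P x y} → Path (P ∩ H) x y → x ∈ B → y ∈ S → Disj B S → Link H S B P
  link {H} {S} {B} {P} {x} w x∈B y∈S B#S with approach {Y = S} w (B#S x∈B) y∈S
  ... | u , s , w₁ , e , s∈S , s∈ with u ∈? B
  ...   | yes u∈B = record
    { L-conn = conn-⁅⁆ ; h∈L = ⁅⁆⁺ ; h∈B = u∈B ; only = λ p _ → ⁅⁆⁻ p ; s∈S = s∈S ; s∈P = proj₁ (∩⁻ s∈)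
    ; touch = u , s , ⁅⁆⁺ , ⁅⁆⁺ , e ; L⊆P = ⁅⁆⊆ (proj₁ (∩⁻ u∈)) ; L⊆H = ⁅⁆⊆ (proj₂ (∩⁻ u∈))
    ; L#S = λ p q → ∖ʳ (end∈ w₁) (⁅⁆⊆ (subst (_∈ S) (⁅⁆⁻ p) q) ⁅⁆⁺) }
    where u∈ = ∖ˡ (end∈ w₁)
  ...   | no u∉B with approach {Y = B} (revW w₁) u∉B x∈B
  ...     | t , h , w₂ , e₂ , h∈B , h∈ = record
    { L = ⁅ h ⁆ ∪ trace w₂
    ; L-conn = conn-∪-touch conn-⁅⁆ (conn-trace w₂) (h , t , ⁅⁆⁺ , end-trace w₂ , ~-sym e₂)
    ; h∈L = ∪ˡ ⁅⁆⁺ ; h∈B = h∈B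
    ; only = λ p q → [ ⁅⁆⁻ , (λ r → ⊥-elim (∖ʳ (trace⊆ w₂ r) q)) ]′ (∪⁻ p)
    ; s∈S = s∈S ; s∈P = proj₁ (∩⁻ s∈) ; touch = u , s , ∪ʳ (start-trace w₂) , ⁅⁆⁺ , e
    ; L⊆P = λ p → proj₁ (∩⁻ (∖ˡ (L⊆ p))) ; L⊆H = λ p → proj₂ (∩⁻ (∖ˡ (L⊆ p))) ; L#S = λ p → ∖ʳ (L⊆ p) }
    where
    L⊆ : ⁅ h ⁆ ∪ trace w₂ ⊆ (P ∩ H) ∖ S
    L⊆ = ∪⊆ (⁅⁆⊆ h∈) (λ p → ∖ˡ (trace⊆ w₂ p))

  record Attached (n : ℕ) (H S : Sub) : Set where
    field
      blk   : Block n (H ∖ S)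
      {P Q} : Sub
      P#Q   : Disj P Q
      link₁ : Link H S (Block.B blk) P
      link₂ : Link H S (Block.B blk) Q

  -- This substitute for 2-connectedness also holds for a 2-connected piece with paths to two ends
  -- `a` and `b`, which need not be 2-connected itself.
  Escapes : Sub → Sub → Set
  Escapes H S = ∀ {v x} → x ∈ H → x ≢ v → ∃[ s ] (s ∈ S × Path (H ∖ ⁅ v ⁆) x s)

  two-vertices : ∀ {n R U} → Tree (suc n) R U → ∀ v → ∃[ x ] (x ∈ U × x ≢ v)
  two-vertices (node {R = R} {U₀ = U₀} c t₀ _ _ _ d _ _) v with hub c ≟ v
  ... | no p = _ , ∪ˡ (hub∈ c) , p
  ... | yes refl = _ , ∪ʳ (∪ˡ (hub∈ (tree-conn t₀))) , λ p → d (hub∈ c) (subst (_∈ U₀) p (hub∈ (tree-conn t₀)))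

  -- No vertex cuts off another one from `S`, so the component carrying the tree satisfies the
  -- hypothesis on crowns, and a one-vertex separation of the block from `S` is refuted by a second
  -- vertex of the block. The apex `A` may exceed `S` and even `H`: it has to be connected
  -- eventually, and `S` may not be.
  attach : ∀ {H S A R U} n q → S ⊆ H → S ⊆ A → Escapes H S →
           Tree (attach-height q n) R U → U ⊆ H ∖ S → Crown A q (H ∖ S) ⊎ Attached (suc n) H S
  attach {H} {S} {A} n q S⊆H S⊆A esc t U⊆ = go (blockOrCrown {K} {A} (suc n) escape q isConn t U⊆K)
    where
    open Component (component (H ∖ S) (U⊆ (hub∈ (tree-conn t)))) renaming (set to K)
    U⊆K : _ ⊆ K
    U⊆K = conn-⊆ (λ _ p e q → closed p (U⊆ q) e) (tree-conn t) (hub∈ (tree-conn t)) has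
    escape : ∀ {c x} → x ∈ K → x ≢ c → ∃[ y ] ∃[ z ] (Path (K ∖ ⁅ c ⁆) x y × z ∈ A × y ~ z)
    escape {c} x∈ x≢c with esc (∖ˡ (⊆S x∈)) x≢c
    ... | s , s∈ , w with approach {Y = S} w (∖ʳ (⊆S x∈)) s∈
    ...   | u , v , w′ , e , v∈ , _ = u , v
            , mapW (λ p → ∖⁺ (proj₂ (∩⁻ p)) (∖ʳ (∖ˡ (proj₁ (∩⁻ p)))))
                (stay {R = K} (λ _ p e q → closed p (∖⁺ (∖ˡ (∖ˡ q)) (∖ʳ q)) e) w′ x∈)
            , S⊆A v∈ , e
    go : Block (suc n) K ⊎ Crown A q K → Crown A q (H ∖ S) ⊎ Attached (suc n) H S
    go (inj₂ κ) = inj₁ record { tree = Crown.tree κ ; V⊆ = λ p → ⊆S (Crown.V⊆ κ p) }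
    go (inj₁ (block {B} 2c B⊆ t′ U⊆B)) with menger (hub isConn) (arcs (λ x → x) H) B S
    ... | inj₁ σ = ⊥-elim (impossible (two-vertices t′ (Separation.cut σ)))
      where
      impossible : ∃[ x ] (x ∈ _ × x ≢ Separation.cut σ) → ⊥
      impossible (x , x∈ , x≢) with esc (∖ˡ (⊆S (B⊆ (U⊆B x∈)))) x≢
      ... | s , s∈ , w = separated σ ∖ˡ (λ p r → ∖ʳ p (subst (_∈ ⁅ Separation.cut σ ⁆) (≡-sym r) ⁅⁆⁺)) w (U⊆B x∈) s∈
    ... | inj₂ λλ = inj₂ record
      { blk = block 2c B⊆H t′ U⊆B ; P#Q = disj
      ; link₁ = link (arc-path (∖ˡ (B⊆H x₁∈)) walk₁) x₁∈ y₁∈ (λ p → ∖ʳ (B⊆H p))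
      ; link₂ = link (arc-path (∖ˡ (B⊆H x₂∈)) walk₂) x₂∈ y₂∈ (λ p → ∖ʳ (B⊆H p)) }
      where
      open Linkage λλ
      B⊆H : B ⊆ H ∖ S
      B⊆H p = ⊆S (B⊆ p)

  -- Rerouting paths

  data Simple : Vertex → Vertex → Sub → Set where
    one  : ∀ {x} → Simple x x ⁅ x ⁆
    more : ∀ {x y z S} → x ~ y → x ∉ S → Simple y z S → Simple x z (⁅ x ⁆ ∪ S)

  simple-start : ∀ {x y S} → Simple x y S → x ∈ S
  simple-start one = ⁅⁆⁺
  simple-start (more _ _ _) = ∪ˡ ⁅⁆⁺

  simple-end : ∀ {x y S} → Simple x y S → y ∈ S
  simple-end one = ⁅⁆⁺
  simple-end (more _ _ s) = ∪ʳ (simple-end s)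

  simple-path : ∀ {x y S} → Simple x y S → Path S x y
  simple-path one = nil ⁅⁆⁺
  simple-path (more e _ s) = cons (∪ˡ ⁅⁆⁺) e (mapW ∪ʳ (simple-path s))

  simple-conn : ∀ {x y S} → Simple x y S → Conn S
  simple-conn one = conn-⁅⁆
  simple-conn (more e _ s) = conn-∪-touch conn-⁅⁆ (simple-conn s) (_ , _ , ⁅⁆⁺ , simple-start s , e)

  suffix : ∀ {x y z S} → Simple y z S → x ∈ S → ∃[ T ] (Simple x z T × T ⊆ S)
  suffix one p with refl ← ⁅⁆⁻ p = _ , one , λ q → q
  suffix (more {y} e y∉ s) p with ∪⁻ p
  ... | inj₁ q with refl ← ⁅⁆⁻ q = _ , more e y∉ s , λ r → r
  ... | inj₂ q with suffix s q
  ...   | T , s′ , T⊆ = T , s′ , λ r → ∪ʳ (T⊆ r)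

  simple : ∀ {A x y} → Path A x y → ∃[ S ] (Simple x y S × S ⊆ A)
  simple (nil p) = _ , one , ⁅⁆⊆ p
  simple (cons {x} p e w) with simple w
  ... | S , s , S⊆ with x ∈? S
  ...   | no x∉ = _ , more e x∉ s , ∪⊆ (⁅⁆⊆ p) S⊆
  ...   | yes x∈ with suffix s x∈
  ...     | T , s′ , T⊆ = T , s′ , λ r → S⊆ (T⊆ r)

  toward-end : ∀ {x z u v S} → Simple x z S → u ∈ S → u ≢ v → Path (S ∖ ⁅ v ⁆) u x ⊎ Path (S ∖ ⁅ v ⁆) u z
  toward-end one u∈ u≢v with refl ← ⁅⁆⁻ u∈ = inj₁ (nil (∖⁺ u∈ (≢⇒∉ u≢v)))
  toward-end {x} {v = v} (more {y = y} {S = S} e x∉ s) u∈ u≢v with ∪⁻ u∈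
  ... | inj₁ p with refl ← ⁅⁆⁻ p = inj₁ (nil (∖⁺ u∈ (≢⇒∉ u≢v)))
  ... | inj₂ p with x ≟ v
  ...   | yes refl = inj₂ (mapW (λ q → ∖⁺ (∪ʳ q) λ r → x∉ (subst (_∈ S) (⁅⁆⁻ r) q))
                                (conn-walk (simple-conn s) p (simple-end s)))
  ...   | no x≢v with toward-end s p u≢v
  ...     | inj₂ w = inj₂ (mapW (λ q → ∖⁺ (∪ʳ (∖ˡ q)) (∖ʳ q)) w)
  ...     | inj₁ w = inj₁ (mapW (λ q → ∖⁺ (∪ʳ (∖ˡ q)) (∖ʳ q)) w ++W
                           cons (∖⁺ (∪ʳ (∖ˡ (end∈ w))) (∖ʳ (end∈ w))) (~-sym e) (nil (∖⁺ (∪ˡ ⁅⁆⁺) (≢⇒∉ x≢v))))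

  record Split (a b : Vertex) (S : Sub) (s t : Vertex) : Set where
    field
      {P Q}  : Sub
      P-conn : Conn P
      Q-conn : Conn Q
      P#Q    : Disj P Q
      P⊆     : P ⊆ S
      Q⊆     : Q ⊆ S
      touch  : Touch P Q
      a∈P    : a ∈ P
      b∈Q    : b ∈ Q
      sides  : (s ∈ P × t ∈ Q) ⊎ (t ∈ P × s ∈ Q)

  -- The path is cut right behind the first of the two vertices that it meets.
  split : ∀ {a b S s t} → Simple a b S → s ∈ S → t ∈ S → s ≢ t → Split a b S s t
  split one s∈ t∈ s≢t = ⊥-elim (s≢t (trans (⁅⁆⁻ s∈) (≡-sym (⁅⁆⁻ t∈))))
  split {s = s} {t} (more {x} {y} {z} {S} e x∉ p) s∈ t∈ s≢t with ∪⁻ s∈ | ∪⁻ t∈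
  ... | inj₁ q | inj₁ r = ⊥-elim (s≢t (trans (⁅⁆⁻ q) (≡-sym (⁅⁆⁻ r))))
  ... | inj₁ q | inj₂ r = record
    { P-conn = conn-⁅⁆ ; Q-conn = simple-conn p ; P#Q = λ u v → x∉ (subst (_∈ S) (⁅⁆⁻ u) v) ; P⊆ = ∪ˡ ; Q⊆ = ∪ʳ
    ; touch = _ , _ , ⁅⁆⁺ , simple-start p , e ; a∈P = ⁅⁆⁺ ; b∈Q = simple-end p ; sides = inj₁ (q , r) }
  ... | inj₂ q | inj₁ r = record
    { P-conn = conn-⁅⁆ ; Q-conn = simple-conn p ; P#Q = λ u v → x∉ (subst (_∈ S) (⁅⁆⁻ u) v) ; P⊆ = ∪ˡ ; Q⊆ = ∪ʳ
    ; touch = _ , _ , ⁅⁆⁺ , simple-start p , e ; a∈P = ⁅⁆⁺ ; b∈Q = simple-end p ; sides = inj₂ (r , q) }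
  ... | inj₂ q | inj₂ r = record
    { P-conn = conn-∪-touch conn-⁅⁆ P-conn (_ , _ , ⁅⁆⁺ , a∈P , e) ; Q-conn = Q-conn
    ; P#Q = disj-∪ (λ u v → x∉ (Q⊆ (subst (_∈ Q) (⁅⁆⁻ u) v))) P#Q
    ; P⊆ = ∪-mono (λ u → u) P⊆ ; Q⊆ = λ u → ∪ʳ (Q⊆ u) ; touch = touch-mono ∪ʳ (λ u → u) touch
    ; a∈P = ∪ˡ ⁅⁆⁺ ; b∈Q = b∈Q ; sides = [ (λ (u , v) → inj₁ (∪ʳ u , v)) , (λ (u , v) → inj₂ (∪ʳ u , v)) ]′ sides }
    where open Split (split p q r s≢t)

  record Shortcut (g : ℕ) (U : Sub) (x y : Vertex) : Set where
    field
      {R Z} : Sub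
      tree  : Tree g R Z
      Z⊆    : Z ⊆ U
      path  : Path (U ∖ Z) x y

  -- Pruning at `x` and then at `y` leaves a subtree that avoids both and whose complement in `U` is
  -- connected.
  shortcut : ∀ {g R U x y} → Tree (2 + g) R U → x ∈ U → y ∈ U → Shortcut g U x y
  shortcut {x = x} {y} t x∈ y∈ = record
    { tree = tree ; Z⊆ = proj₁ below ; path = conn-walk rest (∖⁺ x∈ (λ p → P.avoids (⊆V p))) (∖⁺ y∈ avoids) }
    where
    module P = Pruned (prune t below-refl x)
    open Pruned (prune P.tree P.below y)

  record Detour (g : ℕ) (H U : Sub) (x y : Vertex) : Set where
    field
      {R Z} : Sub
      tree  : Tree g R Z
      Z⊆    : Z ⊆ U
      path  : Path (H ∖ Z) x y

  -- If the path hits `U`, only its parts from either end up to the first contact with `U` are kept;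
  -- a shortcut inside `U` joins the two contacts.
  detour : ∀ {g H R U x y} → Tree (2 + g) R U → U ⊆ H → x ∉ U → y ∉ U → Path H x y → Detour g H U x y
  detour {g} {H} {R} {U} {x} {y} t U⊆H x∉ y∉ w with any? (λ z → (z ∈? trace w) ×-dec (z ∈? U))
  ... | no none with descend 2 t
  ...   | _ , _ , t′ , Z⊆ = record
    { tree = t′ ; Z⊆ = Z⊆ ; path = mapW (λ p → ∖⁺ (trace⊆ w p) (λ q → none (_ , p , Z⊆ q)))
                                         (conn-walk (conn-trace w) (start-trace w) (end-trace w)) }
  detour {g} {H} {R} {U} {x} {y} t U⊆H x∉ y∉ w | yes (z , z∈ , z∈U)
    with approach {Y = U} (conn-walk (conn-trace w) (start-trace w) z∈) x∉ z∈U
       | approach {Y = U} (conn-walk (conn-trace w) (end-trace w) z∈) y∉ z∈U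
  ... | u₁ , v₁ , w₁ , e₁ , v₁∈ , _ | u₂ , v₂ , w₂ , e₂ , v₂∈ , _ = record
    { tree = tree ; Z⊆ = Z⊆
    ; path = outside w₁ ++W cons (end∈ (outside w₁)) e₁ (inside ++W
             cons (end∈ inside) (~-sym e₂) (revW (outside w₂))) }
    where
    open Shortcut (shortcut t v₁∈ v₂∈)
    outside : ∀ {u v} → Path (trace w ∖ U) u v → Path (H ∖ Z) u v
    outside = mapW (λ p → ∖⁺ (trace⊆ w (∖ˡ p)) λ q → ∖ʳ p (Z⊆ q))
    inside : Path (H ∖ Z) v₁ v₂
    inside = mapW (λ p → ∖⁺ (U⊆H (∖ˡ p)) (∖ʳ p)) path

  record Routes (g : ℕ) (H Y U : Sub) (a b : Vertex) : Set where
    field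
      {P Q R Z} : Sub
      P#Q       : Disj P Q
      P⊆        : P ⊆ H
      Q⊆        : Q ⊆ H
      {y₁ y₂}   : Vertex
      y₁∈       : y₁ ∈ Y
      y₂∈       : y₂ ∈ Y
      path₁     : Path P a y₁
      path₂     : Path Q b y₂
      tree      : Tree g R Z
      Z⊆        : Z ⊆ U
      Z#P       : Disj Z P
      Z#Q       : Disj Z Q

  flip-routes : ∀ {g H Y U a b} → Routes g H Y U a b → Routes g H Y U b a
  flip-routes ρ = record
    { P#Q = disj-sym P#Q ; P⊆ = Q⊆ ; Q⊆ = P⊆ ; y₁∈ = y₂∈ ; y₂∈ = y₁∈ ; path₁ = path₂ ; path₂ = path₁
    ; tree = tree ; Z⊆ = Z⊆ ; Z#P = Z#Q ; Z#Q = Z#P }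
    where open Routes ρ

  module Contract (H V : Sub) (r : Vertex) (r∈V : r ∈ V) where

    f : Vertex → Vertex
    f x = if V x then r else x

    f-in : ∀ {x} → x ∈ V → f x ≡ r
    f-in (mem p) rewrite p = refl

    f-out : ∀ {x} → x ∉ V → f x ≡ x
    f-out {x} p rewrite ∉⇒false {x} {V} p = refl

    f-fix : ∀ {x} → f x ∉ V → x ∉ V
    f-fix p q = p (subst (_∈ V) (≡-sym (f-in q)) r∈V)

    Step = Arc (arcs f H)
    Out : Sub → Sub
    Out A = (A ∩ H) ∖ V

    front : ∀ {A x y} → Walk Step A x y → x ∈ H → x ∉ V →
            Path (Out A) x y ⊎ ∃[ u ] ∃[ v ] (Path (Out A) x u × u ~ v × v ∈ V × r ∈ A)
    front (nil p) x∈ x∉ = inj₁ (nil (∖⁺ (∩⁺ p x∈) x∉))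
    front {A} (cons p e w) x∈ x∉ with arc⁻ e
    ... | u , v , u∈ , v∈ , e′ , refl , refl = go (v ∈? V)
      where
      x∈Out = ∖⁺ (∩⁺ p x∈) x∉
      step-out : f u ~ v
      step-out = subst (_~ v) (≡-sym (f-out (f-fix x∉))) e′
      go : Dec (v ∈ V) → _
      go (yes v∈V) = inj₂ (_ , v , nil x∈Out , step-out , v∈V , subst (_∈ A) (f-in v∈V) (start∈ w))
      go (no v∉V) with front w (subst (_∈ H) (≡-sym (f-out v∉V)) v∈) (λ q → v∉V (subst (_∈ V) (f-out v∉V) q))
      ... | inj₁ w′ = inj₁ (cons x∈Out (subst (f u ~_) (≡-sym (f-out v∉V)) step-out) w′)
      ... | inj₂ (u′ , v′ , w′ , rest) =
        inj₂ (u′ , v′ , cons x∈Out (subst (f u ~_) (≡-sym (f-out v∉V)) step-out) w′ , rest)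

    back : ∀ {A x y} → Walk Step A x y → y ∈ H → y ∉ V →
           (x ∈ H × x ∉ V × Path (Out A) x y) ⊎ ∃[ v ] ∃[ u ] (v ∈ V × v ~ u × Path (Out A) u y)
    back (nil p) y∈ y∉ = inj₁ (y∈ , y∉ , nil (∖⁺ (∩⁺ p y∈) y∉))
    back {A} {y = y} (cons p e w) y∈ y∉ with back w y∈ y∉ | arc⁻ e
    ... | inj₂ o | _ = inj₂ o
    ... | inj₁ (q∈ , q∉ , w′) | u , v , u∈ , v∈ , e′ , refl , refl = go (u ∈? V)
      where
      e″ : u ~ f v
      e″ = subst (u ~_) (≡-sym (f-out (f-fix q∉))) e′
      go : Dec (u ∈ V) → _
      go (yes u∈V) = inj₂ (u , _ , u∈V , e″ , w′)
      go (no u∉V) = inj₁ (fu∈ , fu∉ , cons (∖⁺ (∩⁺ p fu∈) fu∉) (subst (_~ f v) (≡-sym (f-out u∉V)) e″) w′)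
        where
        fu∈ = subst (_∈ H) (≡-sym (f-out u∉V)) u∈
        fu∉ : f u ∉ V
        fu∉ q = u∉V (subst (_∈ V) (f-out u∉V) q)

    Through : Sub → Vertex → Vertex → Set
    Through A x y = ∃[ u₁ ] ∃[ v₁ ] ∃[ v₂ ] ∃[ u₂ ]
      (r ∈ A × Path (Out A) x u₁ × u₁ ~ v₁ × v₁ ∈ V × v₂ ∈ V × v₂ ~ u₂ × Path (Out A) u₂ y)

    -- A walk in the contracted graph may pass `r` repeatedly. Only the part before the first
    -- arrival at `V` and the part after the last departure are kept; the gap is to be closed inside
    -- `V`.
    expand : ∀ {A x y} → Walk Step A x y → x ∈ H → x ∉ V → y ∈ H → y ∉ V → Path (Out A) x y ⊎ Through A x y
    expand w x∈ x∉ y∈ y∉ with back w y∈ y∉ | front w x∈ x∉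
    ... | inj₁ (_ , _ , w′) | _ = inj₁ w′
    ... | inj₂ _ | inj₁ w′ = inj₁ w′
    ... | inj₂ (v₂ , u₂ , v₂∈ , e₂ , w₂) | inj₂ (u₁ , v₁ , w₁ , e₁ , v₁∈ , r∈A) =
      inj₂ (u₁ , v₁ , v₂ , u₂ , r∈A , w₁ , e₁ , v₁∈ , v₂∈ , e₂ , w₂)

  -- A path from {a,b} to Y that spares a subtree Z shows that Z does not separate, so Menger's theorem applies after contracting
  -- Z to a vertex; at most one of the two routes uses that vertex, and it can be led through Z by a shortcut.
  route : ∀ {g H Y R U a b} → Tree (4 + g) R U → U ⊆ H → a ∈ H → b ∈ H → Y ⊆ H → a ∉ U → b ∉ U → Disj U Y →
          (∀ v → ∃[ x ] ∃[ y ] (x ∈ ⁅ a ⁆ ∪ ⁅ b ⁆ × y ∈ Y × Path (H ∖ ⁅ v ⁆) x y)) → Routes g H Y U a b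
  route {g} {H} {Y} {R} {U} {a} {b} t U⊆H a∈ b∈ Y⊆H a∉ b∉ U#Y access with access a
  ... | x₀ , y₀ , x₀∈ , y₀∈ , w₀ = go (menger r (arcs f H) (⁅ a ⁆ ∪ ⁅ b ⁆) Y)
    where
    ends∉U : ∀ {x} → x ∈ ⁅ a ⁆ ∪ ⁅ b ⁆ → x ∉ U
    ends∉U p q = [ (λ s → a∉ (subst (_∈ U) (⁅⁆⁻ s) q)) , (λ s → b∉ (subst (_∈ U) (⁅⁆⁻ s) q)) ]′ (∪⁻ p)
    open Detour (detour t U⊆H (ends∉U x₀∈) (λ p → U#Y p y₀∈) (mapW ∖ˡ w₀))
    r = hub (tree-conn tree)
    r∈Z : r ∈ Z
    r∈Z = hub∈ (tree-conn tree)
    open Contract H Z r r∈Z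
    f-end : ∀ {x} → x ∈ ⁅ a ⁆ ∪ ⁅ b ⁆ → f x ∈ ⁅ a ⁆ ∪ ⁅ b ⁆
    f-end p = subst (_∈ ⁅ a ⁆ ∪ ⁅ b ⁆) (≡-sym (f-out (λ q → ends∉U p (Z⊆ q)))) p
    f-Y : ∀ {y} → y ∈ Y → f y ∈ Y
    f-Y p = subst (_∈ Y) (≡-sym (f-out (λ q → U#Y (Z⊆ q) p))) p
    no-sep : Separation (arcs f H) (⁅ a ⁆ ∪ ⁅ b ⁆) Y → ⊥
    no-sep σ with Separation.cut σ ≟ r
    ... | yes c≡r = separated σ ∖ˡ (λ p q → ∖ʳ p (subst (_∈ Z) (trans (≡-sym (trans q c≡r)) (f-out (∖ʳ p))) r∈Z))
                              path (f-end x₀∈) (f-Y y₀∈)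
    -- A path avoiding this cut still avoids it after the contraction, because `Z` is sent to `r`
    -- and every other vertex is fixed.
    ... | no c≢r with access (Separation.cut σ)
    ...   | x , y , x∈ , y∈ , w = separated σ ∖ˡ avoid w (f-end x∈) (f-Y y∈)
      where
      avoid : ∀ {z} → z ∈ H ∖ ⁅ Separation.cut σ ⁆ → f z ≢ Separation.cut σ
      avoid {z} p q with z ∈? Z
      ... | yes z∈ = c≢r (trans (≡-sym q) (f-in z∈))
      ... | no z∉  = ∖ʳ p (subst (_∈ ⁅ Separation.cut σ ⁆) (trans (≡-sym q) (f-out z∉)) ⁅⁆⁺)
    Out⊆H : ∀ A → Out A ⊆ H
    Out⊆H A p = proj₂ (∩⁻ (∖ˡ p))
    Out# : ∀ {A B} → Disj A B → Disj (Out A) (Out B)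
    Out# d p q = d (proj₁ (∩⁻ (∖ˡ p))) (proj₁ (∩⁻ (∖ˡ q)))
    through : ∀ {A B a b c d} → Disj A B → c ∈ Y → d ∈ Y → Through A a c → Path (Out B) b d → Routes g H Y U a b
    through {A} {B} A#B c∈ d∈ (u₁ , v₁ , v₂ , u₂ , _ , w₁ , e₁ , v₁∈ , v₂∈ , e₂ , w₂) w = record
      { P = Out A ∪ (Z ∖ S.Z) ; Q = Out B
      ; P#Q = disj-∪ (Out# A#B) (λ p q → ∖ʳ q (∖ˡ p))
      ; P⊆ = ∪⊆ (Out⊆H A) (λ p → U⊆H (Z⊆ (∖ˡ p))) ; Q⊆ = Out⊆H B ; y₁∈ = c∈ ; y₂∈ = d∈
      ; path₁ = mapW ∪ˡ w₁ ++W cons (∪ˡ (end∈ w₁)) e₁ (mapW ∪ʳ S.path ++W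
                cons (∪ʳ (end∈ S.path)) e₂ (mapW ∪ˡ w₂))
      ; path₂ = w ; tree = S.tree ; Z⊆ = λ p → Z⊆ (S.Z⊆ p)
      ; Z#P = disj-∪ʳ (λ p q → ∖ʳ q (S.Z⊆ p)) (λ p q → ∖ʳ q p) ; Z#Q = λ p q → ∖ʳ q (S.Z⊆ p) }
      where module S = Shortcut (shortcut tree v₁∈ v₂∈)
    build : ∀ {A B c d} → Disj A B → c ∈ Y → d ∈ Y → Path (Out A) a c ⊎ Through A a c →
            Path (Out B) b d ⊎ Through B b d → Routes g H Y U a b
    build A#B c∈ d∈ (inj₂ θ) (inj₁ w) = through A#B c∈ d∈ θ w
    build A#B c∈ d∈ (inj₁ w) (inj₂ θ) = flip-routes (through (disj-sym A#B) d∈ c∈ θ w)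
    build A#B c∈ d∈ (inj₂ (_ , _ , _ , _ , p , _)) (inj₂ (_ , _ , _ , _ , q , _)) = ⊥-elim (A#B p q)
    build {A} {B} A#B c∈ d∈ (inj₁ w) (inj₁ w′) with descend 2 tree
    ... | _ , _ , t′ , V′⊆ = record
      { P#Q = Out# A#B ; P⊆ = Out⊆H A ; Q⊆ = Out⊆H B ; y₁∈ = c∈ ; y₂∈ = d∈ ; path₁ = w ; path₂ = w′
      ; tree = t′ ; Z⊆ = λ p → Z⊆ (V′⊆ p) ; Z#P = λ p q → ∖ʳ q (V′⊆ p) ; Z#Q = λ p q → ∖ʳ q (V′⊆ p) }
    go : Separation (arcs f H) (⁅ a ⁆ ∪ ⁅ b ⁆) Y ⊎ Linkage Step (⁅ a ⁆ ∪ ⁅ b ⁆) Y → Routes g H Y U a b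
    go (inj₁ σ) = ⊥-elim (no-sep σ)
    go (inj₂ L) with link-from L
    ... | A , B , c , d , A#B , c∈ , d∈ , wA , wB =
      build A#B c∈ d∈ (expand wA a∈ (λ p → a∉ (Z⊆ p)) (Y⊆H c∈) (λ p → U#Y (Z⊆ p) c∈))
                      (expand wB b∈ (λ p → b∉ (Z⊆ p)) (Y⊆H d∈) (λ p → U#Y (Z⊆ p) d∈))

  -- Series and parallel composition

  -- With X and Y as the ends of the root edge, this is a model of ∇ of level p, except for the root edge itself.
  data Nabla : ℕ → Sub → Sub → Sub → Set where
    base : ∀ {X Y W} → Conn W → Touch W X → Touch W Y → Nabla 0 X Y W
    glue : ∀ {p X Y M W₁ W₂} → Conn M → Nabla p X M W₁ → Nabla p M Y W₂ → Touch M X → Touch M Y →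
           Disj M W₁ → Disj M W₂ → Disj W₁ W₂ → Nabla (suc p) X Y (M ∪ W₁ ∪ W₂)

  nabla-mono : ∀ {p X X′ Y Y′ W} → X ⊆ X′ → Y ⊆ Y′ → Nabla p X Y W → Nabla p X′ Y′ W
  nabla-mono f g (base c s t) = base c (touch-mono (λ p → p) f s) (touch-mono (λ p → p) g t)
  nabla-mono f g (glue c l r s t d₁ d₂ d) =
    glue c (nabla-mono f (λ p → p) l) (nabla-mono (λ p → p) g r)
      (touch-mono (λ p → p) f s) (touch-mono (λ p → p) g t) d₁ d₂ d

  record NablaAt (p : ℕ) (a b : Vertex) (H : Sub) : Set where
    field
      {X Y W} : Sub
      a∈      : a ∈ X
      b∈      : b ∈ Y
      X-conn  : Conn X
      Y-conn  : Conn Y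
      touch   : Touch X Y
      nabla   : Nabla p X Y W
      X#Y     : Disj X Y
      X#W     : Disj X W
      Y#W     : Disj Y W
      X⊆      : X ⊆ H
      Y⊆      : Y ⊆ H
      W⊆      : W ⊆ H

  record CrownAt (q : ℕ) (a b : Vertex) (H : Sub) : Set where
    field
      {R T Y} : Sub
      a∈     : a ∈ R
      b∈     : b ∈ Y
      Y-conn : Conn Y
      tree   : Tree⁺ Y q R T
      T#Y    : Disj T Y
      T⊆     : T ⊆ H
      Y⊆     : Y ⊆ H

    a∈T : a ∈ T
    a∈T = tree⁺-root⊆ tree a∈

  Outcome : ℕ → ℕ → Vertex → Vertex → Sub → Set
  Outcome p q a b H = NablaAt p a b H ⊎ CrownAt q a b H

  Only : Sub → Sub → Vertex → Set
  Only C B h = ∀ {x} → x ∈ C → x ∈ B → x ≡ h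

  only-disj : ∀ {C B X Y h} → Only C B h → h ∈ X → Disj X Y → Y ⊆ B → Disj C Y
  only-disj {X = X} only h∈ X#Y Y⊆ p q = X#Y (subst (_∈ X) (≡-sym (only p (Y⊆ q))) h∈) q

  -- The cyclic sequence C₀, B₁, C₁, B₂, C₂, with a ∈ C₀ and b ∈ C₂.
  record Chain (H : Sub) (a b : Vertex) (B₁ B₂ : Sub) (h₁ h₁′ h₂ h₂′ : Vertex) : Set where
    field
      {C₀ C₁ C₂} : Sub
      conn₀  : Conn C₀
      conn₁  : Conn C₁
      conn₂  : Conn C₂
      a∈     : a ∈ C₀
      b∈     : b ∈ C₂
      h₁∈    : h₁ ∈ C₀
      h₁′∈   : h₁′ ∈ C₁
      h₂∈    : h₂ ∈ C₁
      h₂′∈   : h₂′ ∈ C₂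
      only₁  : Only C₀ B₁ h₁
      only₁′ : Only C₁ B₁ h₁′
      only₂  : Only C₁ B₂ h₂
      only₂′ : Only C₂ B₂ h₂′
      C₀#C₁  : Disj C₀ C₁
      C₀#C₂  : Disj C₀ C₂
      C₁#C₂  : Disj C₁ C₂
      C₀#B₂  : Disj C₀ B₂
      C₂#B₁  : Disj C₂ B₁
      B₁#B₂  : Disj B₁ B₂
      touch  : Touch C₀ C₂
      C₀⊆    : C₀ ⊆ H
      C₁⊆    : C₁ ⊆ H
      C₂⊆    : C₂ ⊆ H
      B₁⊆    : B₁ ⊆ H
      B₂⊆    : B₂ ⊆ H
      h₁∈B   : h₁ ∈ B₁
      h₁′∈B  : h₁′ ∈ B₁
      h₂∈B   : h₂ ∈ B₂
      h₂′∈B  : h₂′ ∈ B₂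
      B₁-conn : Conn B₁
      B₂-conn : Conn B₂

  module _ {H a b B₁ B₂ h₁ h₁′ h₂ h₂′} (χ : Chain H a b B₁ B₂ h₁ h₁′ h₂ h₂′) where
    open Chain χ

    series-crown₁ : ∀ {q} → CrownAt q h₁ h₁′ B₁ → CrownAt q a b H
    series-crown₁ κ = record
      { a∈ = ∪ʳ a∈ ; b∈ = ∪ʳ (∪ʳ (∪ʳ b∈))
      ; Y-conn = conn-∪-meet κ.Y-conn (conn-∪-meet conn₁ (conn-∪-meet B₂-conn conn₂ h₂′∈B h₂′∈) h₂∈ (∪ˡ h₂∈B)) κ.b∈ (∪ˡ h₁′∈)
      ; tree = tree⁺-mono ∪ˡ E.tree
      ; T#Y = λ p q → apart (E.bound p) q
      ; T⊆ = λ p → ∪⊆ (λ q → B₁⊆ (κ.T⊆ q)) C₀⊆ (E.bound p)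
      ; Y⊆ = ∪⊆ (λ q → B₁⊆ (κ.Y⊆ q)) (∪⊆ C₁⊆ (∪⊆ B₂⊆ C₂⊆)) }
      where
      module κ = CrownAt κ
      module E = Extended (extend κ.tree κ.a∈ conn₀ h₁∈ (λ p q → only₁ p (κ.T⊆ q)))
      apart : Disj (κ.T ∪ C₀) (κ.Y ∪ C₁ ∪ B₂ ∪ C₂)
      apart = disj-∪
        (disj-∪ʳ κ.T#Y (disj-∪ʳ (disj-sym (only-disj only₁′ κ.b∈ (disj-sym κ.T#Y) κ.T⊆))
          (disj-∪ʳ (λ p → B₁#B₂ (κ.T⊆ p)) (λ p q → C₂#B₁ q (κ.T⊆ p)))))
        (disj-∪ʳ (only-disj only₁ κ.a∈T κ.T#Y κ.Y⊆) (disj-∪ʳ C₀#C₁ (disj-∪ʳ C₀#B₂ C₀#C₂)))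

    series-crown₂ : ∀ {q} → CrownAt q h₂ h₂′ B₂ → CrownAt q a b H
    series-crown₂ κ = record
      { a∈ = ∪ʳ (∪ˡ a∈) ; b∈ = ∪ʳ b∈ ; Y-conn = conn-∪-meet κ.Y-conn conn₂ κ.b∈ h₂′∈
      ; tree = tree⁺-mono ∪ˡ E.tree
      ; T#Y = λ p q → apart (E.bound p) q
      ; T⊆ = λ p → ∪⊆ (λ q → B₂⊆ (κ.T⊆ q)) (∪⊆ C₀⊆ (∪⊆ B₁⊆ C₁⊆)) (E.bound p)
      ; Y⊆ = ∪⊆ (λ q → B₂⊆ (κ.Y⊆ q)) C₂⊆ }
      where
      module κ = CrownAt κ
      C = C₀ ∪ B₁ ∪ C₁
      only : Only C B₂ h₂
      only p q with ∪⁻ p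
      ... | inj₁ r = ⊥-elim (C₀#B₂ r q)
      ... | inj₂ r with ∪⁻ r
      ...   | inj₁ s = ⊥-elim (B₁#B₂ s q)
      ...   | inj₂ s = only₂ s q
      module E = Extended (extend κ.tree κ.a∈
        (conn-∪-meet conn₀ (conn-∪-meet B₁-conn conn₁ h₁′∈B h₁′∈) h₁∈ (∪ˡ h₁∈B)) (∪ʳ (∪ʳ h₂∈)) (λ p q → only p (κ.T⊆ q)))
      apart : Disj (κ.T ∪ C) (κ.Y ∪ C₂)
      apart = disj-∪
        (disj-∪ʳ κ.T#Y (disj-sym (only-disj only₂′ κ.b∈ (disj-sym κ.T#Y) κ.T⊆)))
        (disj-∪ʳ (only-disj only κ.a∈T κ.T#Y κ.Y⊆) (disj-∪ C₀#C₂ (disj-∪ (disj-sym C₂#B₁) C₁#C₂)))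

    -- The facing ends of the two models, joined by `C₁`, form the vertex in which the root edges
    -- are glued; the contact between `C₀` and `C₂` is the new root edge.
    series-nabla : ∀ {p} → NablaAt p h₁ h₁′ B₁ → NablaAt p h₂ h₂′ B₂ → NablaAt (suc p) a b H
    series-nabla ν₁ ν₂ = record
      { X = N₁.X ∪ C₀ ; Y = N₂.Y ∪ C₂
      ; a∈ = ∪ʳ a∈ ; b∈ = ∪ʳ b∈
      ; X-conn = conn-∪-meet N₁.X-conn conn₀ N₁.a∈ h₁∈
      ; Y-conn = conn-∪-meet N₂.Y-conn conn₂ N₂.b∈ h₂′∈
      ; touch = touch-mono ∪ʳ ∪ʳ touch
      ; nabla = glue {M = M} {N₁.W} {N₂.W}
          (conn-∪-meet N₁.Y-conn (conn-∪-meet conn₁ N₂.X-conn h₂∈ N₂.a∈) N₁.b∈ (∪ˡ h₁′∈))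
          (nabla-mono ∪ˡ ∪ˡ N₁.nabla) (nabla-mono (λ p → ∪ʳ (∪ʳ p)) ∪ˡ N₂.nabla)
          (touch-mono ∪ˡ ∪ˡ (touch-sym N₁.touch)) (touch-mono (λ p → ∪ʳ (∪ʳ p)) ∪ˡ N₂.touch)
          (disj-∪ N₁.Y#W (disj-∪ (only-disj only₁′ N₁.b∈ N₁.Y#W N₁.W⊆) (λ p q → B₁#B₂ (N₁.W⊆ q) (N₂.X⊆ p))))
          (disj-∪ (λ p q → B₁#B₂ (N₁.Y⊆ p) (N₂.W⊆ q)) (disj-∪ (only-disj only₂ N₂.a∈ N₂.X#W N₂.W⊆) N₂.X#W))
          (λ p q → B₁#B₂ (N₁.W⊆ p) (N₂.W⊆ q))
      ; X#Y = disj-∪ (disj-∪ʳ (λ p q → B₁#B₂ (N₁.X⊆ p) (N₂.Y⊆ q)) (λ p q → C₂#B₁ q (N₁.X⊆ p)))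
                     (disj-∪ʳ (λ p q → C₀#B₂ p (N₂.Y⊆ q)) C₀#C₂)
      ; X#W = disj-∪
          (disj-∪ʳ (disj-∪ʳ N₁.X#Y (disj-∪ʳ (disj-sym (only-disj only₁′ N₁.b∈ (disj-sym N₁.X#Y) N₁.X⊆))
                                            (λ p q → B₁#B₂ (N₁.X⊆ p) (N₂.X⊆ q))))
                   (disj-∪ʳ N₁.X#W (λ p q → B₁#B₂ (N₁.X⊆ p) (N₂.W⊆ q))))
          (disj-∪ʳ (disj-∪ʳ (only-disj only₁ N₁.a∈ N₁.X#Y N₁.Y⊆) (disj-∪ʳ C₀#C₁ (λ p q → C₀#B₂ p (N₂.X⊆ q))))
                   (disj-∪ʳ (only-disj only₁ N₁.a∈ N₁.X#W N₁.W⊆) (λ p q → C₀#B₂ p (N₂.W⊆ q))))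
      ; Y#W = disj-∪
          (disj-∪ʳ (disj-∪ʳ (λ p q → B₁#B₂ (N₁.Y⊆ q) (N₂.Y⊆ p))
                            (disj-∪ʳ (disj-sym (only-disj only₂ N₂.a∈ N₂.X#Y N₂.Y⊆)) (disj-sym N₂.X#Y)))
                   (disj-∪ʳ (λ p q → B₁#B₂ (N₁.W⊆ q) (N₂.Y⊆ p)) N₂.Y#W))
          (disj-∪ʳ (disj-∪ʳ (λ p q → C₂#B₁ p (N₁.Y⊆ q))
                            (disj-∪ʳ (disj-sym C₁#C₂) (only-disj only₂′ N₂.b∈ (disj-sym N₂.X#Y) N₂.X⊆)))
                   (disj-∪ʳ (λ p q → C₂#B₁ p (N₁.W⊆ q)) (only-disj only₂′ N₂.b∈ N₂.Y#W N₂.W⊆)))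
      ; X⊆ = ∪⊆ (λ p → B₁⊆ (N₁.X⊆ p)) C₀⊆
      ; Y⊆ = ∪⊆ (λ p → B₂⊆ (N₂.Y⊆ p)) C₂⊆
      ; W⊆ = ∪⊆ (∪⊆ (λ p → B₁⊆ (N₁.Y⊆ p)) (∪⊆ C₁⊆ (λ p → B₂⊆ (N₂.X⊆ p))))
                (∪⊆ (λ p → B₁⊆ (N₁.W⊆ p)) (λ p → B₂⊆ (N₂.W⊆ p))) }
      where
      module N₁ = NablaAt ν₁
      module N₂ = NablaAt ν₂
      M = N₁.Y ∪ C₁ ∪ N₂.X

    series : ∀ {p q} → Outcome p q h₁ h₁′ B₁ → Outcome p q h₂ h₂′ B₂ → Outcome (suc p) q a b H
    series (inj₂ κ) _ = inj₂ (series-crown₁ κ)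
    series (inj₁ _) (inj₂ κ) = inj₂ (series-crown₂ κ)
    series (inj₁ ν₁) (inj₁ ν₂) = inj₁ (series-nabla ν₁ ν₂)

  -- Both pieces lie between R and C, with a ∈ R and b ∈ C; the links L₁ and L₂ are kept apart from R because R
  -- has to become the root of a tree.
  record Theta (H : Sub) (a b : Vertex) (B₁ B₂ : Sub) (h₁ h₁′ h₂ h₂′ : Vertex) : Set where
    field
      {R L₁ L₂ C} : Sub
      R-conn  : Conn R
      L₁-conn : Conn L₁
      L₂-conn : Conn L₂
      C-conn  : Conn C
      a∈      : a ∈ R
      b∈      : b ∈ C
      R~L₁    : Touch R L₁
      R~L₂    : Touch R L₂
      h₁∈     : h₁ ∈ L₁
      h₂∈     : h₂ ∈ L₂
      h₁′∈    : h₁′ ∈ C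
      h₂′∈    : h₂′ ∈ C
      h₁∈B    : h₁ ∈ B₁
      h₁′∈B   : h₁′ ∈ B₁
      h₂∈B    : h₂ ∈ B₂
      h₂′∈B   : h₂′ ∈ B₂
      only₁   : Only L₁ B₁ h₁
      only₂   : Only L₂ B₂ h₂
      only₁′  : Only C B₁ h₁′
      only₂′  : Only C B₂ h₂′
      R#B₁    : Disj R B₁
      R#B₂    : Disj R B₂
      L₁#B₂   : Disj L₁ B₂
      L₂#B₁   : Disj L₂ B₁
      R#L₁    : Disj R L₁
      R#L₂    : Disj R L₂
      L₁#L₂   : Disj L₁ L₂
      R#C     : Disj R C
      L₁#C    : Disj L₁ C
      L₂#C    : Disj L₂ C
      B₁#B₂   : Disj B₁ B₂
      R⊆      : R ⊆ H
      L₁⊆     : L₁ ⊆ H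
      L₂⊆     : L₂ ⊆ H
      C⊆      : C ⊆ H
      B₁⊆     : B₁ ⊆ H
      B₂⊆     : B₂ ⊆ H

  module _ {H a b B₁ B₂ h₁ h₁′ h₂ h₂′} (θ : Theta H a b B₁ B₂ h₁ h₁′ h₂ h₂′) where
    open Theta θ

    parallel-nabla : ∀ {p} → NablaAt p h₁ h₁′ B₁ → NablaAt p a b H
    parallel-nabla ν = record
      { X = N.X ∪ L₁ ∪ R ; Y = N.Y ∪ C ; W = N.W
      ; a∈ = ∪ʳ (∪ʳ a∈) ; b∈ = ∪ʳ b∈
      ; X-conn = conn-∪-meet N.X-conn (conn-∪-touch L₁-conn R-conn (touch-sym R~L₁)) N.a∈ (∪ˡ h₁∈)
      ; Y-conn = conn-∪-meet N.Y-conn C-conn N.b∈ h₁′∈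
      ; touch = touch-mono ∪ˡ ∪ˡ N.touch ; nabla = nabla-mono ∪ˡ ∪ˡ N.nabla
      ; X#Y = disj-∪ (disj-∪ʳ N.X#Y (disj-sym (only-disj only₁′ N.b∈ (disj-sym N.X#Y) N.X⊆)))
                (disj-∪ (disj-∪ʳ (only-disj only₁ N.a∈ N.X#Y N.Y⊆) L₁#C) (disj-∪ʳ (λ p q → R#B₁ p (N.Y⊆ q)) R#C))
      ; X#W = disj-∪ N.X#W (disj-∪ (only-disj only₁ N.a∈ N.X#W N.W⊆) (λ p q → R#B₁ p (N.W⊆ q)))
      ; Y#W = disj-∪ N.Y#W (only-disj only₁′ N.b∈ N.Y#W N.W⊆)
      ; X⊆ = ∪⊆ (λ p → B₁⊆ (N.X⊆ p)) (∪⊆ L₁⊆ R⊆) ; Y⊆ = ∪⊆ (λ p → B₁⊆ (N.Y⊆ p)) C⊆ ; W⊆ = λ p → B₁⊆ (N.W⊆ p) }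
      where module N = NablaAt ν

    -- `L₁` and `L₂` lengthen the roots of the two crowns until they touch the new root `R`, and `C`
    -- merges the two apexes into one.
    parallel-crown : ∀ {q} → CrownAt q h₁ h₁′ B₁ → CrownAt q h₂ h₂′ B₂ → CrownAt (suc q) a b H
    parallel-crown κ₁ κ₂ = record
      { T = R ∪ E₁.set ∪ E₂.set ; Y = K₁.Y ∪ C ∪ K₂.Y
      ; a∈ = a∈ ; b∈ = ∪ʳ (∪ˡ b∈)
      ; Y-conn = conn-∪-meet K₁.Y-conn (conn-∪-meet C-conn K₂.Y-conn h₂′∈ K₂.b∈) K₁.b∈ (∪ˡ h₁′∈)
      ; tree = node R-conn (tree⁺-mono ∪ˡ E₁.tree) (tree⁺-mono (λ p → ∪ʳ (∪ʳ p)) E₂.tree)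
          (touch-mono (λ p → p) ∪ʳ R~L₁) (touch-mono (λ p → p) ∪ʳ R~L₂)
          (λ p q → disj-∪ʳ (λ r s → R#B₁ r (K₁.T⊆ s)) R#L₁ p (E₁.bound q))
          (λ p q → disj-∪ʳ (λ r s → R#B₂ r (K₂.T⊆ s)) R#L₂ p (E₂.bound q))
          (λ p q → sets#sets (E₁.bound p) (E₂.bound q))
      ; T#Y = disj-∪
          (disj-∪ʳ (λ p q → R#B₁ p (K₁.Y⊆ q)) (disj-∪ʳ R#C (λ p q → R#B₂ p (K₂.Y⊆ q))))
          (disj-∪ (λ p → set₁#Y (E₁.bound p)) (λ p → set₂#Y (E₂.bound p)))
      ; T⊆ = ∪⊆ R⊆ (∪⊆ (λ p → ∪⊆ (λ q → B₁⊆ (K₁.T⊆ q)) L₁⊆ (E₁.bound p)) (λ p → ∪⊆ (λ q → B₂⊆ (K₂.T⊆ q)) L₂⊆ (E₂.bound p)))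
      ; Y⊆ = ∪⊆ (λ p → B₁⊆ (K₁.Y⊆ p)) (∪⊆ C⊆ (λ p → B₂⊆ (K₂.Y⊆ p))) }
      where
      module K₁ = CrownAt κ₁
      module K₂ = CrownAt κ₂
      module E₁ = Extended (extend K₁.tree K₁.a∈ L₁-conn h₁∈ (λ p q → only₁ p (K₁.T⊆ q)))
      module E₂ = Extended (extend K₂.tree K₂.a∈ L₂-conn h₂∈ (λ p q → only₂ p (K₂.T⊆ q)))
      sets#sets : Disj (K₁.T ∪ L₁) (K₂.T ∪ L₂)
      sets#sets = disj-∪ (disj-∪ʳ (λ p q → B₁#B₂ (K₁.T⊆ p) (K₂.T⊆ q)) (λ p q → L₂#B₁ q (K₁.T⊆ p)))
                         (disj-∪ʳ (λ p q → L₁#B₂ p (K₂.T⊆ q)) L₁#L₂)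
      set₁#Y : Disj (K₁.T ∪ L₁) (K₁.Y ∪ C ∪ K₂.Y)
      set₁#Y = disj-∪
        (disj-∪ʳ K₁.T#Y (disj-∪ʳ (disj-sym (only-disj only₁′ K₁.b∈ (disj-sym K₁.T#Y) K₁.T⊆))
                                 (λ p q → B₁#B₂ (K₁.T⊆ p) (K₂.Y⊆ q))))
        (disj-∪ʳ (only-disj only₁ K₁.a∈T K₁.T#Y K₁.Y⊆) (disj-∪ʳ L₁#C (λ p q → L₁#B₂ p (K₂.Y⊆ q))))
      set₂#Y : Disj (K₂.T ∪ L₂) (K₁.Y ∪ C ∪ K₂.Y)
      set₂#Y = disj-∪
        (disj-∪ʳ (λ p q → B₁#B₂ (K₁.Y⊆ q) (K₂.T⊆ p))
                 (disj-∪ʳ (disj-sym (only-disj only₂′ K₂.b∈ (disj-sym K₂.T#Y) K₂.T⊆)) K₂.T#Y))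
        (disj-∪ʳ (λ p q → L₂#B₁ p (K₁.Y⊆ q)) (disj-∪ʳ L₂#C (only-disj only₂ K₂.a∈T K₂.T#Y K₂.Y⊆)))

  flip-theta : ∀ {H a b B₁ B₂ h₁ h₁′ h₂ h₂′} → Theta H a b B₁ B₂ h₁ h₁′ h₂ h₂′ → Theta H a b B₂ B₁ h₂ h₂′ h₁ h₁′
  flip-theta θ = record
    { R-conn = R-conn ; L₁-conn = L₂-conn ; L₂-conn = L₁-conn ; C-conn = C-conn ; a∈ = a∈ ; b∈ = b∈
    ; R~L₁ = R~L₂ ; R~L₂ = R~L₁ ; h₁∈ = h₂∈ ; h₂∈ = h₁∈ ; h₁′∈ = h₂′∈ ; h₂′∈ = h₁′∈
    ; h₁∈B = h₂∈B ; h₁′∈B = h₂′∈B ; h₂∈B = h₁∈B ; h₂′∈B = h₁′∈B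
    ; only₁ = only₂ ; only₂ = only₁ ; only₁′ = only₂′ ; only₂′ = only₁′ ; R#B₁ = R#B₂ ; R#B₂ = R#B₁
    ; L₁#B₂ = L₂#B₁ ; L₂#B₁ = L₁#B₂ ; R#L₁ = R#L₂ ; R#L₂ = R#L₁ ; L₁#L₂ = disj-sym L₁#L₂ ; R#C = R#C
    ; L₁#C = L₂#C ; L₂#C = L₁#C ; B₁#B₂ = disj-sym B₁#B₂ ; R⊆ = R⊆ ; L₁⊆ = L₂⊆ ; L₂⊆ = L₁⊆ ; C⊆ = C⊆
    ; B₁⊆ = B₂⊆ ; B₂⊆ = B₁⊆ }
    where open Theta θ

  parallel : ∀ {H a b B₁ B₂ h₁ h₁′ h₂ h₂′ p q} → Theta H a b B₁ B₂ h₁ h₁′ h₂ h₂′ →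
             Outcome p q h₁ h₁′ B₁ → Outcome p q h₂ h₂′ B₂ → Outcome p (suc q) a b H
  parallel θ (inj₁ ν) _ = inj₁ (parallel-nabla θ ν)
  parallel θ (inj₂ _) (inj₁ ν) = inj₁ (parallel-nabla (flip-theta θ) ν)
  parallel θ (inj₂ κ₁) (inj₂ κ₂) = inj₂ (parallel-crown θ κ₁ κ₂)

  -- Two pieces: B₁ hangs by L₁ and L₂ on the far ends of S₁ and S₂, and B₂ hangs by J₁ and J₂ on u₁, u₂ ∈ S₁ ∪ S₂.
  record Config (H : Sub) (a b : Vertex) (B₁ B₂ : Sub) (k₁ k₂ h₁ h₂ u₁ u₂ : Vertex) : Set where
    field
      {X Y S₁ S₂ L₁ L₂ J₁ J₂} : Sub
      {a′ b′ s₁ s₂}           : Vertex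
      X-conn  : Conn X
      Y-conn  : Conn Y
      L₁-conn : Conn L₁
      L₂-conn : Conn L₂
      J₁-conn : Conn J₁
      J₂-conn : Conn J₂
      B₁-conn : Conn B₁
      B₂-conn : Conn B₂
      a∈      : a ∈ X
      b∈      : b ∈ Y
      a′∈     : a′ ∈ X
      b′∈     : b′ ∈ Y
      touch   : Touch X Y
      simple₁ : Simple a′ s₁ S₁
      simple₂ : Simple b′ s₂ S₂
      L₁~     : Touch L₁ ⁅ s₁ ⁆
      L₂~     : Touch L₂ ⁅ s₂ ⁆
      J₁~     : Touch J₁ ⁅ u₁ ⁆
      J₂~     : Touch J₂ ⁅ u₂ ⁆
      u₁≢u₂   : u₁ ≢ u₂
      k₁∈     : k₁ ∈ L₁
      k₂∈     : k₂ ∈ L₂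
      h₁∈     : h₁ ∈ J₁
      h₂∈     : h₂ ∈ J₂
      k₁∈B    : k₁ ∈ B₁
      k₂∈B    : k₂ ∈ B₁
      h₁∈B    : h₁ ∈ B₂
      h₂∈B    : h₂ ∈ B₂
      onlyL₁  : Only L₁ B₁ k₁
      onlyL₂  : Only L₂ B₁ k₂
      onlyJ₁  : Only J₁ B₂ h₁
      onlyJ₂  : Only J₂ B₂ h₂
      onlyX   : Only X S₁ a′
      onlyY   : Only Y S₂ b′
      D₁#D₂   : Disj (X ∪ S₁) (Y ∪ S₂)
      L₁#L₂   : Disj L₁ L₂
      J₁#J₂   : Disj J₁ J₂
      D#L     : Disj ((X ∪ S₁) ∪ (Y ∪ S₂)) (L₁ ∪ L₂)
      D#J     : Disj ((X ∪ S₁) ∪ (Y ∪ S₂)) (J₁ ∪ J₂)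
      D#B₁    : Disj ((X ∪ S₁) ∪ (Y ∪ S₂)) B₁
      D#B₂    : Disj ((X ∪ S₁) ∪ (Y ∪ S₂)) B₂
      L#J     : Disj (L₁ ∪ L₂) (J₁ ∪ J₂)
      L#B₂    : Disj (L₁ ∪ L₂) B₂
      J#B₁    : Disj (J₁ ∪ J₂) B₁
      B₁#B₂   : Disj B₁ B₂
      D⊆      : (X ∪ S₁) ∪ (Y ∪ S₂) ⊆ H
      L⊆      : L₁ ∪ L₂ ⊆ H
      J⊆      : J₁ ∪ J₂ ⊆ H
      B₁⊆     : B₁ ⊆ H
      B₂⊆     : B₂ ⊆ H

  ∪-swap : ∀ {A B} → A ∪ B ⊆ B ∪ A
  ∪-swap = ∪⊆ ∪ʳ ∪ˡ

  flip-ends : ∀ {H a b B₁ B₂ k₁ k₂ h₁ h₂ u₁ u₂} →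
              Config H a b B₁ B₂ k₁ k₂ h₁ h₂ u₁ u₂ → Config H b a B₁ B₂ k₂ k₁ h₁ h₂ u₁ u₂
  flip-ends c = record
    { X-conn = Y-conn ; Y-conn = X-conn ; L₁-conn = L₂-conn ; L₂-conn = L₁-conn ; J₁-conn = J₁-conn ; J₂-conn = J₂-conn
    ; B₁-conn = B₁-conn ; B₂-conn = B₂-conn ; a∈ = b∈ ; b∈ = a∈ ; a′∈ = b′∈ ; b′∈ = a′∈ ; touch = touch-sym touch
    ; simple₁ = simple₂ ; simple₂ = simple₁ ; L₁~ = L₂~ ; L₂~ = L₁~ ; J₁~ = J₁~ ; J₂~ = J₂~ ; u₁≢u₂ = u₁≢u₂
    ; k₁∈ = k₂∈ ; k₂∈ = k₁∈ ; h₁∈ = h₁∈ ; h₂∈ = h₂∈ ; k₁∈B = k₂∈B ; k₂∈B = k₁∈B ; h₁∈B = h₁∈B ; h₂∈B = h₂∈B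
    ; onlyL₁ = onlyL₂ ; onlyL₂ = onlyL₁ ; onlyJ₁ = onlyJ₁ ; onlyJ₂ = onlyJ₂ ; onlyX = onlyY ; onlyY = onlyX
    ; D₁#D₂ = disj-sym D₁#D₂ ; L₁#L₂ = disj-sym L₁#L₂ ; J₁#J₂ = J₁#J₂
    ; D#L = λ p q → D#L (∪-swap p) (∪-swap q) ; D#J = λ p q → D#J (∪-swap p) q
    ; D#B₁ = λ p q → D#B₁ (∪-swap p) q ; D#B₂ = λ p q → D#B₂ (∪-swap p) q
    ; L#J = λ p q → L#J (∪-swap p) q ; L#B₂ = λ p q → L#B₂ (∪-swap p) q ; J#B₁ = J#B₁ ; B₁#B₂ = B₁#B₂
    ; D⊆ = λ p → D⊆ (∪-swap p) ; L⊆ = λ p → L⊆ (∪-swap p) ; J⊆ = J⊆ ; B₁⊆ = B₁⊆ ; B₂⊆ = B₂⊆ }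
    where open Config c

  flip-feet : ∀ {H a b B₁ B₂ k₁ k₂ h₁ h₂ u₁ u₂} →
              Config H a b B₁ B₂ k₁ k₂ h₁ h₂ u₁ u₂ → Config H a b B₁ B₂ k₁ k₂ h₂ h₁ u₂ u₁
  flip-feet c = record
    { X-conn = X-conn ; Y-conn = Y-conn ; L₁-conn = L₁-conn ; L₂-conn = L₂-conn ; J₁-conn = J₂-conn ; J₂-conn = J₁-conn
    ; B₁-conn = B₁-conn ; B₂-conn = B₂-conn ; a∈ = a∈ ; b∈ = b∈ ; a′∈ = a′∈ ; b′∈ = b′∈ ; touch = touch
    ; simple₁ = simple₁ ; simple₂ = simple₂ ; L₁~ = L₁~ ; L₂~ = L₂~ ; J₁~ = J₂~ ; J₂~ = J₁~ ; u₁≢u₂ = λ p → u₁≢u₂ (≡-sym p)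
    ; k₁∈ = k₁∈ ; k₂∈ = k₂∈ ; h₁∈ = h₂∈ ; h₂∈ = h₁∈ ; k₁∈B = k₁∈B ; k₂∈B = k₂∈B ; h₁∈B = h₂∈B ; h₂∈B = h₁∈B
    ; onlyL₁ = onlyL₁ ; onlyL₂ = onlyL₂ ; onlyJ₁ = onlyJ₂ ; onlyJ₂ = onlyJ₁ ; onlyX = onlyX ; onlyY = onlyY
    ; D₁#D₂ = D₁#D₂ ; L₁#L₂ = L₁#L₂ ; J₁#J₂ = disj-sym J₁#J₂
    ; D#L = D#L ; D#J = λ p q → D#J p (∪-swap q) ; D#B₁ = D#B₁ ; D#B₂ = D#B₂
    ; L#J = λ p q → L#J p (∪-swap q) ; L#B₂ = L#B₂ ; J#B₁ = λ p q → J#B₁ (∪-swap p) q ; B₁#B₂ = B₁#B₂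
    ; D⊆ = D⊆ ; L⊆ = L⊆ ; J⊆ = λ p → J⊆ (∪-swap p) ; B₁⊆ = B₁⊆ ; B₂⊆ = B₂⊆ }
    where open Config c

  flip-chain : ∀ {H a b B₁ B₂ h₁ h₁′ h₂ h₂′} → Chain H a b B₁ B₂ h₁ h₁′ h₂ h₂′ → Chain H b a B₂ B₁ h₂′ h₂ h₁′ h₁
  flip-chain c = record
    { conn₀ = conn₂ ; conn₁ = conn₁ ; conn₂ = conn₀ ; a∈ = b∈ ; b∈ = a∈ ; h₁∈ = h₂′∈ ; h₁′∈ = h₂∈ ; h₂∈ = h₁′∈ ; h₂′∈ = h₁∈
    ; only₁ = only₂′ ; only₁′ = only₂ ; only₂ = only₁′ ; only₂′ = only₁
    ; C₀#C₁ = disj-sym C₁#C₂ ; C₀#C₂ = disj-sym C₀#C₂ ; C₁#C₂ = disj-sym C₀#C₁ ; C₀#B₂ = C₂#B₁ ; C₂#B₁ = C₀#B₂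
    ; B₁#B₂ = disj-sym B₁#B₂ ; touch = touch-sym touch ; C₀⊆ = C₂⊆ ; C₁⊆ = C₁⊆ ; C₂⊆ = C₀⊆ ; B₁⊆ = B₂⊆ ; B₂⊆ = B₁⊆
    ; h₁∈B = h₂′∈B ; h₁′∈B = h₂∈B ; h₂∈B = h₁′∈B ; h₂′∈B = h₁∈B ; B₁-conn = B₂-conn ; B₂-conn = B₁-conn }
    where open Chain c

  only-∪ : ∀ {C D B h} → Disj C B → Only D B h → Only (C ∪ D) B h
  only-∪ d o p q = [ (λ r → ⊥-elim (d r q)) , (λ r → o r q) ]′ (∪⁻ p)

  touch-at : ∀ {A B s} → Touch A ⁅ s ⁆ → s ∈ B → Touch A B
  touch-at t s∈ = touch-mono (λ p → p) (⁅⁆⊆ s∈) t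

  module _ {H a b B₁ B₂ k₁ k₂ h₁ h₂ u₁ u₂} (c : Config H a b B₁ B₂ k₁ k₂ h₁ h₂ u₁ u₂) where
    open Config c
    private
      D = (X ∪ S₁) ∪ (Y ∪ S₂)
      D₂-conn : Conn (Y ∪ S₂)
      D₂-conn = conn-∪-meet Y-conn (simple-conn simple₂) b′∈ (simple-start simple₂)

    -- Feet on different strands: the first strand touches both pieces, by `J₁` and by `L₁`, and the
    -- second strand collects the other two links.
    config-theta : u₁ ∈ S₁ → u₂ ∈ S₂ → Theta H a b B₂ B₁ h₁ h₂ k₁ k₂
    config-theta u₁∈ u₂∈ = record
      { R = X ∪ S₁ ; L₁ = J₁ ; L₂ = L₁ ; C = ((Y ∪ S₂) ∪ J₂) ∪ L₂
      ; R-conn = conn-∪-meet X-conn (simple-conn simple₁) a′∈ (simple-start simple₁)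
      ; L₁-conn = J₁-conn ; L₂-conn = L₁-conn
      ; C-conn = conn-∪-touch (conn-∪-touch D₂-conn J₂-conn (touch-sym (touch-at J₂~ (∪ʳ u₂∈)))) L₂-conn
                   (touch-sym (touch-at L₂~ (∪ˡ (∪ʳ (simple-end simple₂)))))
      ; a∈ = ∪ˡ a∈ ; b∈ = ∪ˡ (∪ˡ (∪ˡ b∈))
      ; R~L₁ = touch-sym (touch-at J₁~ (∪ʳ u₁∈)) ; R~L₂ = touch-sym (touch-at L₁~ (∪ʳ (simple-end simple₁)))
      ; h₁∈ = h₁∈ ; h₂∈ = k₁∈ ; h₁′∈ = ∪ˡ (∪ʳ h₂∈) ; h₂′∈ = ∪ʳ k₂∈
      ; h₁∈B = h₁∈B ; h₁′∈B = h₂∈B ; h₂∈B = k₁∈B ; h₂′∈B = k₂∈B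
      ; only₁ = onlyJ₁ ; only₂ = onlyL₁
      ; only₁′ = λ p q → [ (λ r → only-∪ (λ s → D#B₂ (∪ʳ s)) onlyJ₂ r q) , (λ r → ⊥-elim (L#B₂ (∪ʳ r) q)) ]′ (∪⁻ p)
      ; only₂′ = only-∪ (disj-∪ (λ s → D#B₁ (∪ʳ s)) (λ r → J#B₁ (∪ʳ r))) onlyL₂
      ; R#B₁ = λ p → D#B₂ (∪ˡ p) ; R#B₂ = λ p → D#B₁ (∪ˡ p)
      ; L₁#B₂ = λ p → J#B₁ (∪ˡ p) ; L₂#B₁ = λ p → L#B₂ (∪ˡ p)
      ; R#L₁ = λ p q → D#J (∪ˡ p) (∪ˡ q) ; R#L₂ = λ p q → D#L (∪ˡ p) (∪ˡ q) ; L₁#L₂ = λ p q → L#J (∪ˡ q) (∪ˡ p)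
      ; R#C = disj-∪ʳ (disj-∪ʳ D₁#D₂ (λ p q → D#J (∪ˡ p) (∪ʳ q))) (λ p q → D#L (∪ˡ p) (∪ʳ q))
      ; L₁#C = disj-∪ʳ (disj-∪ʳ (λ p q → D#J (∪ʳ q) (∪ˡ p)) J₁#J₂) (λ p q → L#J (∪ʳ q) (∪ˡ p))
      ; L₂#C = disj-∪ʳ (disj-∪ʳ (λ p q → D#L (∪ʳ q) (∪ˡ p)) (λ p q → L#J (∪ˡ p) (∪ʳ q))) L₁#L₂
      ; B₁#B₂ = disj-sym B₁#B₂
      ; R⊆ = λ p → D⊆ (∪ˡ p) ; L₁⊆ = λ p → J⊆ (∪ˡ p) ; L₂⊆ = λ p → L⊆ (∪ˡ p)
      ; C⊆ = ∪⊆ (∪⊆ (λ p → D⊆ (∪ʳ p)) (λ p → J⊆ (∪ʳ p))) (λ p → L⊆ (∪ʳ p))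
      ; B₁⊆ = B₂⊆ ; B₂⊆ = B₁⊆ }

    -- Both feet on the first strand: cutting it between them makes the walk from `a` pass through
    -- `B₂`, come back to the rest of the strand and continue by `L₁` into `B₁`.
    config-chain : (σ : Split a′ s₁ S₁ u₁ u₂) → u₁ ∈ Split.P σ → u₂ ∈ Split.Q σ → Chain H a b B₂ B₁ h₁ h₂ k₁ k₂
    config-chain σ u₁∈ u₂∈ = record
      { C₀ = (X ∪ P) ∪ J₁ ; C₁ = (Q ∪ J₂) ∪ L₁ ; C₂ = (Y ∪ S₂) ∪ L₂
      ; conn₀ = conn-∪-touch (conn-∪-meet X-conn P-conn a′∈ a∈P) J₁-conn (touch-sym (touch-at J₁~ (∪ʳ u₁∈)))
      ; conn₁ = conn-∪-touch (conn-∪-touch Q-conn J₂-conn (touch-sym (touch-at J₂~ u₂∈))) L₁-conn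
                  (touch-sym (touch-at L₁~ (∪ˡ b∈Q)))
      ; conn₂ = conn-∪-touch D₂-conn L₂-conn (touch-sym (touch-at L₂~ (∪ʳ (simple-end simple₂))))
      ; a∈ = ∪ˡ (∪ˡ a∈) ; b∈ = ∪ˡ (∪ˡ b∈) ; h₁∈ = ∪ʳ h₁∈ ; h₁′∈ = ∪ˡ (∪ʳ h₂∈) ; h₂∈ = ∪ʳ k₁∈ ; h₂′∈ = ∪ʳ k₂∈
      ; only₁ = only-∪ (λ p → D#B₂ (XP⊆ p)) onlyJ₁
      ; only₁′ = λ p q → [ (λ r → only-∪ (λ s → D#B₂ (Q⊆D s)) onlyJ₂ r q) , (λ r → ⊥-elim (L#B₂ (∪ˡ r) q)) ]′ (∪⁻ p)
      ; only₂ = only-∪ (disj-∪ (λ s → D#B₁ (Q⊆D s)) (λ r → J#B₁ (∪ʳ r))) onlyL₁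
      ; only₂′ = only-∪ (λ p → D#B₁ (∪ʳ p)) onlyL₂
      ; C₀#C₁ = disj-∪ (disj-∪ʳ (disj-∪ʳ (disj-∪ (only-disj onlyX a∈P P#Q Q⊆) P#Q) (λ p q → D#J (XP⊆ p) (∪ʳ q)))
                                (λ p q → D#L (XP⊆ p) (∪ˡ q)))
                       (disj-∪ʳ (disj-∪ʳ (λ p q → D#J (Q⊆D q) (∪ˡ p)) J₁#J₂) (λ p q → L#J (∪ˡ q) (∪ˡ p)))
      ; C₀#C₂ = disj-∪ (disj-∪ʳ (λ p → D₁#D₂ (XP⊆X p)) (λ p q → D#L (XP⊆ p) (∪ʳ q)))
                       (disj-∪ʳ (λ p q → D#J (∪ʳ q) (∪ˡ p)) (λ p q → L#J (∪ʳ q) (∪ˡ p)))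
      ; C₁#C₂ = disj-∪ (disj-∪ (disj-∪ʳ (λ p → D₁#D₂ (∪ʳ (Q⊆ p))) (λ p q → D#L (Q⊆D p) (∪ʳ q)))
                               (disj-∪ʳ (λ p q → D#J (∪ʳ q) (∪ʳ p)) (λ p q → L#J (∪ʳ q) (∪ʳ p))))
                       (disj-∪ʳ (λ p q → D#L (∪ʳ q) (∪ˡ p)) L₁#L₂)
      ; C₀#B₂ = disj-∪ (λ p → D#B₁ (XP⊆ p)) (λ p → J#B₁ (∪ˡ p))
      ; C₂#B₁ = disj-∪ (λ p → D#B₂ (∪ʳ p)) (λ p → L#B₂ (∪ʳ p))
      ; B₁#B₂ = disj-sym B₁#B₂
      ; touch = touch-mono (λ p → ∪ˡ (∪ˡ p)) (λ p → ∪ˡ (∪ˡ p)) touch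
      ; C₀⊆ = ∪⊆ (λ p → D⊆ (XP⊆ p)) (λ p → J⊆ (∪ˡ p))
      ; C₁⊆ = ∪⊆ (∪⊆ (λ p → D⊆ (Q⊆D p)) (λ p → J⊆ (∪ʳ p))) (λ p → L⊆ (∪ˡ p))
      ; C₂⊆ = ∪⊆ (λ p → D⊆ (∪ʳ p)) (λ p → L⊆ (∪ʳ p))
      ; B₁⊆ = B₂⊆ ; B₂⊆ = B₁⊆ ; h₁∈B = h₁∈B ; h₁′∈B = h₂∈B ; h₂∈B = k₁∈B ; h₂′∈B = k₂∈B
      ; B₁-conn = B₂-conn ; B₂-conn = B₁-conn }
      where
      open Split σ renaming (touch to P~Q)
      XP⊆X : X ∪ P ⊆ X ∪ S₁
      XP⊆X = ∪-mono (λ p → p) P⊆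
      XP⊆ : X ∪ P ⊆ D
      XP⊆ p = ∪ˡ (XP⊆X p)
      Q⊆D : Q ⊆ D
      Q⊆D p = ∪ˡ (∪ʳ (Q⊆ p))

  data Arranged (H : Sub) (a b : Vertex) : Sub → Sub → Set where
    inSeries   : ∀ {B₁ B₂ h₁ h₁′ h₂ h₂′} → Chain H a b B₁ B₂ h₁ h₁′ h₂ h₂′ → Arranged H a b B₁ B₂
    inParallel : ∀ {B₁ B₂ h₁ h₁′ h₂ h₂′} → Theta H a b B₁ B₂ h₁ h₁′ h₂ h₂′ → Arranged H a b B₁ B₂
    swapped    : ∀ {B₁ B₂} → Arranged H a b B₂ B₁ → Arranged H a b B₁ B₂

  flip-split : ∀ {a b S s t} → Split a b S s t → Split a b S t s
  flip-split σ = record { P-conn = P-conn ; Q-conn = Q-conn ; P#Q = P#Q ; P⊆ = P⊆ ; Q⊆ = Q⊆ ; touch = touch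
                        ; a∈P = a∈P ; b∈Q = b∈Q ; sides = [ inj₂ , inj₁ ]′ sides }
    where open Split σ

  same-end : ∀ {H a b B₁ B₂ k₁ k₂ h₁ h₂ u₁ u₂} (c : Config H a b B₁ B₂ k₁ k₂ h₁ h₂ u₁ u₂) →
             u₁ ∈ Config.S₁ c → u₂ ∈ Config.S₁ c → ∃[ h ] ∃[ h′ ] Chain H a b B₂ B₁ h h′ k₁ k₂
  same-end c u₁∈ u₂∈ with split (Config.simple₁ c) u₁∈ u₂∈ (Config.u₁≢u₂ c)
  ... | σ with Split.sides σ
  ...   | inj₁ (p , q) = _ , _ , config-chain c σ p q
  ...   | inj₂ (p , q) = _ , _ , config-chain (flip-feet c) (flip-split σ) p q

  arrange : ∀ {H a b B₁ B₂ k₁ k₂ h₁ h₂ u₁ u₂} (c : Config H a b B₁ B₂ k₁ k₂ h₁ h₂ u₁ u₂) →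
            u₁ ∈ Config.S₁ c ∪ Config.S₂ c → u₂ ∈ Config.S₁ c ∪ Config.S₂ c → Arranged H a b B₁ B₂
  arrange c p q with ∪⁻ p | ∪⁻ q
  ... | inj₁ p′ | inj₁ q′ = swapped (inSeries (proj₂ (proj₂ (same-end c p′ q′))))
  ... | inj₂ p′ | inj₂ q′ = inSeries (flip-chain (proj₂ (proj₂ (same-end (flip-ends c) p′ q′))))
  ... | inj₁ p′ | inj₂ q′ = swapped (inParallel (config-theta c p′ q′))
  ... | inj₂ p′ | inj₁ q′ = swapped (inParallel (config-theta (flip-feet c) q′ p′))

  -- Finding two pieces

  third : ∀ {n R U} → Tree (suc n) R U → ∀ x y → ∃[ v ] (v ∈ U × v ≢ x × v ≢ y)
  third {R = R} (node {U₀ = U₀} {U₁ = U₁} c t₀ t₁ _ _ d₀ d₁ d) x y = go (r ≟ x) (r ≟ y) (u ≟ x) (u ≟ y)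
    where
    r = hub c
    u = hub (tree-conn t₀)
    v = hub (tree-conn t₁)
    r≢u : r ≢ u
    r≢u p = d₀ (hub∈ c) (subst (_∈ U₀) (≡-sym p) (hub∈ (tree-conn t₀)))
    r≢v : r ≢ v
    r≢v p = d₁ (hub∈ c) (subst (_∈ U₁) (≡-sym p) (hub∈ (tree-conn t₁)))
    u≢v : u ≢ v
    u≢v p = d (hub∈ (tree-conn t₀)) (subst (_∈ U₁) (≡-sym p) (hub∈ (tree-conn t₁)))
    go : Dec (r ≡ x) → Dec (r ≡ y) → Dec (u ≡ x) → Dec (u ≡ y) → ∃[ v ] (v ∈ R ∪ U₀ ∪ U₁ × v ≢ x × v ≢ y)
    go (no p) (no q) _ _ = r , ∪ˡ (hub∈ c) , p , q
    go _ _ (no p) (no q) = u , ∪ʳ (∪ˡ (hub∈ (tree-conn t₀))) , p , q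
    go (yes p) _ (yes q) _ = ⊥-elim (r≢u (trans p (≡-sym q)))
    go _ (yes p) _ (yes q) = ⊥-elim (r≢u (trans p (≡-sym q)))
    go (yes p) _ _ (yes q) = v , ∪ʳ (∪ʳ (hub∈ (tree-conn t₁))) , (λ s → r≢v (trans p (≡-sym s))) , λ s → u≢v (trans q (≡-sym s))
    go _ (yes p) (yes q) _ = v , ∪ʳ (∪ʳ (hub∈ (tree-conn t₁))) , (λ s → u≢v (trans q (≡-sym s))) , λ s → r≢v (trans p (≡-sym s))

  lower : ∀ {g h R U} → g ≤ h → Tree h R U → ∃[ R′ ] ∃[ U′ ] (Tree g R′ U′ × U′ ⊆ U)
  lower {g} {h} {R} {U} g≤h t = descend (h ∸ g) (subst (λ k → Tree k R U) (≡-sym (m∸n+n≡m g≤h)) t)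

  avoid : ∀ {g R U} → Tree (suc g) R U → ∀ v → ∃[ R′ ] ∃[ U′ ] (Tree g R′ U′ × U′ ⊆ U × v ∉ U′)
  avoid t v = _ , _ , tree , ⊆V , avoids
    where open Pruned (prune t below-refl v)

  twoConn-path : ∀ {B n R U x y} → TwoConn B → Tree (suc n) R U → x ∈ B → y ∈ B → Path B x y
  twoConn-path {x = x} {y} 2c t x∈ y∈ =
    let v , _ , v≢x , v≢y = third t x y in mapW ∖ˡ (2c x∈ y∈ (λ p → v≢x (≡-sym p)) (λ p → v≢y (≡-sym p)))

  twoConn-conn : ∀ {B n R U} → TwoConn B → Tree (suc n) R U → U ⊆ B → Conn B
  twoConn-conn 2c t U⊆ = conn (hub (tree-conn t)) x∈ (λ p → twoConn-path 2c t p x∈)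
    where x∈ = U⊆ (hub∈ (tree-conn t))

  twoConn-escapes : ∀ {H S} → TwoConn H → S ⊆ H → (∀ v → ∃[ s ] (s ∈ S × s ≢ v)) → Escapes H S
  twoConn-escapes 2c S⊆ two {v} x∈ x≢v = let s , s∈ , s≢v = two v in s , s∈ , 2c x∈ (S⊆ s∈) x≢v s≢v

  one-of-two : ∀ {a b S} → a ≢ b → a ∈ S → b ∈ S → ∀ v → ∃[ s ] (s ∈ S × s ≢ v)
  one-of-two {a} {b} a≢b a∈ b∈ v with a ≟ v
  ... | no p = a , a∈ , p
  ... | yes refl = b , b∈ , λ p → a≢b (≡-sym p)

  record Trimmed (P Y : Sub) (a : Vertex) : Set where
    field
      {q}    : Vertex
      {S}    : Sub
      q∈     : q ∈ Y
      simp   : Simple a q S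
      S⊆     : S ⊆ P
      only   : Only S Y q

  trim : ∀ {P Y a y} → Path P a y → y ∈ Y → Trimmed P Y a
  trim {P} {Y} {a} w y∈ with a ∈? Y
  ... | yes a∈ = record { q∈ = a∈ ; simp = one ; S⊆ = ⁅⁆⊆ (start∈ w) ; only = λ p _ → ⁅⁆⁻ p }
  ... | no a∉ with approach w a∉ y∈
  ...   | u , v , w′ , e , v∈ , v∈P with simple (mapW ∪ˡ w′ ++W cons (∪ˡ (end∈ w′)) e (nil (∪ʳ {P ∖ Y} ⁅⁆⁺)))
  ...     | S , s , S⊆ = record
    { q∈ = v∈ ; simp = s ; S⊆ = λ p → ∪⊆ ∖ˡ (⁅⁆⊆ v∈P) (S⊆ p)
    ; only = λ p q → [ (λ r → ⊥-elim (∖ʳ r q)) , ⁅⁆⁻ ]′ (∪⁻ (S⊆ p)) }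

  -- B with paths from q₁, q₂ ∈ B to a, b becomes 2-connected when the edge ab is added.
  ears-escape : ∀ {B S₁ S₂ a b q₁ q₂} → TwoConn B → Simple a q₁ S₁ → Simple b q₂ S₂ → Disj S₁ S₂ →
                q₁ ∈ B → q₂ ∈ B → Escapes ((S₁ ∪ B) ∪ S₂) (⁅ a ⁆ ∪ ⁅ b ⁆)
  ears-escape {B} {S₁} {S₂} {a} {b} {q₁} {q₂} 2c s₁ s₂ S₁#S₂ q₁∈ q₂∈ {v} x∈ x≢v =
    [ (λ p → [ (λ q → via₁ (toward-end s₁ q x≢v)) , (λ q → from-B q x≢v) ]′ (∪⁻ p)) , (λ p → via₂ (toward-end s₂ p x≢v)) ]′ (∪⁻ x∈)
    where
    A = (S₁ ∪ B) ∪ S₂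
    Escape = λ x → ∃[ s ] (s ∈ ⁅ a ⁆ ∪ ⁅ b ⁆ × Path (A ∖ ⁅ v ⁆) x s)
    keep : ∀ {S} → S ⊆ A → S ∖ ⁅ v ⁆ ⊆ A ∖ ⁅ v ⁆
    keep f p = ∖⁺ (f (∖ˡ p)) (∖ʳ p)
    S₁⊆ : S₁ ⊆ A
    S₁⊆ p = ∪ˡ (∪ˡ p)
    B⊆ : B ⊆ A
    B⊆ p = ∪ˡ (∪ʳ p)
    miss : ∀ {S} → v ∉ S → S ⊆ A → S ⊆ A ∖ ⁅ v ⁆
    miss {S} h f p = ∖⁺ (f p) λ q → h (subst (_∈ S) (⁅⁆⁻ q) p)
    -- The paths `S₁` and `S₂` are disjoint, so `v` leaves at least one of them intact.
    from-B : ∀ {x} → x ∈ B → x ≢ v → Escape x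
    from-B x∈ x≢v with v ∈? S₁
    ... | no v∉ = a , ∪ˡ ⁅⁆⁺ , (mapW (keep B⊆) (2c x∈ q₁∈ x≢v λ { refl → v∉ (simple-end s₁) }) ++W
                                mapW (miss v∉ S₁⊆) (revW (simple-path s₁)))
    ... | yes v∈ = b , ∪ʳ ⁅⁆⁺ , (mapW (keep B⊆) (2c x∈ q₂∈ x≢v λ { refl → S₁#S₂ v∈ (simple-end s₂) }) ++W
                                 mapW (miss (S₁#S₂ v∈) ∪ʳ) (revW (simple-path s₂)))
    extend-by : ∀ {x y} → Path (A ∖ ⁅ v ⁆) x y → Escape y → Escape x
    extend-by w (s , s∈ , w′) = s , s∈ , (w ++W w′)
    ≢v : ∀ {S x y} → Path (S ∖ ⁅ v ⁆) x y → y ≢ v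
    ≢v w refl = ∖ʳ (end∈ w) ⁅⁆⁺
    via₁ : ∀ {x} → Path (S₁ ∖ ⁅ v ⁆) x a ⊎ Path (S₁ ∖ ⁅ v ⁆) x q₁ → Escape x
    via₁ (inj₁ w) = a , ∪ˡ ⁅⁆⁺ , mapW (keep S₁⊆) w
    via₁ (inj₂ w) = extend-by (mapW (keep S₁⊆) w) (from-B q₁∈ (≢v w))
    via₂ : ∀ {x} → Path (S₂ ∖ ⁅ v ⁆) x b ⊎ Path (S₂ ∖ ⁅ v ⁆) x q₂ → Escape x
    via₂ (inj₁ w) = b , ∪ʳ ⁅⁆⁺ , mapW (keep ∪ʳ) w
    via₂ (inj₂ w) = extend-by (mapW (keep ∪ʳ) w) (from-B q₂∈ (≢v w))

  -- `A` is a 2-connected piece with its paths to `a` and `b`, still carrying a tree; `att` holds a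
  -- further piece outside `A`. The tree in `A` is kept for the second piece that `Stage₂` finds
  -- inside `A`.
  record Stage₁ (m : ℕ) (H : Sub) (a b : Vertex) : Set where
    field
      {A R U} : Sub
      A⊆      : A ⊆ H
      a∈      : a ∈ A
      b∈      : b ∈ A
      A-conn  : Conn A
      escapes : Escapes A (⁅ a ⁆ ∪ ⁅ b ⁆)
      tree    : Tree m R U
      U⊆      : U ⊆ A
      att     : Attached m H A

  record Stage₂ (m k : ℕ) (H : Sub) (a b : Vertex) : Set where
    field
      {A P Q S₁ S₂} : Sub
      A⊆      : A ⊆ H
      blk     : Block m (H ∖ A)
      P#Q     : Disj P Q
      link₁   : Link H A (Block.B blk) P
      link₂   : Link H A (Block.B blk) Q
      simple₁ : Simple a (Link.s link₁) S₁
      simple₂ : Simple b (Link.s link₂) S₂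
      S₁#S₂   : Disj S₁ S₂
      S₁⊆     : S₁ ⊆ A
      S₂⊆     : S₂ ⊆ A
      att     : Attached k A (S₁ ∪ S₂)

  record Bypass (k : ℕ) (H : Sub) (a b : Vertex) : Set where
    field
      {X Y L₁ L₂} : Sub
      {h₁ h₂} : Vertex
      blk     : Block k H
      X-conn  : Conn X
      Y-conn  : Conn Y
      L₁-conn : Conn L₁
      L₂-conn : Conn L₂
      a∈      : a ∈ X
      b∈      : b ∈ Y
      touch   : Touch X Y
      X~L₁    : Touch X L₁
      Y~L₂    : Touch Y L₂
      h₁∈     : h₁ ∈ L₁
      h₂∈     : h₂ ∈ L₂
      h₁∈B    : h₁ ∈ Block.B blk
      h₂∈B    : h₂ ∈ Block.B blk
      only₁   : Only L₁ (Block.B blk) h₁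
      only₂   : Only L₂ (Block.B blk) h₂
      X#Y     : Disj X Y
      X#L     : Disj X (L₁ ∪ L₂)
      Y#L     : Disj Y (L₁ ∪ L₂)
      L₁#L₂   : Disj L₁ L₂
      X#B     : Disj X (Block.B blk)
      Y#B     : Disj Y (Block.B blk)
      X⊆      : X ⊆ H
      Y⊆      : Y ⊆ H
      L₁⊆     : L₁ ⊆ H
      L₂⊆     : L₂ ⊆ H

  -- `Win` is the early exit, later the Γ⁺ minor itself; `_>>=_` passes it on.
  module Search (Win : Set) (w : ℕ) (win : ∀ {A R T} → Conn A → Disj A T → Tree⁺ A w R T → Win) where

    _>>=_ : ∀ {A B : Set} → Win ⊎ A → (A → Win ⊎ B) → Win ⊎ B
    inj₁ x >>= f = inj₁ x
    inj₂ y >>= f = f y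

    attach-or-win : ∀ {H S A R U} m → S ⊆ H → S ⊆ A → Conn A → (∀ {x} → x ∈ A → x ∈ H → x ∈ S) → Escapes H S →
                    Tree (attach-height w m) R U → U ⊆ H ∖ S → Win ⊎ Attached (suc m) H S
    attach-or-win m S⊆H S⊆A cA A∩H esc t U⊆ with attach m w S⊆H S⊆A esc t U⊆
    ... | inj₂ α = inj₂ α
    ... | inj₁ κ = inj₁ (win cA (λ p q → ∖ʳ (Crown.V⊆ κ q) (A∩H p (∖ˡ (Crown.V⊆ κ q)))) (Crown.tree κ))

    -- The children of one node get different roles. `U₀` yields a piece `B`, with the root and `U₁`
    -- as the connected apex in case it does not. `U₁` then supplies the subtree spared by the
    -- routes from `a` and `b` to `B`, and this subtree yields the piece attached to `B` and the
    -- routes.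
    stage₁ : ∀ {H a b R U} m → TwoConn H → a ∈ H → b ∈ H → a ≢ b → Tree (stage₁-height w m) R U → U ⊆ H →
             Win ⊎ Stage₁ (suc m) H a b
    stage₁ {H} {a} {b} m 2c a∈ b∈ a≢b t U⊆H with avoid t a
    ... | _ , _ , t′ , ⊆₁ , a∉ with avoid t′ b
    ...   | _ , _ , node {R = R} {U₀ = U₀} {R₁ = R₁} {U₁ = U₁} c t₀ t₁ e₀ e₁ d₀ d₁ d , ⊆₂ , b∉ =
      attach-or-win m S⊆H (λ p → p) S-conn (λ p _ → p) esc (proj₁ (proj₂ (proj₂ low)))
        (λ p → U₀⊆ (proj₂ (proj₂ (proj₂ low)) p)) >>= continue
      where
      inH : ∀ {x} → x ∈ R ∪ U₀ ∪ U₁ → x ∈ H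
      inH p = U⊆H (⊆₁ (⊆₂ p))
      S = R ∪ U₁
      S⊆H : S ⊆ H
      S⊆H = ∪⊆ (λ p → inH (∪ˡ p)) (λ p → inH (∪ʳ (∪ʳ p)))
      S-conn : Conn S
      S-conn = conn-∪-touch c (tree-conn t₁) (touch-mono (λ p → p) (root⊆ t₁) e₁)
      esc : Escapes H S
      esc = twoConn-escapes 2c S⊆H (one-of-two (λ p → d₁ (hub∈ c) (subst (_∈ U₁) (≡-sym p) (hub∈ (tree-conn t₁))))
              (∪ˡ (hub∈ c)) (∪ʳ (hub∈ (tree-conn t₁))))
      low = descend 4 t₀
      U₀⊆ : U₀ ⊆ H ∖ S
      U₀⊆ p = ∖⁺ (inH (∪ʳ (∪ˡ p))) (λ q → [ (λ r → d₀ r p) , (λ r → d p r) ]′ (∪⁻ q))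
      continue : Attached (suc m) H S → Win ⊎ Stage₁ (suc m) H a b
      continue α with Attached.blk α
      ... | block {B} 2cB B⊆ tB UB⊆ = routed (route t₁ U₁⊆H a∈ b∈ (λ p → ∖ˡ (B⊆ p))
          (λ p → a∉ (⊆₂ (∪ʳ (∪ʳ p)))) (λ p → b∉ (∪ʳ (∪ʳ p))) U₁#B
          (λ v → let x , x∈ , x≢ = one-of-two a≢b (∪ˡ {⁅ a ⁆} {⁅ b ⁆} ⁅⁆⁺) (∪ʳ ⁅⁆⁺) v
                     y , y∈ , y≢ = two-vertices tB v
                 in x , y , x∈ , UB⊆ y∈ , 2c (∪⊆ (⁅⁆⊆ a∈) (⁅⁆⊆ b∈) x∈) (∖ˡ (B⊆ (UB⊆ y∈))) x≢ y≢))
        where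
        U₁⊆H : U₁ ⊆ H
        U₁⊆H p = inH (∪ʳ (∪ʳ p))
        U₁#B : Disj U₁ B
        U₁#B p q = ∖ʳ (B⊆ q) (∪ʳ p)
        routed : Routes (attach-height w m) H B U₁ a b → Win ⊎ Stage₁ (suc m) H a b
        routed ρ = trimmed (trim path₁ y₁∈) (trim path₂ y₂∈)
          where
          open Routes ρ
          trimmed : Trimmed P B a → Trimmed Q B b → Win ⊎ Stage₁ (suc m) H a b
          trimmed τ₁ τ₂ =
            attach-or-win m A⊆H (λ p → p) A-conn (λ p _ → p) (twoConn-escapes 2c A⊆H (one-of-two a≢b a∈A b∈A)) tree
              (λ p → ∖⁺ (U₁⊆H (Z⊆ p)) λ q → [ (λ r → [ (λ s → Z#P p (T₁.S⊆ s)) , (λ s → U₁#B (Z⊆ p) s) ]′ (∪⁻ r))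
                                            , (λ r → Z#Q p (T₂.S⊆ r)) ]′ (∪⁻ q))
            >>= λ α′ → inj₂ record
              { A⊆ = A⊆H ; a∈ = a∈A ; b∈ = b∈A ; A-conn = A-conn
              ; escapes = ears-escape 2cB T₁.simp T₂.simp (λ p q → P#Q (T₁.S⊆ p) (T₂.S⊆ q)) T₁.q∈ T₂.q∈
              ; tree = tB ; U⊆ = λ p → ∪ˡ (∪ʳ (UB⊆ p)) ; att = α′ }
            where
            module T₁ = Trimmed τ₁
            module T₂ = Trimmed τ₂
            A = (T₁.S ∪ B) ∪ T₂.S
            A⊆H : A ⊆ H
            A⊆H = ∪⊆ (∪⊆ (λ p → P⊆ (T₁.S⊆ p)) (λ p → ∖ˡ (B⊆ p))) (λ p → Q⊆ (T₂.S⊆ p))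
            a∈A : a ∈ A
            a∈A = ∪ˡ (∪ˡ (simple-start T₁.simp))
            b∈A : b ∈ A
            b∈A = ∪ʳ (simple-start T₂.simp)
            A-conn : Conn A
            A-conn = conn-∪-meet (conn-∪-meet (simple-conn T₁.simp) (twoConn-conn 2cB tB UB⊆) (simple-end T₁.simp) T₁.q∈)
                       (simple-conn T₂.simp) (∪ʳ T₂.q∈) (simple-end T₂.simp)

    module _ {H : Sub} {a b : Vertex} (k : ℕ) (σ : Stage₁ (stage₂-height w k) H a b) where
      open Stage₁ σ
      open Attached att using (blk; link₁; link₂) renaming (P#Q to P₁#Q₁; P to P₁; Q to Q₁)
      open Block blk using (B; twoConn) renaming (tree to treeB; U⊆ to UB⊆; B⊆ to B⊆H∖A)
      private
        z₁ = Link.s link₁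
        z₂ = Link.s link₂

      stage₂-routed : ∀ {U′} → U′ ⊆ A → Routes (attach-height w k) A (⁅ z₁ ⁆ ∪ ⁅ z₂ ⁆) U′ a b →
                      Win ⊎ Stage₂ (stage₂-height w k) (suc k) H a b
      stage₂-routed {U′} U′⊆A ρ = fork (∪⁻ y₁∈) (∪⁻ y₂∈)
        where
        open Routes ρ using (P#Q; P⊆; Q⊆; y₁; y₂; y₁∈; y₂∈; path₁; path₂; Z; Z⊆; Z#P; Z#Q) renaming (tree to treeZ; P to P₂; Q to Q₂)

        finish : ∀ {P Q} → Disj P Q → (K₁ : Link H A B P) (K₂ : Link H A B Q) → Path P₂ a (Link.s K₁) → Path Q₂ b (Link.s K₂) →
                 Win ⊎ Stage₂ (stage₂-height w k) (suc k) H a b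
        finish P#Q′ K₁ K₂ w₁ w₂ with simple w₁ | simple w₂
        ... | S₁ , s₁ , S₁⊆P | S₂ , s₂ , S₂⊆Q =
          attach-or-win k S⊆A S⊆apex apex-conn apex∩A esc treeZ Z⊆′ >>= λ α → inj₂ record
            { A⊆ = A⊆ ; blk = blk ; P#Q = P#Q′ ; link₁ = K₁ ; link₂ = K₂ ; simple₁ = s₁ ; simple₂ = s₂
            ; S₁#S₂ = λ p q → P#Q (S₁⊆P p) (S₂⊆Q q) ; S₁⊆ = λ p → P⊆ (S₁⊆P p) ; S₂⊆ = λ p → Q⊆ (S₂⊆Q p) ; att = α }
          where
          module K₁ = Link K₁
          module K₂ = Link K₂
          S = S₁ ∪ S₂
          S⊆A : S ⊆ A
          S⊆A = ∪⊆ (λ p → P⊆ (S₁⊆P p)) (λ p → Q⊆ (S₂⊆Q p))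
          -- The strands are disjoint and their union need not be connected; the first piece and its
          -- links join them outside `A`, so the apex does not meet the region searched for the
          -- second piece.
          apex = ((S₁ ∪ K₁.L) ∪ B) ∪ (K₂.L ∪ S₂)
          S⊆apex : S ⊆ apex
          S⊆apex = ∪⊆ (λ p → ∪ˡ (∪ˡ (∪ˡ p))) (λ p → ∪ʳ (∪ʳ p))
          apex-conn : Conn apex
          apex-conn = conn-∪-meet
            (conn-∪-meet (conn-∪-touch (simple-conn s₁) K₁.L-conn (touch-sym (touch-at K₁.touch (simple-end s₁))))
              (twoConn-conn twoConn treeB UB⊆) (∪ʳ K₁.h∈L) K₁.h∈B)
            (conn-∪-touch K₂.L-conn (simple-conn s₂) (touch-at K₂.touch (simple-end s₂)))
            (∪ʳ K₂.h∈B) (∪ˡ K₂.h∈L)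
          apex∩A : ∀ {x} → x ∈ apex → x ∈ A → x ∈ S
          apex∩A p q = [ (λ r → [ (λ s → [ ∪ˡ , (λ t → ⊥-elim (K₁.L#S t q)) ]′ (∪⁻ s)) , (λ s → ⊥-elim (∖ʳ (B⊆H∖A s) q)) ]′ (∪⁻ r))
                       , (λ r → [ (λ s → ⊥-elim (K₂.L#S s q)) , ∪ʳ ]′ (∪⁻ r)) ]′ (∪⁻ p)
          esc : Escapes A S
          esc x∈ x≢v = let s , s∈ , w = escapes x∈ x≢v in
            s , ∪⊆ (⁅⁆⊆ (∪ˡ (simple-start s₁))) (⁅⁆⊆ (∪ʳ (simple-start s₂))) s∈ , w
          Z⊆′ : Z ⊆ A ∖ S
          Z⊆′ p = ∖⁺ (U′⊆A (Z⊆ p)) λ q → [ (λ r → Z#P p (S₁⊆P r)) , (λ r → Z#Q p (S₂⊆Q r)) ]′ (∪⁻ q)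

        fork : y₁ ∈ ⁅ z₁ ⁆ ⊎ y₁ ∈ ⁅ z₂ ⁆ → y₂ ∈ ⁅ z₁ ⁆ ⊎ y₂ ∈ ⁅ z₂ ⁆ → Win ⊎ Stage₂ (stage₂-height w k) (suc k) H a b
        fork (inj₁ p) (inj₂ q) = finish P₁#Q₁ link₁ link₂ (subst (Path P₂ a) (⁅⁆⁻ p) path₁) (subst (Path Q₂ b) (⁅⁆⁻ q) path₂)
        fork (inj₂ p) (inj₁ q) = finish (disj-sym P₁#Q₁) link₂ link₁ (subst (Path P₂ a) (⁅⁆⁻ p) path₁) (subst (Path Q₂ b) (⁅⁆⁻ q) path₂)
        fork (inj₁ p) (inj₁ q) = ⊥-elim (P#Q (end∈ path₁) (subst (_∈ Q₂) (trans (⁅⁆⁻ q) (≡-sym (⁅⁆⁻ p))) (end∈ path₂)))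
        fork (inj₂ p) (inj₂ q) = ⊥-elim (P#Q (end∈ path₁) (subst (_∈ Q₂) (trans (⁅⁆⁻ q) (≡-sym (⁅⁆⁻ p))) (end∈ path₂)))

    stage₂ : ∀ {H a b} k → Stage₁ (stage₂-height w k) H a b → Win ⊎ Stage₂ (stage₂-height w k) (suc k) H a b
    stage₂ {H} {a} {b} k σ with avoid (Stage₁.tree σ) (Link.s (Attached.link₁ (Stage₁.att σ)))
    ... | _ , _ , t₁ , ⊆₁ , z₁∉ with avoid t₁ (Link.s (Attached.link₂ (Stage₁.att σ)))
    ...   | _ , _ , t₂ , ⊆₂ , z₂∉ with avoid t₂ a
    ...     | _ , _ , t₃ , ⊆₃ , a∉ with avoid t₃ b
    ...       | _ , U′ , t₄ , ⊆₄ , b∉ = stage₂-routed k σ U′⊆A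
      (route t₄ U′⊆A a∈ b∈ z⊆A (λ p → a∉ (⊆₄ p)) b∉ (λ p q → z∉U′ q p)
        (λ v → let z , z∈ , z≢v = one-of-two z₁≢z₂ (∪ˡ {⁅ z₁ ⁆} {⁅ z₂ ⁆} ⁅⁆⁺) (∪ʳ ⁅⁆⁺) v
                   x , x∈ , w = escapes (z⊆A z∈) z≢v
               in x , z , x∈ , z∈ , revW w))
      where
      open Stage₁ σ
      open Attached att
      z₁ = Link.s link₁
      z₂ = Link.s link₂
      z₁≢z₂ : z₁ ≢ z₂
      z₁≢z₂ p = P#Q (Link.s∈P link₁) (subst (_∈ Q) (≡-sym p) (Link.s∈P link₂))
      U′⊆A : U′ ⊆ A
      U′⊆A p = U⊆ (⊆₁ (⊆₂ (⊆₃ (⊆₄ p))))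
      z∉U′ : ∀ {z} → z ∈ ⁅ z₁ ⁆ ∪ ⁅ z₂ ⁆ → z ∉ U′
      z∉U′ p q with ∪⁻ p
      ... | inj₁ r = z₁∉ (⊆₂ (⊆₃ (⊆₄ (subst (_∈ U′) (⁅⁆⁻ r) q))))
      ... | inj₂ r = z₂∉ (⊆₃ (⊆₄ (subst (_∈ U′) (⁅⁆⁻ r) q)))
      z⊆A : ⁅ z₁ ⁆ ∪ ⁅ z₂ ⁆ ⊆ A
      z⊆A = ∪⊆ (⁅⁆⊆ (Link.s∈S link₁)) (⁅⁆⊆ (Link.s∈S link₂))

    -- A path from `a` to `b` spares a subtree, whose block is attached to the path at two different
    -- vertices. Splitting the path between them leaves an edge from the part of `a` to the part of
    -- `b`: the future root edge.
    bypass : ∀ {H a b R U} k → TwoConn H → a ∈ H → b ∈ H → a ≢ b → Tree (bypass-height w k) R U → U ⊆ H →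
             Win ⊎ Bypass (suc k) H a b
    bypass {H} {a} {b} k 2c a∈ b∈ a≢b t U⊆H with avoid t a
    ... | _ , _ , t₁ , ⊆₁ , a∉ with avoid t₁ b
    ...   | _ , _ , t₂ , ⊆₂ , b∉ with detour t₂ (λ p → U⊆H (⊆₁ (⊆₂ p))) (λ p → a∉ (⊆₂ p)) b∉ (twoConn-path 2c t₂ a∈ b∈)
    ...     | δ with simple (Detour.path δ)
    ...       | S , s , S⊆ =
      attach-or-win k S⊆H (λ p → p) (simple-conn s) (λ p _ → p)
        (twoConn-escapes 2c S⊆H (one-of-two a≢b (simple-start s) (simple-end s))) tree
        (λ p → ∖⁺ (U⊆H (⊆₁ (⊆₂ (Z⊆ p)))) λ q → ∖ʳ (S⊆ q) p)
      >>= λ α → inj₂ (cases α)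
      where
      open Detour δ
      S⊆H : S ⊆ H
      S⊆H p = ∖ˡ (S⊆ p)
      cases : Attached (suc k) H S → Bypass (suc k) H a b
      cases α = [ (λ (p , q) → build P#Q link₁ link₂ p q) , (λ (p , q) → build (disj-sym P#Q) link₂ link₁ p q) ]′ σ.sides
        where
        open Attached α
        module B = Block blk
        σ : Split a b S (Link.s link₁) (Link.s link₂)
        σ = split s (Link.s∈S link₁) (Link.s∈S link₂)
              (λ p → P#Q (Link.s∈P link₁) (subst (_∈ Q) (≡-sym p) (Link.s∈P link₂)))
        module σ = Split σ
        build : ∀ {P Q} → Disj P Q → (K₁ : Link H S B.B P) (K₂ : Link H S B.B Q) → Link.s K₁ ∈ σ.P → Link.s K₂ ∈ σ.Q →
                Bypass (suc k) H a b
        build P#Q K₁ K₂ s₁∈ s₂∈ = record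
          { blk = block B.twoConn (λ p → ∖ˡ (B.B⊆ p)) B.tree B.U⊆
          ; X-conn = σ.P-conn ; Y-conn = σ.Q-conn ; L₁-conn = K₁.L-conn ; L₂-conn = K₂.L-conn
          ; a∈ = σ.a∈P ; b∈ = σ.b∈Q ; touch = σ.touch
          ; X~L₁ = touch-sym (touch-at K₁.touch s₁∈) ; Y~L₂ = touch-sym (touch-at K₂.touch s₂∈)
          ; h₁∈ = K₁.h∈L ; h₂∈ = K₂.h∈L ; h₁∈B = K₁.h∈B ; h₂∈B = K₂.h∈B ; only₁ = K₁.only ; only₂ = K₂.only
          ; X#Y = σ.P#Q ; X#L = λ p → #L (σ.P⊆ p) ; Y#L = λ p → #L (σ.Q⊆ p) ; L₁#L₂ = λ p q → P#Q (K₁.L⊆P p) (K₂.L⊆P q)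
          ; X#B = λ p q → ∖ʳ (B.B⊆ q) (σ.P⊆ p) ; Y#B = λ p q → ∖ʳ (B.B⊆ q) (σ.Q⊆ p)
          ; X⊆ = λ p → S⊆H (σ.P⊆ p) ; Y⊆ = λ p → S⊆H (σ.Q⊆ p) ; L₁⊆ = K₁.L⊆H ; L₂⊆ = K₂.L⊆H }
          where
          module K₁ = Link K₁
          module K₂ = Link K₂
          #L : Disj S (K₁.L ∪ K₂.L)
          #L = disj-∪ʳ (disj-sym K₁.L#S) (disj-sym K₂.L#S)

  module _ {m k l H a b} (β : Bypass l H a b)
           (σ : Stage₂ (suc m) (suc k) (Block.B (Bypass.blk β)) (Bypass.h₁ β) (Bypass.h₂ β)) where
    private
      module β = Bypass β
      module C = Block β.blk
      module σ = Stage₂ σ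
      module K₁ = Link σ.link₁
      module K₂ = Link σ.link₂
      module α = Attached σ.att
      module J₁ = Link α.link₁
      module J₂ = Link α.link₂
      module B₁ = Block σ.blk
      module B₂ = Block α.blk
      X = β.X ∪ β.L₁
      Y = β.Y ∪ β.L₂
      onlyX : Only X C.B β.h₁
      onlyX = only-∪ β.X#B β.only₁
      onlyY : Only Y C.B β.h₂
      onlyY = only-∪ β.Y#B β.only₂
      S₁⊆C : σ.S₁ ⊆ C.B
      S₁⊆C p = σ.A⊆ (σ.S₁⊆ p)
      S₂⊆C : σ.S₂ ⊆ C.B
      S₂⊆C p = σ.A⊆ (σ.S₂⊆ p)
      S⊆A : σ.S₁ ∪ σ.S₂ ⊆ σ.A
      S⊆A = ∪⊆ σ.S₁⊆ σ.S₂⊆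
      L⊆C : K₁.L ∪ K₂.L ⊆ C.B
      L⊆C = ∪⊆ K₁.L⊆H K₂.L⊆H
      J⊆A : J₁.L ∪ J₂.L ⊆ σ.A
      J⊆A = ∪⊆ J₁.L⊆H J₂.L⊆H
      B₂⊆A : B₂.B ⊆ σ.A
      B₂⊆A p = ∖ˡ (B₂.B⊆ p)
      L#A : Disj (K₁.L ∪ K₂.L) σ.A
      L#A = disj-∪ K₁.L#S K₂.L#S
      C⊆H : C.B ⊆ H
      C⊆H = C.B⊆
      D#-disj : ∀ {Z} → Z ⊆ C.B → Disj (σ.S₁ ∪ σ.S₂) Z → Disj ((X ∪ σ.S₁) ∪ (Y ∪ σ.S₂)) Z
      D#-disj Z⊆ d = disj-∪
        (disj-∪ (only-disj onlyX (simple-start σ.simple₁) (λ p → d (∪ˡ p)) Z⊆) (λ p → d (∪ˡ p)))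
        (disj-∪ (only-disj onlyY (simple-start σ.simple₂) (λ p → d (∪ʳ p)) Z⊆) (λ p → d (∪ʳ p)))

    -- The search for two pieces takes place inside the block of the bypass, between `h₁` and `h₂`;
    -- the bypass extends both strands to `a` and `b` and adds the edge between them.
    config : Config H a b B₁.B B₂.B K₁.h K₂.h J₁.h J₂.h J₁.s J₂.s
    config = record
      { X-conn = conn-∪-touch β.X-conn β.L₁-conn β.X~L₁ ; Y-conn = conn-∪-touch β.Y-conn β.L₂-conn β.Y~L₂
      ; L₁-conn = K₁.L-conn ; L₂-conn = K₂.L-conn ; J₁-conn = J₁.L-conn ; J₂-conn = J₂.L-conn
      ; B₁-conn = twoConn-conn B₁.twoConn B₁.tree B₁.U⊆ ; B₂-conn = twoConn-conn B₂.twoConn B₂.tree B₂.U⊆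
      ; a∈ = ∪ˡ β.a∈ ; b∈ = ∪ˡ β.b∈ ; a′∈ = ∪ʳ β.h₁∈ ; b′∈ = ∪ʳ β.h₂∈ ; touch = touch-mono ∪ˡ ∪ˡ β.touch
      ; simple₁ = σ.simple₁ ; simple₂ = σ.simple₂
      ; L₁~ = K₁.touch ; L₂~ = K₂.touch ; J₁~ = J₁.touch ; J₂~ = J₂.touch
      ; u₁≢u₂ = λ p → α.P#Q J₁.s∈P (subst (_∈ α.Q) (≡-sym p) J₂.s∈P)
      ; k₁∈ = K₁.h∈L ; k₂∈ = K₂.h∈L ; h₁∈ = J₁.h∈L ; h₂∈ = J₂.h∈L
      ; k₁∈B = K₁.h∈B ; k₂∈B = K₂.h∈B ; h₁∈B = J₁.h∈B ; h₂∈B = J₂.h∈B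
      ; onlyL₁ = K₁.only ; onlyL₂ = K₂.only ; onlyJ₁ = J₁.only ; onlyJ₂ = J₂.only
      ; onlyX = λ p q → onlyX p (S₁⊆C q) ; onlyY = λ p q → onlyY p (S₂⊆C q)
      ; D₁#D₂ = disj-∪
          (disj-∪ʳ (disj-∪ (disj-∪ʳ β.X#Y (λ p q → β.X#L p (∪ʳ q))) (disj-∪ʳ (λ p q → β.Y#L q (∪ˡ p)) β.L₁#L₂))
                   (only-disj onlyX (simple-start σ.simple₁) σ.S₁#S₂ S₂⊆C))
          (disj-∪ʳ (disj-sym (only-disj onlyY (simple-start σ.simple₂) (disj-sym σ.S₁#S₂) S₁⊆C)) σ.S₁#S₂)
      ; L₁#L₂ = λ p q → σ.P#Q (K₁.L⊆P p) (K₂.L⊆P q)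
      ; J₁#J₂ = λ p q → α.P#Q (J₁.L⊆P p) (J₂.L⊆P q)
      ; D#L = D#-disj L⊆C (λ p q → L#A q (S⊆A p))
      ; D#J = D#-disj (λ p → σ.A⊆ (J⊆A p)) (disj-sym (disj-∪ J₁.L#S J₂.L#S))
      ; D#B₁ = D#-disj (λ p → ∖ˡ (B₁.B⊆ p)) (λ p q → ∖ʳ (B₁.B⊆ q) (S⊆A p))
      ; D#B₂ = D#-disj (λ p → σ.A⊆ (B₂⊆A p)) (λ p q → ∖ʳ (B₂.B⊆ q) p)
      ; L#J = λ p q → L#A p (J⊆A q)
      ; L#B₂ = λ p q → L#A p (B₂⊆A q)
      ; J#B₁ = λ p q → ∖ʳ (B₁.B⊆ q) (J⊆A p)
      ; B₁#B₂ = λ p q → ∖ʳ (B₁.B⊆ p) (B₂⊆A q)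
      ; D⊆ = ∪⊆ (∪⊆ (∪⊆ β.X⊆ β.L₁⊆) (λ p → C⊆H (S₁⊆C p))) (∪⊆ (∪⊆ β.Y⊆ β.L₂⊆) (λ p → C⊆H (S₂⊆C p)))
      ; L⊆ = λ p → C⊆H (L⊆C p) ; J⊆ = λ p → C⊆H (σ.A⊆ (J⊆A p))
      ; B₁⊆ = λ p → C⊆H (∖ˡ (B₁.B⊆ p)) ; B₂⊆ = λ p → C⊆H (σ.A⊆ (B₂⊆A p)) }

    pieces-arranged : Arranged H a b B₁.B B₂.B
    pieces-arranged = arrange config J₁.s∈S J₂.s∈S

  chain-distinct : ∀ {H a b B₁ B₂ h₁ h₁′ h₂ h₂′} (χ : Chain H a b B₁ B₂ h₁ h₁′ h₂ h₂′) → h₁ ≢ h₁′ × h₂ ≢ h₂′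
  chain-distinct χ = (λ p → C₀#C₁ h₁∈ (subst (_∈ C₁) (≡-sym p) h₁′∈)) , (λ p → C₁#C₂ h₂∈ (subst (_∈ C₂) (≡-sym p) h₂′∈))
    where open Chain χ

  theta-distinct : ∀ {H a b B₁ B₂ h₁ h₁′ h₂ h₂′} (θ : Theta H a b B₁ B₂ h₁ h₁′ h₂ h₂′) → h₁ ≢ h₁′ × h₂ ≢ h₂′
  theta-distinct θ = (λ p → L₁#C h₁∈ (subst (_∈ C) (≡-sym p) h₁′∈)) , (λ p → L₂#C h₂∈ (subst (_∈ C) (≡-sym p) h₂′∈))
    where open Theta θ

  module Solve (Win : Set) (w : ℕ) (win : ∀ {A R T} → Conn A → Disj A T → Tree⁺ A w R T → Win) where
    open Search Win w win

    Solved : ℕ → ℕ → Sub → Set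
    Solved p q B = ∀ {h h′} → h ∈ B → h′ ∈ B → h ≢ h′ → Win ⊎ Outcome p q h h′ B

    Solves : ℕ → ℕ → ℕ → Set
    Solves N p q = ∀ {B R U} → TwoConn B → Tree N R U → U ⊆ B → Solved p q B

    solve-base : ∀ {k H a b} → Bypass (suc k) H a b → NablaAt 0 a b H
    solve-base β = record
      { a∈ = a∈ ; b∈ = b∈ ; X-conn = X-conn ; Y-conn = Y-conn ; touch = touch
      ; nabla = base (conn-∪-meet (conn-∪-meet L₁-conn (twoConn-conn B.twoConn B.tree B.U⊆) h₁∈ h₁∈B) L₂-conn (∪ʳ h₂∈B) h₂∈)
                  (touch-mono (λ p → ∪ˡ (∪ˡ p)) (λ p → p) (touch-sym X~L₁)) (touch-mono ∪ʳ (λ p → p) (touch-sym Y~L₂))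
      ; X#Y = X#Y
      ; X#W = disj-∪ʳ (disj-∪ʳ (λ p q → X#L p (∪ˡ q)) X#B) (λ p q → X#L p (∪ʳ q))
      ; Y#W = disj-∪ʳ (disj-∪ʳ (λ p q → Y#L p (∪ˡ q)) Y#B) (λ p q → Y#L p (∪ʳ q))
      ; X⊆ = X⊆ ; Y⊆ = Y⊆ ; W⊆ = ∪⊆ (∪⊆ L₁⊆ B.B⊆) L₂⊆ }
      where
      open Bypass β
      module B = Block blk

    crown-base : ∀ {k H a b} → Bypass k H a b → CrownAt 0 a b H
    crown-base β = record { a∈ = a∈ ; b∈ = b∈ ; Y-conn = Y-conn ; tree = leaf X-conn touch ; T#Y = X#Y ; T⊆ = X⊆ ; Y⊆ = Y⊆ }
      where open Bypass β

    -- In series the pieces are solved for `p` and `suc q`, in parallel for `suc p` and `q`, so both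
    -- solutions must be on offer for each piece.
    combine : ∀ {p q H a b B₁ B₂} → Arranged H a b B₁ B₂ →
              Solved p (suc q) B₁ → Solved (suc p) q B₁ → Solved p (suc q) B₂ → Solved (suc p) q B₂ →
              Win ⊎ Outcome (suc p) (suc q) a b H
    combine (inSeries χ) f₁ _ f₂ _ =
      f₁ h₁∈B h₁′∈B (proj₁ (chain-distinct χ)) >>= λ o₁ →
      f₂ h₂∈B h₂′∈B (proj₂ (chain-distinct χ)) >>= λ o₂ → inj₂ (series χ o₁ o₂)
      where open Chain χ
    combine (inParallel θ) _ f₁ _ f₂ =
      f₁ h₁∈B h₁′∈B (proj₁ (theta-distinct θ)) >>= λ o₁ →
      f₂ h₂∈B h₂′∈B (proj₂ (theta-distinct θ)) >>= λ o₂ → inj₂ (parallel θ o₁ o₂)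
      where open Theta θ
    combine (swapped α) f₁ g₁ f₂ g₂ = combine α f₂ g₂ f₁ g₁

    solve-step : ∀ {p q N₁ N₂} → Solves N₁ p (suc q) → Solves N₂ (suc p) q →
                 Solves (bypass-height w (step-height w (N₁ + N₂))) (suc p) (suc q)
    solve-step {p} {q} {N₁} {N₂} f g {B} 2c t U⊆ a∈ b∈ a≢b = bypass (step-height w k) 2c a∈ b∈ a≢b t U⊆ >>= staged
      where
      k = N₁ + N₂
      solved : ∀ {h Z} (β : Block h Z) → suc k ≤ h → Solved p (suc q) (Block.B β) × Solved (suc p) q (Block.B β)
      solved (block 2c _ t U⊆) k≤ = via f (≤-trans (≤-trans (m≤m+n N₁ N₂) (m≤n⇒m≤1+n ≤-refl)) k≤)
                                  , via g (≤-trans (≤-trans (m≤n+m N₂ N₁) (m≤n⇒m≤1+n ≤-refl)) k≤)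
        where
        via : ∀ {N p q} → Solves N p q → N ≤ _ → Solved p q _
        via f N≤ = let _ , _ , t′ , U′⊆ = lower N≤ t in f 2c t′ (λ p → U⊆ (U′⊆ p))
      staged : ∀ {a b} → Bypass (suc (step-height w k)) B a b → Win ⊎ Outcome (suc p) (suc q) a b B
      staged β =
        stage₁ (7 + attach-height w k) C.twoConn h₁∈B h₂∈B h₁≢h₂ C.tree C.U⊆ >>= λ σ →
        stage₂ k σ >>= λ τ →
        let f₁ , g₁ = solved (Stage₂.blk τ) big
            f₂ , g₂ = solved (Attached.blk (Stage₂.att τ)) ≤-refl
        in combine (pieces-arranged β τ) f₁ g₁ f₂ g₂
        where
        open Bypass β
        module C = Block blk
        h₁≢h₂ : h₁ ≢ h₂
        h₁≢h₂ p = L₁#L₂ h₁∈ (subst (_∈ L₂) (≡-sym p) h₂∈)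
        -- `stage₂-height w k` is `8 + attach-height w k`, and `attach-height w k` begins with
        -- `suc k`.
        big : suc k ≤ stage₂-height w k
        big = ≤-trans (m≤m+n (suc k) _) (m≤n+m _ 8)

    -- A bypass settles the base cases: its two path parts and the attached piece form a triangle,
    -- and the contact of the two parts alone is a crown of height 0.
    solve : ∀ p q → Solves (solve-height w p q) p q
    solve zero    q       2c t U⊆ a∈ b∈ a≢b = bypass 0 2c a∈ b∈ a≢b t U⊆ >>= λ β → inj₂ (inj₁ (solve-base β))
    solve (suc p) zero    2c t U⊆ a∈ b∈ a≢b = bypass 0 2c a∈ b∈ a≢b t U⊆ >>= λ β → inj₂ (inj₂ (crown-base β))
    solve (suc p) (suc q) = solve-step (solve p (suc q)) (solve (suc p) q)

  -- Minor models

  from-WalkIn : ∀ {S : Vertex → Set} {A x y} → (∀ {z} → S z → z ∈ A) → WalkIn G S x y → Path A x y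
  from-WalkIn f (stop p)     = nil (f p)
  from-WalkIn f (step p e w) = cons (f p) e (from-WalkIn f w)

  to-WalkIn : ∀ {A x y} → Path A x y → WalkIn G (λ z → A z ≡ true) x y
  to-WalkIn (nil (mem p))      = stop p
  to-WalkIn (cons (mem p) e w) = step p e (to-WalkIn w)

  model : ∀ {H : Pattern} (B : V H → Sub) → (∀ h → Conn (B h)) → (∀ h h′ {x} → x ∈ B h → x ∈ B h′ → h ≡ h′) →
          (∀ h h′ → E H h h′ → Touch (B h) (B h′)) → H ≼ G
  model B c d e = record
    { branch = B
    ; connected = λ h → (hub (c h) , _∈_.holds (hub∈ (c h))) , λ x y p q → to-WalkIn (conn-walk (c h) (mem p) (mem q))
    ; disjoint = λ h h′ x p q → d h h′ (mem p) (mem q)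
    ; edges = λ h h′ p → let x , y , mem x∈ , mem y∈ , x~y = e h h′ p in x , y , x∈ , y∈ , x~y }

  module _ {k} (μ : Γ k ≼ G) where
    open MinorModel μ

    bag : (s : List Bool) → length s ≤ k → Sub
    bag s p = branch (s , p)

    bag-conn : ∀ s p → Conn (bag s p)
    bag-conn s p = let (x , x∈) , w = connected (s , p) in
      conn x (mem x∈) λ { (mem y∈) → from-WalkIn mem (w _ _ y∈ x∈) }

    -- All vertices of the subtree rooted at s lie in bags t ++ s: the head of a list is the last turn on the way from the root.
    record Rooted-at (h : ℕ) (s : List Bool) (p : length s ≤ k) : Set where
      field
        {U}    : Sub
        tree   : Tree h (bag s p) U
        origin : ∀ {x} → x ∈ U → ∃[ t ] ∃[ q ] (x ∈ bag (t ++ s) q)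

    longer : ∀ (t : List Bool) {b s} → s ≢ t ++ b ∷ s
    longer t {b} {s} eq = m≢1+n+m (length s) (trans (cong length eq) (trans (length-++ t) (+-suc (length t) (length s))))

    -- Separates the bags of the two child subtrees: all addresses in a subtree share the letter
    -- next to `s`, and a mismatch in length would make `s` a proper suffix of itself.
    turn : ∀ t t′ {b b′ : Bool} {s} → t ++ b ∷ s ≡ t′ ++ b′ ∷ s → b ≡ b′
    turn []      []       eq = ∷-injectiveˡ eq
    turn []      (_ ∷ t′) eq = ⊥-elim (longer t′ (∷-injectiveʳ eq))
    turn (_ ∷ t) []       eq = ⊥-elim (longer t (≡-sym (∷-injectiveʳ eq)))
    turn (_ ∷ t) (_ ∷ t′) eq = turn t t′ (∷-injectiveʳ eq)

    bags-meet : ∀ {s t p q x} → x ∈ bag s p → x ∈ bag t q → s ≡ t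
    bags-meet (mem p) (mem q) = cong proj₁ (disjoint _ _ _ p q)

    rooted-at : ∀ h s p → length s + h ≤ k → Rooted-at h s p
    rooted-at zero s p _ = record { tree = leaf (bag-conn s p) ; origin = λ x∈ → [] , p , x∈ }
    rooted-at (suc h) s p q = record
      { tree = node (bag-conn s p) (C.tree false) (C.tree true) (down false) (down true) (apart false) (apart true)
                 λ x∈ y∈ → let t , _ , u = C.origin false x∈ ; t′ , _ , u′ = C.origin true y∈ in
                           false≢true (turn t t′ (bags-meet u u′))
      ; origin = λ x∈ → [ (λ r → [] , p , r) , (λ r → [ below false , below true ]′ (∪⁻ r)) ]′ (∪⁻ x∈) }
      where
      q′ : suc (length s + h) ≤ k
      q′ = ≤-trans (≤-reflexive (≡-sym (+-suc (length s) h))) q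
      p′ : suc (length s) ≤ k
      p′ = ≤-trans (s≤s (m≤m+n (length s) h)) q′
      module C (b : Bool) = Rooted-at (rooted-at h (b ∷ s) p′ q′)
      down : ∀ b → Touch (bag s p) (bag (b ∷ s) p′)
      down b = let x , y , x∈ , y∈ , e = edges (s , p) (b ∷ s , p′) (inj₁ (b , refl)) in x , y , mem x∈ , mem y∈ , e
      apart : ∀ b → Disj (bag s p) (C.U b)
      apart b x∈ y∈ = let t , _ , u = C.origin b y∈ in longer t (bags-meet x∈ u)
      below : ∀ b {x} → x ∈ C.U b → ∃[ t ] ∃[ r ] (x ∈ bag (t ++ s) r)
      below b x∈ = let t , r , u = C.origin b x∈ in go t r u
        where
        go : ∀ {x} t r → x ∈ bag (t ++ b ∷ s) r → ∃[ t′ ] ∃[ r′ ] (x ∈ bag (t′ ++ s) r′)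
        go t r u = t ++ b ∷ [] , subst (λ l → length l ≤ k) (≡-sym (++-assoc t (b ∷ []) s)) r , moved (++-assoc t (b ∷ []) s) u
          where
          moved : ∀ {l l′ x} (eq : l′ ≡ l) {r} → x ∈ bag l r → x ∈ bag l′ (subst (λ l → length l ≤ k) (≡-sym eq) r)
          moved refl v = v
      false≢true : false ≡ true → ⊥
      false≢true ()

    tree-of : ∃[ R ] ∃[ U ] Tree k R U
    tree-of = _ , _ , Rooted-at.tree (rooted-at k [] z≤n ≤-refl)

  -- Addresses are read from the root here, whereas a `TreeV` lists the last turn first; hence the
  -- `reverse` in `Γ⁺-model`. An address below a leaf gets the empty set.
  child : ∀ {A q R U} → Tree⁺ A q R U → List Bool → Sub
  child {R = R} _ [] = R
  child (leaf _ _) (_ ∷ _) = λ _ → false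
  child (node _ t₀ t₁ _ _ _ _ _) (false ∷ s) = child t₀ s
  child (node _ t₀ t₁ _ _ _ _ _) (true ∷ s)  = child t₁ s

  child⊆ : ∀ {A q R U} (t : Tree⁺ A q R U) s → child t s ⊆ U
  child⊆ t [] p = tree⁺-root⊆ t p
  child⊆ (leaf _ _) (_ ∷ _) (mem ())
  child⊆ (node _ t₀ t₁ _ _ _ _ _) (false ∷ s) p = ∪ʳ (∪ˡ (child⊆ t₀ s p))
  child⊆ (node _ t₀ t₁ _ _ _ _ _) (true ∷ s)  p = ∪ʳ (∪ʳ (child⊆ t₁ s p))

  child-conn : ∀ {A q R U} (t : Tree⁺ A q R U) s → length s ≤ q → Conn (child t s)
  child-conn t [] _ = tree⁺-root-conn t
  child-conn (node _ t₀ t₁ _ _ _ _ _) (false ∷ s) (s≤s p) = child-conn t₀ s p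
  child-conn (node _ t₀ t₁ _ _ _ _ _) (true ∷ s)  (s≤s p) = child-conn t₁ s p

  child-disj : ∀ {A q R U} (t : Tree⁺ A q R U) s s′ {x} → x ∈ child t s → x ∈ child t s′ → s ≡ s′
  child-disj t [] [] p q = refl
  child-disj (leaf _ _) [] (_ ∷ _) _ (mem ())
  child-disj (leaf _ _) (_ ∷ _) _ (mem ()) _
  child-disj (node _ t₀ t₁ _ _ d₀ d₁ d) [] (false ∷ s) p q = ⊥-elim (d₀ p (child⊆ t₀ s q))
  child-disj (node _ t₀ t₁ _ _ d₀ d₁ d) [] (true ∷ s)  p q = ⊥-elim (d₁ p (child⊆ t₁ s q))
  child-disj (node _ t₀ t₁ _ _ d₀ d₁ d) (false ∷ s) [] p q = ⊥-elim (d₀ q (child⊆ t₀ s p))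
  child-disj (node _ t₀ t₁ _ _ d₀ d₁ d) (true ∷ s)  [] p q = ⊥-elim (d₁ q (child⊆ t₁ s p))
  child-disj (node _ t₀ t₁ _ _ d₀ d₁ d) (false ∷ s) (true ∷ s′) p q = ⊥-elim (d (child⊆ t₀ s p) (child⊆ t₁ s′ q))
  child-disj (node _ t₀ t₁ _ _ d₀ d₁ d) (true ∷ s) (false ∷ s′) p q = ⊥-elim (d (child⊆ t₀ s′ q) (child⊆ t₁ s p))
  child-disj (node _ t₀ t₁ _ _ d₀ d₁ d) (false ∷ s) (false ∷ s′) p q = cong (false ∷_) (child-disj t₀ s s′ p q)
  child-disj (node _ t₀ t₁ _ _ d₀ d₁ d) (true ∷ s) (true ∷ s′) p q = cong (true ∷_) (child-disj t₁ s s′ p q)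

  child-touch : ∀ {A q R U} (t : Tree⁺ A q R U) s b → suc (length s) ≤ q → Touch (child t s) (child t (s ∷ʳ b))
  child-touch (node _ t₀ t₁ e₀ e₁ _ _ _) [] false _ = e₀
  child-touch (node _ t₀ t₁ e₀ e₁ _ _ _) [] true _ = e₁
  child-touch (node _ t₀ t₁ e₀ e₁ _ _ _) (false ∷ s) b (s≤s p) = child-touch t₀ s b p
  child-touch (node _ t₀ t₁ e₀ e₁ _ _ _) (true ∷ s)  b (s≤s p) = child-touch t₁ s b p

  leaf-touch : ∀ {A q R U} (t : Tree⁺ A q R U) s → length s ≡ q → Touch (child t s) A
  leaf-touch (leaf _ e) [] _ = e
  leaf-touch (node _ t₀ t₁ _ _ _ _ _) (false ∷ s) refl = leaf-touch t₀ s refl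
  leaf-touch (node _ t₀ t₁ _ _ _ _ _) (true ∷ s)  refl = leaf-touch t₁ s refl

  Γ⁺-model : ∀ {A ℓ R U} → Conn A → Disj A U → Tree⁺ A ℓ R U → Γ⁺ ℓ ≼ G
  Γ⁺-model {A} {ℓ} cA A#U t = model B B-conn B-disj B-touch
    where
    B : Maybe (TreeV ℓ) → Sub
    B nothing        = A
    B (just (s , _)) = child t (reverse s)
    same : ∀ {s s′} l l′ → s ≡ s′ → _≡_ {A = Maybe (TreeV ℓ)} (just (s , l)) (just (s′ , l′))
    same l l′ refl = cong (λ p → just (_ , p)) (≤-irrelevant l l′)
    B-conn : ∀ h → Conn (B h)
    B-conn nothing = cA
    B-conn (just (s , p)) = child-conn t (reverse s) (≤-trans (≤-reflexive (length-reverse s)) p)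
    B-disj : ∀ h h′ {x} → x ∈ B h → x ∈ B h′ → h ≡ h′
    B-disj nothing nothing _ _ = refl
    B-disj nothing (just (s , _)) p q = ⊥-elim (A#U p (child⊆ t (reverse s) q))
    B-disj (just (s , _)) nothing p q = ⊥-elim (A#U q (child⊆ t (reverse s) p))
    B-disj (just (s , l)) (just (s′ , l′)) p q = same l l′ (reverse-injective (child-disj t (reverse s) (reverse s′) p q))
    B-child : ∀ x y → Child x y → Touch (B (just x)) (B (just y))
    B-child (s , p) (_ , q) (b , refl) = subst (λ r → Touch (child t (reverse s)) (child t r)) (≡-sym (unfold-reverse b s))
      (child-touch t (reverse s) b (≤-trans (≤-reflexive (cong suc (length-reverse s))) q))
    B-touch : ∀ h h′ → PlusE ℓ h h′ → Touch (B h) (B h′)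
    B-touch (just x) (just y) (inj₁ e) = B-child x y e
    B-touch (just x) (just y) (inj₂ e) = touch-sym (B-child y x e)
    B-touch (just (s , _)) nothing e = leaf-touch t (reverse s) (trans (length-reverse s) e)
    B-touch nothing (just (s , _)) e = touch-sym (leaf-touch t (reverse s) (trans (length-reverse s) e))

  middle : ∀ {p X Y W} → Nabla p X Y W → Inner p → Sub
  middle (base {W = W} _ _ _) _ = W
  middle (glue {M = M} _ _ _ _ _ _ _ _) (inj₁ tt) = M
  middle (glue _ l r _ _ _ _ _) (inj₂ (inj₁ i)) = middle l i
  middle (glue _ l r _ _ _ _ _) (inj₂ (inj₂ i)) = middle r i

  middle⊆ : ∀ {p X Y W} (ν : Nabla p X Y W) i → middle ν i ⊆ W
  middle⊆ (base _ _ _) _ q = q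
  middle⊆ (glue _ _ _ _ _ _ _ _) (inj₁ tt) q = ∪ˡ q
  middle⊆ (glue _ l r _ _ _ _ _) (inj₂ (inj₁ i)) q = ∪ʳ (∪ˡ (middle⊆ l i q))
  middle⊆ (glue _ l r _ _ _ _ _) (inj₂ (inj₂ i)) q = ∪ʳ (∪ʳ (middle⊆ r i q))

  middle-conn : ∀ {p X Y W} (ν : Nabla p X Y W) i → Conn (middle ν i)
  middle-conn (base c _ _) _ = c
  middle-conn (glue c _ _ _ _ _ _ _) (inj₁ tt) = c
  middle-conn (glue _ l r _ _ _ _ _) (inj₂ (inj₁ i)) = middle-conn l i
  middle-conn (glue _ l r _ _ _ _ _) (inj₂ (inj₂ i)) = middle-conn r i

  middle-disj : ∀ {p X Y W} (ν : Nabla p X Y W) i j {x} → x ∈ middle ν i → x ∈ middle ν j → i ≡ j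
  middle-disj (base _ _ _) tt tt _ _ = refl
  middle-disj (glue _ l r _ _ d₁ d₂ d) (inj₁ tt) (inj₁ tt) _ _ = refl
  middle-disj (glue _ l r _ _ d₁ d₂ d) (inj₁ tt) (inj₂ (inj₁ j)) p q = ⊥-elim (d₁ p (middle⊆ l j q))
  middle-disj (glue _ l r _ _ d₁ d₂ d) (inj₁ tt) (inj₂ (inj₂ j)) p q = ⊥-elim (d₂ p (middle⊆ r j q))
  middle-disj (glue _ l r _ _ d₁ d₂ d) (inj₂ (inj₁ i)) (inj₁ tt) p q = ⊥-elim (d₁ q (middle⊆ l i p))
  middle-disj (glue _ l r _ _ d₁ d₂ d) (inj₂ (inj₂ i)) (inj₁ tt) p q = ⊥-elim (d₂ q (middle⊆ r i p))
  middle-disj (glue _ l r _ _ d₁ d₂ d) (inj₂ (inj₁ i)) (inj₂ (inj₁ j)) p q = cong (λ k → inj₂ (inj₁ k)) (middle-disj l i j p q)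
  middle-disj (glue _ l r _ _ d₁ d₂ d) (inj₂ (inj₁ i)) (inj₂ (inj₂ j)) p q = ⊥-elim (d (middle⊆ l i p) (middle⊆ r j q))
  middle-disj (glue _ l r _ _ d₁ d₂ d) (inj₂ (inj₂ i)) (inj₂ (inj₁ j)) p q = ⊥-elim (d (middle⊆ l j q) (middle⊆ r i p))
  middle-disj (glue _ l r _ _ d₁ d₂ d) (inj₂ (inj₂ i)) (inj₂ (inj₂ j)) p q = cong (λ k → inj₂ (inj₂ k)) (middle-disj r i j p q)

  all-bags : ∀ {p X Y W} → Nabla p X Y W → NV p → Sub
  all-bags {X = X} ν left = X
  all-bags {Y = Y} ν right = Y
  all-bags ν (inner i) = middle ν i

  root-touch : ∀ {p X Y W} (ν : Nabla p X Y W) → Touch X Y → ∀ u v → RootE u v → Touch (all-bags ν u) (all-bags ν v)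
  root-touch ν e _ _ (inj₁ (refl , refl)) = e
  root-touch ν e _ _ (inj₂ (refl , refl)) = touch-sym e

  all-touch : ∀ {p X Y W} (ν : Nabla p X Y W) → Touch X Y → ∀ u v → NE p u v → Touch (all-bags ν u) (all-bags ν v)
  all-touch (base _ s t) e left left q = ⊥-elim (q refl)
  all-touch (base _ s t) e left right q = e
  all-touch (base _ s t) e left (inner tt) q = touch-sym s
  all-touch (base _ s t) e right left q = touch-sym e
  all-touch (base _ s t) e right right q = ⊥-elim (q refl)
  all-touch (base _ s t) e right (inner tt) q = touch-sym t
  all-touch (base _ s t) e (inner tt) left q = s
  all-touch (base _ s t) e (inner tt) right q = t
  all-touch (base _ s t) e (inner tt) (inner tt) q = ⊥-elim (q refl)
  all-touch ν@(glue _ l r s t _ _ _) e u v (inj₁ q) = root-touch ν e u v q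
  all-touch {suc p} ν@(glue _ l r s t _ _ _) e _ _ (inj₂ (inj₁ (a , b , q , refl , refl))) =
    touch-mono (to a) (to b) (all-touch l (touch-sym s) a b q)
    where
    to : ∀ a → all-bags l a ⊆ all-bags ν (emb₁ a)
    to left x = x
    to right x = x
    to (inner i) x = x
  all-touch {suc p} ν@(glue _ l r s t _ _ _) e _ _ (inj₂ (inj₂ (a , b , q , refl , refl))) =
    touch-mono (to a) (to b) (all-touch r t a b q)
    where
    to : ∀ a → all-bags r a ⊆ all-bags ν (emb₂ a)
    to left x = x
    to right x = x
    to (inner i) x = x

  ∇-model : ∀ {p a b H} → NablaAt p a b H → ∇ (suc p) ≼ G
  ∇-model {p} N = model (all-bags nabla) bags-conn bags-disj (all-touch nabla touch)
    where
    open NablaAt N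
    bags-conn : ∀ h → Conn (all-bags nabla h)
    bags-conn left = X-conn
    bags-conn right = Y-conn
    bags-conn (inner i) = middle-conn nabla i
    bags-disj : ∀ h h′ {x} → x ∈ all-bags nabla h → x ∈ all-bags nabla h′ → h ≡ h′
    bags-disj left left _ _ = refl
    bags-disj right right _ _ = refl
    bags-disj left right p q = ⊥-elim (X#Y p q)
    bags-disj right left p q = ⊥-elim (X#Y q p)
    bags-disj left (inner j) p q = ⊥-elim (X#W p (middle⊆ nabla j q))
    bags-disj right (inner j) p q = ⊥-elim (Y#W p (middle⊆ nabla j q))
    bags-disj (inner i) left p q = ⊥-elim (X#W q (middle⊆ nabla i p))
    bags-disj (inner i) right p q = ⊥-elim (Y#W q (middle⊆ nabla i p))
    bags-disj (inner i) (inner j) p q = cong inner (middle-disj nabla i j p q)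

  everything : Sub
  everything _ = true

  everything-twoConn : TwoConnected G → TwoConn everything
  everything-twoConn (_ , _ , cut) {v} _ _ x≢v y≢v = from-WalkIn (λ z≢v → ∖⁺ (mem refl) (≢⇒∉ z≢v)) (proj₂ (cut v) _ _ x≢v y≢v)

  two-distinct : ∀ {m} → 3 ≤ m → ∃[ a ] ∃[ b ] (_≢_ {A = Fin m} a b)
  two-distinct (s≤s (s≤s _)) = zero , suc zero , λ ()

  -- `Nabla p` models ∇ of index `suc p`, since the pattern is encoded at the predecessor. `ℓ`
  -- enters twice: as the height at which a crown met on the way ends the search, and as the height
  -- of the crown built by parallel steps. The ends `a` and `b` are arbitrary distinct vertices.
  Γ⁺-or-∇ : ∀ p ℓ → TwoConnected G → Γ (solve-height ℓ p ℓ) ≼ G → (Γ⁺ ℓ ≼ G) ⊎ (∇ (suc p) ≼ G)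
  Γ⁺-or-∇ p ℓ 2c μ with tree-of μ | two-distinct (proj₁ 2c)
  ... | _ , _ , t | a , b , a≢b
    with Solve.solve (Γ⁺ ℓ ≼ G) ℓ Γ⁺-model p ℓ (everything-twoConn 2c) t (λ _ → mem refl) {a} {b} (mem refl) (mem refl) a≢b
  ... | inj₁ won = inj₁ won
  ... | inj₂ (inj₁ ν) = inj₂ (∇-model ν)
  ... | inj₂ (inj₂ κ) = inj₁ (Γ⁺-model κ.Y-conn (disj-sym κ.T#Y) κ.tree)
    where module κ = CrownAt κ

theorem1p4 : ∀ (ℓ : ℕ) → 1 ≤ ℓ →
    ∃[ k ] (∀ (G : Graph) → TwoConnected G → Γ k ≼ G →
    (Γ⁺ ℓ ≼ G) ⊎ (∇ ℓ ≼ G))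
theorem1p4 (suc p) (s≤s _) = solve-height (suc p) p (suc p) , λ G 2c μ → Minors.Γ⁺-or-∇ G p (suc p) 2c μ
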